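{- Let $\rho_1,\rho_2:W_F\to\mathrm{GL}_2(\overline{\mathbb{Q}}_\ell)$ be a supercuspidal representation and a special representation, respectively, such that $\rho_1(W_F),\rho_2(W_F)\subset\mathrm{GL}_2(\mathcal{O}_K)$, with associated Weil--Deligne representations $\mathrm{Ind}_{W_E}^{W_F}\xi$ and $\chi\omega\oplus\chi$, where $E/F$ is a quadratic extension, $\xi$ is a $1$-dimensional representation of $W_E$ and $\chi$ is a $1$-dimensional representation of $W_F$. Suppose (as may be assumed without loss of generality) that there are upper triangular matrices $U_j=\begin{pmatrix}a_j&b_j\\0&d_j\end{pmatrix}\in\mathrm{GL}_2(K)$, $j=1,2$, such that for all $k\in\mathbb{Z}$, $\tau\in I_F$, $$\rho_1(\Phi^k\tau)=U_1\,\mathrm{Ind}_{W_E}^{W_F}\xi(\Phi^k\tau)\,U_1^{ -1},$$ $$\rho_2(\Phi^k\tau)=\begin{pmatrix}\chi\omega(\Phi^k\tau)&\frac{a_2}{d_2}t_\ell(\tau)\chi\omega(\Phi^k\tau)+\frac{b_2}{d_2}(\chi(\Phi^k\tau)-\chi\omega(\Phi^k\tau))\\0&\chi(\Phi^k\tau)\end{pmatrix}.$$ Suppose that $a_2/d_2\in\mathcal{O}_K^\times$. If $E/F$ is ramified, then $\overline{\rho}_1$ and $\overline{\rho}_2$ are not isomorphic.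
   Context: $p\neq\ell$ are odd primes. $F/\mathbb{Q}_p$ is a finite extension with residue field of order $q$, Weil group $W_F$ and inertia group $I_F$. $\Phi\in W_F$ is a fixed Frobenius element, and $\omega$ is the character of $W_F$ with $\omega(\Phi^k\tau)=q^{ -k}$ for $k\in\mathbb{Z}$, $\tau\in I_F$. $t_\ell:I_F\to\mathbb{Z}_\ell$ is a fixed continuous surjective homomorphism; it satisfies $t_\ell(g\tau g^{ -1})=\omega(g)t_\ell(\tau)$. $K/\mathbb{Q}_\ell$ is a finite extension with ring of integers $\mathcal{O}_K$ and maximal ideal $\lambda$. A bar denotes reduction modulo $\lambda$. All representations are continuous. For a quadratic extension $E/F$, $W_E\subset W_F$ has index $2$, $\sigma\in W_F\setminus W_E$ is a fixed element, $\xi^\sigma(h)=\xi(\sigma h\sigma^{ -1})$, and $\mathrm{Ind}_{W_E}^{W_F}\xi$ denotes the matrix representation given for $h\in W_E$ by $$h\mapsto\begin{pmatrix}\xi(h)&0\\0&\xi^\sigma(h)\end{pmatrix},\qquad h\sigma\mapsto\begin{pmatrix}0&\xi(h)\\ \xi(\sigma h\sigma)&0\end{pmatrix}.$$ The Weil--Deligne representation associated with a continuous $\rho$ is $(\rho_\Phi,N_\rho)$, where $N_\rho$ is the unique nilpotent matrix with $\rho(\tau)=\exp(t_\ell(\tau)N_\rho)$ for $\tau$ in some open subgroup of $I_F$, and $\rho_\Phi(\Phi^k\tau)=\rho(\Phi^k\tau)\exp(-t_\ell(\tau)N_\rho)$. $\rho$ is (nonexceptional) supercuspidal if its Weil--Deligne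 representation is isomorphic to $(\mathrm{Ind}_{W_E}^{W_F}\xi,0)$ with $E/F$ quadratic and $\xi\neq\xi^\sigma$ (for $p$ odd all supercuspidals are of this form), and special if it is isomorphic to $\left(\chi\omega\oplus\chi,\begin{pmatrix}0&1\\0&0\end{pmatrix}\right)$. -}

module Defs where

open import Level using (0ℓ)
import Level
open import Algebra.Bundles using (CommutativeRing; RawRing; Group; RawMonoid)
open import Algebra.Apartness.Bundles using (HeytingField)
open import Algebra.Morphism.Structures
  using (IsRingIsomorphism)
open import Algebra.Morphism.Bundles using (RingHomomorphism; MonoidHomomorphism)
import Algebra.Morphism.Construct.Composition as Comp
import Algebra.Morphism.Construct.Identity as Id
import Algebra.Properties.Monoid.Mult as Mult
import Algebra.Properties.Semiring.Exp as Exp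
import Algebra.Properties.Semiring.Sum as Sum
import Algebra.Properties.Group as GroupP
import Algebra.Properties.AbelianGroup as AbelianGroupP
import Algebra.Properties.Ring as RingP
import Algebra.Solver.Ring.NaturalCoefficients.Default as SemiringSolver
open import Data.Nat.Base as ℕ using (ℕ; zero; suc)
open import Data.Fin.Base using (Fin; toℕ; zero; suc)
open import Data.Integer.Base as ℤ using (ℤ; +_; -[1+_])
import Data.Integer.Properties as ℤ
open import Data.Integer.Divisibility.Signed
  using (_∣_; ∣m∣n⇒∣m+n; ∣m⇒∣-m; ∣n⇒∣m*n; ∣m⇒∣m*n; divides)
import Data.Integer.Solver as ℤSolver
open import Data.Product.Base using (Σ; ∃; ∃₂; _×_; _,_; proj₁; proj₂)
open import Data.Sum.Base using (_⊎_; inj₁; inj₂)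
open import Function.Base using (_∘_; id)
open import Function.Definitions using (Surjective)
open import Relation.Binary.Core using (Rel)
open import Relation.Binary.Structures using (IsPreorder)
open import Relation.Binary.PropositionalEquality.Core as ≡ using (_≡_; _≢_)
import Relation.Binary.Reasoning.Setoid as SetoidReasoning
open import Relation.Nullary.Negation.Core using (¬_)
open import Relation.Unary using (Pred; _∈_; _∉_; _∩_; U)

ZornsLemma : Set₂
ZornsLemma = ∀ {A : Set₁} {_≲_ : Rel A (Level.suc 0ℓ)} → IsPreorder _≡_ _≲_ →
  (∀ (C : Pred A (Level.suc 0ℓ)) → (∀ {x y} → x ∈ C → y ∈ C → x ≲ y ⊎ y ≲ x) →
     ∃ λ u → ∀ {x} → x ∈ C → x ≲ u) →
  ∃ λ m → ∀ {x} → m ≲ x → x ≲ m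

-- ℤₚ = lim ℤ/pⁿ: seq n is a representative of the class modulo pⁿ.
record ℤₚ (p : ℕ) : Set where
  constructor mkℤₚ
  field
    seq      : ℕ → ℤ
    coherent : ∀ n → + (p ℕ.^ n) ∣ seq (suc n) ℤ.- seq n

open ℤₚ public

-- ℚₚ = ℤₚ[1/p]: (num , exp) stands for num / p^exp.
record ℚₚ (p : ℕ) : Set where
  constructor _/p^_
  field
    num : ℤₚ p
    exp : ℕ

module _ (p : ℕ) where

  private
    ∣0 : ∀ k x → k ∣ x ℤ.- x
    ∣0 k x = divides (+ 0) (ℤ.+-inverseʳ x)

    ∣-resp : ∀ {k x y} → x ≡ y → k ∣ x → k ∣ y
    ∣-resp ≡.refl d = d

    open ℤSolver.+-*-Solver

    add-diff : ∀ a' a b' b →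
      (a' ℤ.- a) ℤ.+ (b' ℤ.- b) ≡ (a' ℤ.+ b') ℤ.- (a ℤ.+ b)
    add-diff = solve 4
      (λ a' a b' b → (a' :- a) :+ (b' :- b) := (a' :+ b') :- (a :+ b)) ≡.refl

    mul-diff : ∀ a' a b' b →
      a' ℤ.* (b' ℤ.- b) ℤ.+ (a' ℤ.- a) ℤ.* b ≡ a' ℤ.* b' ℤ.- a ℤ.* b
    mul-diff = solve 4
      (λ a' a b' b → a' :* (b' :- b) :+ (a' :- a) :* b := a' :* b' :- a :* b) ≡.refl

    neg-diff : ∀ a' a → ℤ.- (a' ℤ.- a) ≡ (ℤ.- a') ℤ.- (ℤ.- a)
    neg-diff = solve 2 (λ a' a → :- (a' :- a) := (:- a') :- (:- a)) ≡.refl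

  fromℤ : ℤ → ℤₚ p
  fromℤ z = mkℤₚ (λ _ → z) (λ n → ∣0 (+ (p ℕ.^ n)) z)

  ℤₚ-rawRing : RawRing 0ℓ 0ℓ
  ℤₚ-rawRing = record
    { Carrier = ℤₚ p
    ; _≈_     = λ x y → ∀ n → + (p ℕ.^ n) ∣ seq x n ℤ.- seq y n
    ; _+_     = λ x y → mkℤₚ (λ n → seq x n ℤ.+ seq y n) (λ n →
        ∣-resp (add-diff (seq x (suc n)) (seq x n) (seq y (suc n)) (seq y n))
          (∣m∣n⇒∣m+n (coherent x n) (coherent y n)))
    ; _*_     = λ x y → mkℤₚ (λ n → seq x n ℤ.* seq y n) (λ n →
        ∣-resp (mul-diff (seq x (suc n)) (seq x n) (seq y (suc n)) (seq y n))
          (∣m∣n⇒∣m+n (∣n⇒∣m*n (seq x (suc n)) (coherent y n))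
                     (∣m⇒∣m*n (seq y n) (coherent x n))))
    ; -_      = λ x → mkℤₚ (λ n → ℤ.- seq x n) (λ n →
        ∣-resp (neg-diff (seq x (suc n)) (seq x n)) (∣m⇒∣-m (coherent x n)))
    ; 0#      = fromℤ (+ 0)
    ; 1#      = fromℤ (+ 1)
    }

  ℚₚ-rawRing : RawRing 0ℓ 0ℓ
  ℚₚ-rawRing = record
    { Carrier = ℚₚ p
    ; _≈_     = λ { (a /p^ k) (b /p^ l) → a * p^ l ≈ b * p^ k }
    ; _+_     = λ { (a /p^ k) (b /p^ l) → (a * p^ l + b * p^ k) /p^ (k ℕ.+ l) }
    ; _*_     = λ { (a /p^ k) (b /p^ l) → (a * b) /p^ (k ℕ.+ l) }
    ; -_      = λ { (a /p^ k) → (- a) /p^ k }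
    ; 0#      = 0# /p^ 0
    ; 1#      = 1# /p^ 0
    }
    where
    open RawRing ℤₚ-rawRing
    p^_ : ℕ → ℤₚ p
    p^ k = fromℤ (+ (p ℕ.^ k))

ℤₚ⇒ℚₚ : ∀ {p} → ℤₚ p → ℚₚ p
ℤₚ⇒ℚₚ a = a /p^ 0

-- Given excluded middle, x # y means x ≉ y, and these are the classical fields.
Field : Set₁
Field = HeytingField 0ℓ 0ℓ 0ℓ

module FieldOps (K : Field) where
  open HeytingField K public using (Carrier; #⇒invertible; tight)
  commutativeRing : CommutativeRing 0ℓ 0ℓ
  commutativeRing =
    record { isCommutativeRing = HeytingField.isCommutativeRing K }
  open CommutativeRing commutativeRing public
    hiding (Carrier; zero)
  open Exp semiring public using (_^_)
  open Sum semiring public using (sum)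

  natural : ℕ → Carrier
  natural n = n ×₁ 1#
    where open Mult +-monoid using () renaming (_×_ to _×₁_)

∣_∣ : Field → Set
∣ K ∣ = HeytingField.Carrier K

fieldRing : Field → RawRing 0ℓ 0ℓ
fieldRing = FieldOps.rawRing

open RingHomomorphism using (⟦_⟧)
open MonoidHomomorphism using () renaming (⟦_⟧ to ⟪_⟫)

_∘ʰ_ : ∀ {R S : RawRing 0ℓ 0ℓ} {K : Field} → RingHomomorphism S (fieldRing K) →
  RingHomomorphism R S → RingHomomorphism R (fieldRing K)
_∘ʰ_ {K = K} g f = record
  { ⟦_⟧ = ⟦ g ⟧ ∘ ⟦ f ⟧
  ; isRingHomomorphism = Comp.isRingHomomorphism (FieldOps.trans K)
      (RingHomomorphism.isRingHomomorphism f) (RingHomomorphism.isRingHomomorphism g)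
  }

module Extension {R : RawRing 0ℓ 0ℓ} (K : Field) (ι : RingHomomorphism R (fieldRing K)) where
  open FieldOps K
  private module R = RawRing R

  combination : ∀ {n} → (Fin n → Carrier) → (Fin n → R.Carrier) → Carrier
  combination b c = sum (λ i → ⟦ ι ⟧ (c i) * b i)

  Span : ∀ {n} → (Fin n → Carrier) → Pred Carrier 0ℓ
  Span b x = ∃ λ c → x ≈ combination b c

  LinearlyIndependent : ∀ {n} → (Fin n → Carrier) → Set
  LinearlyIndependent b = ∀ c → combination b c ≈ 0# → ∀ i → c i R.≈ R.0#

-- The value at x of the monic polynomial Xⁿ + Σ cᵢ Xⁱ.
monic : (K : Field) → ∀ {n} → (Fin n → ∣ K ∣) → ∣ K ∣ → ∣ K ∣
monic K {n} c x = x ^ n + sum (λ i → c i * x ^ toℕ i)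
  where open FieldOps K

record FiniteExtensionOfℚₚ (p : ℕ) : Set₁ where
  field
    asField : Field
    ι      : RingHomomorphism (ℚₚ-rawRing p) (fieldRing asField)
  open Extension asField ι
  field
    degree      : ℕ
    basis       : Fin degree → ∣ asField ∣
    spanning    : ∀ x → x ∈ Span basis
    independent : LinearlyIndependent basis

record AlgebraicClosure (K : Field) : Set₁ where
  field
    asField : Field
    ι      : RingHomomorphism (fieldRing K) (fieldRing asField)
  open FieldOps asField
  field
    closed    : ∀ {n} (c : Fin (suc n) → Carrier) → ∃ λ x → monic asField c x ≈ 0#
    algebraic : ∀ x → ∃₂ λ n (c : Fin n → ∣ K ∣) → monic asField (⟦ ι ⟧ ∘ c) x ≈ 0#

-- A is an algebraic extension of ℚₚ.
module Integers {p : ℕ} (A : Field) (ι : RingHomomorphism (ℚₚ-rawRing p) (fieldRing A)) where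
  open FieldOps A

  Integral : Pred Carrier 0ℓ
  Integral x = ∃₂ λ n (c : Fin n → ℤₚ p) → monic A (⟦ ι ⟧ ∘ ℤₚ⇒ℚₚ ∘ c) x ≈ 0#

  𝓞 : Pred Carrier 0ℓ → Pred Carrier 0ℓ
  𝓞 L = L ∩ Integral

  infix 4 _∣[_]_
  _∣[_]_ : Carrier → Pred Carrier 0ℓ → Carrier → Set
  x ∣[ O ] y = ∃ λ z → z ∈ O × y ≈ x * z

  -- ϖ is a nonzero element generating a maximal ideal of O, where maximality
  -- of (ϖ) means that it is proper and (ϖ) + (x) = O for x in O outside (ϖ).
  record IsUniformiser (O : Pred Carrier 0ℓ) (ϖ : Carrier) : Set where
    field
      mem     : ϖ ∈ O
      nonzero : ¬ ϖ ≈ 0#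
      proper  : ¬ ϖ ∣[ O ] 1#
      maximal : ∀ {x} → x ∈ O → ¬ ϖ ∣[ O ] x → ∃ λ y → y ∈ O × ϖ ∣[ O ] (1# - x * y)

  -- The quotient O/ϖ has exactly q elements.
  record HasResidueOrder (O : Pred Carrier 0ℓ) (ϖ : Carrier) (q : ℕ) : Set where
    field
      rep       : Fin q → Carrier
      rep-mem   : ∀ i → rep i ∈ O
      injective : ∀ {i j} → ϖ ∣[ O ] (rep i - rep j) → i ≡ j
      exhaust   : ∀ {x} → x ∈ O → ∃ λ i → ϖ ∣[ O ] (x - rep i)

  -- |x - y| ≤ |pⁿ|.
  near : ℕ → Carrier → Carrier → Set
  near n x y = (natural p ^ n) ∣[ Integral ] (x - y)

module _ {p : ℕ} (F : FiniteExtensionOfℚₚ p) where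
  open FiniteExtensionOfℚₚ F
  open Integers asField ι

  UniformiserOf : ∣ asField ∣ → Set
  UniformiserOf = IsUniformiser (𝓞 U)

  ResidueOrder : ∣ asField ∣ → ℕ → Set
  ResidueOrder = HasResidueOrder (𝓞 U)

module _ {a ℓ b} (G : Group a ℓ) (P : Pred (Group.Carrier G) b) where
  open Group G

  subgroup : (∀ {x y} → x ∈ P → y ∈ P → x ∙ y ∈ P) → ε ∈ P →
             (∀ {x} → x ∈ P → x ⁻¹ ∈ P) → Group _ ℓ
  subgroup ∙-closed ε-closed ⁻¹-closed = record
    { Carrier = Σ Carrier P
    ; _≈_ = λ x y → proj₁ x ≈ proj₁ y
    ; _∙_ = λ { (x , px) (y , py) → x ∙ y , ∙-closed px py }
    ; ε   = ε , ε-closed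
    ; _⁻¹ = λ { (x , px) → x ⁻¹ , ⁻¹-closed px }
    ; isGroup = record
      { isMonoid = record
        { isSemigroup = record
          { isMagma = record
            { isEquivalence = record { refl = refl ; sym = sym ; trans = trans }
            ; ∙-cong = ∙-cong
            }
          ; assoc = λ _ _ _ → assoc _ _ _
          }
        ; identity = (λ _ → identityˡ _) , (λ _ → identityʳ _)
        }
      ; inverse = (λ _ → inverseˡ _) , (λ _ → inverseʳ _)
      ; ⁻¹-cong = ⁻¹-cong
      }
    }

module ℤPower {a ℓ} (G : Group a ℓ) where
  open Group G
  open Mult monoid using () renaming (_×_ to _times_)

  infixr 8 _^ᶻ_
  _^ᶻ_ : Carrier → ℤ → Carrier
  g ^ᶻ (+ n)    = n times g
  g ^ᶻ -[1+ n ] = suc n times (g ⁻¹)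

  private
    open SetoidReasoning setoid
    open GroupP G using (\\-leftDividesˡ; \\-leftDividesʳ)

    ^-suc : ∀ g k → g ^ᶻ ℤ.suc k ≈ g ∙ g ^ᶻ k
    ^-suc g (+ n)          = refl
    ^-suc g -[1+ zero ]    = sym (\\-leftDividesˡ g ε)
    ^-suc g -[1+ suc n ]   = sym (\\-leftDividesˡ g _)

    ^-pred : ∀ g k → g ^ᶻ ℤ.pred k ≈ g ⁻¹ ∙ g ^ᶻ k
    ^-pred g (+ zero)      = refl
    ^-pred g (+ suc n)     = sym (\\-leftDividesʳ g _)
    ^-pred g -[1+ n ]      = refl

  ^ᶻ-homo-+ : ∀ g k l → g ^ᶻ (k ℤ.+ l) ≈ g ^ᶻ k ∙ g ^ᶻ l
  ^ᶻ-homo-+ g (+ zero) l = begin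
    g ^ᶻ (+ 0 ℤ.+ l)       ≡⟨ ≡.cong (g ^ᶻ_) (ℤ.+-identityˡ l) ⟩
    g ^ᶻ l                 ≈⟨ identityˡ _ ⟨
    ε ∙ g ^ᶻ l             ∎
  ^ᶻ-homo-+ g (+ suc n) l = begin
    g ^ᶻ (+ suc n ℤ.+ l)        ≡⟨ ≡.cong (g ^ᶻ_) (ℤ.+-assoc (+ 1) (+ n) l) ⟩
    g ^ᶻ ℤ.suc (+ n ℤ.+ l)      ≈⟨ ^-suc g (+ n ℤ.+ l) ⟩
    g ∙ g ^ᶻ (+ n ℤ.+ l)        ≈⟨ ∙-congˡ (^ᶻ-homo-+ g (+ n) l) ⟩
    g ∙ (g ^ᶻ (+ n) ∙ g ^ᶻ l)   ≈⟨ assoc _ _ _ ⟨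
    g ^ᶻ (+ suc n) ∙ g ^ᶻ l     ∎
  ^ᶻ-homo-+ g -[1+ zero ] l = begin
    g ^ᶻ (-[1+ 0 ] ℤ.+ l)       ≈⟨ ^-pred g l ⟩
    g ⁻¹ ∙ g ^ᶻ l               ≈⟨ ∙-congʳ (identityʳ _) ⟨
    g ^ᶻ -[1+ 0 ] ∙ g ^ᶻ l      ∎
  ^ᶻ-homo-+ g -[1+ suc n ] l = begin
    g ^ᶻ (-[1+ suc n ] ℤ.+ l)        ≡⟨ ≡.cong (g ^ᶻ_) (ℤ.+-assoc -[1+ 0 ] -[1+ n ] l) ⟩
    g ^ᶻ ℤ.pred (-[1+ n ] ℤ.+ l)     ≈⟨ ^-pred g (-[1+ n ] ℤ.+ l) ⟩
    g ⁻¹ ∙ g ^ᶻ (-[1+ n ] ℤ.+ l)     ≈⟨ ∙-congˡ (^ᶻ-homo-+ g -[1+ n ] l) ⟩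
    g ⁻¹ ∙ (g ^ᶻ -[1+ n ] ∙ g ^ᶻ l)  ≈⟨ assoc _ _ _ ⟨
    g ^ᶻ -[1+ suc n ] ∙ g ^ᶻ l       ∎

module QuadraticIdentities (R : CommutativeRing 0ℓ 0ℓ) where
  open CommutativeRing R
  open SetoidReasoning setoid
  private module S = SemiringSolver commutativeSemiring
  open S using (_:+_; _:*_; _:=_)

  agree : ∀ {y z} b₀ b₁ c₀ c₁ → y * b₀ ≈ z * b₀ → y * b₁ ≈ z * b₁ →
    1# ≈ c₀ * b₀ + (c₁ * b₁ + 0#) → y ≈ z
  agree {y} {z} b₀ b₁ c₀ c₁ e₀ e₁ one = begin
    y                              ≈⟨ expand y ⟩
    c₀ * (y * b₀) + c₁ * (y * b₁)  ≈⟨ +-cong (*-congˡ e₀) (*-congˡ e₁) ⟩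
    c₀ * (z * b₀) + c₁ * (z * b₁)  ≈⟨ expand z ⟨
    z                              ∎
    where
    expand : ∀ y → y ≈ c₀ * (y * b₀) + c₁ * (y * b₁)
    expand y = begin
      y                                ≈⟨ *-identityʳ y ⟨
      y * 1#                           ≈⟨ *-congˡ one ⟩
      y * (c₀ * b₀ + (c₁ * b₁ + 0#))   ≈⟨ *-congˡ (+-congˡ (+-identityʳ _)) ⟩
      y * (c₀ * b₀ + c₁ * b₁)          ≈⟨ S.solve 5 (λ y b₀ b₁ c₀ c₁ →
        y :* (c₀ :* b₀ :+ c₁ :* b₁) := c₀ :* (y :* b₀) :+ c₁ :* (y :* b₁))
        refl y b₀ b₁ c₀ c₁ ⟩
      c₀ * (y * b₀) + c₁ * (y * b₁)    ∎

  Root : (a b c d x : Carrier) → Set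
  Root a b c d x = x * x + a * d ≈ (a + d) * x + b * c

  cayley-hamilton : ∀ a b c d x u v →
    x * u ≈ a * u + b * v → x * v ≈ c * u + d * v →
    (x * x + a * d) * u ≈ ((a + d) * x + b * c) * u
  cayley-hamilton a b c d x u v eᵤ eᵥ = begin
    (x * x + a * d) * u
      ≈⟨ S.solve 4 (λ a d x u → (x :* x :+ a :* d) :* u := x :* (x :* u) :+ a :* (d :* u))
           refl a d x u ⟩
    x * (x * u) + a * (d * u)
      ≈⟨ +-congʳ (*-congˡ eᵤ) ⟩
    x * (a * u + b * v) + a * (d * u)
      ≈⟨ S.solve 6 (λ a b d x u v → x :* (a :* u :+ b :* v) :+ a :* (d :* u) :=
           a :* (x :* u) :+ b :* (x :* v) :+ a :* (d :* u)) refl a b d x u v ⟩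
    a * (x * u) + b * (x * v) + a * (d * u)
      ≈⟨ +-congʳ (+-congˡ (*-congˡ eᵥ)) ⟩
    a * (x * u) + b * (c * u + d * v) + a * (d * u)
      ≈⟨ S.solve 7 (λ a b c d x u v →
           a :* (x :* u) :+ b :* (c :* u :+ d :* v) :+ a :* (d :* u) :=
           a :* (x :* u) :+ d :* (a :* u :+ b :* v) :+ b :* (c :* u))
           refl a b c d x u v ⟩
    a * (x * u) + d * (a * u + b * v) + b * (c * u)
      ≈⟨ +-congʳ (+-congˡ (*-congˡ eᵤ)) ⟨
    a * (x * u) + d * (x * u) + b * (c * u)
      ≈⟨ S.solve 6 (λ a b c d x u → a :* (x :* u) :+ d :* (x :* u) :+ b :* (c :* u) :=
           ((a :+ d) :* x :+ b :* c) :* u) refl a b c d x u ⟩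
    ((a + d) * x + b * c) * u  ∎

  second-root : ∀ a b c d x y → Root a b c d x → Root a b c d y →
    (y - x) * (y - ((a + d) - x)) ≈ 0#
  second-root a b c d x y rx ry = begin
    w * (y - (T - x))            ≈⟨ *-congˡ (+-congˡ (GroupP.⁻¹-anti-homo-// +-group T x)) ⟩
    w * (y + (x - T))            ≈⟨ *-congˡ (+-assoc y x (- T)) ⟨
    w * (y + x - T)              ≈⟨ distribˡ w (y + x) (- T) ⟩
    w * (y + x) + w * - T        ≈⟨ +-cong key (sym (RingP.-‿distribʳ-* ring w T)) ⟩
    w * T - w * T                ≈⟨ -‿inverseʳ (w * T) ⟩
    0#                           ∎
    where
    T = a + d
    w = y - x
    y≈x+w : y ≈ x + w
    y≈x+w = sym (trans (sym (+-assoc x y (- x))) (AbelianGroupP.xyx⁻¹≈y +-abelianGroup x y))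
    key : w * (y + x) ≈ w * T
    key = GroupP.∙-cancelˡ +-group (x * x + a * d) _ _ (begin
      x * x + a * d + w * (y + x)        ≈⟨ +-congˡ (*-congˡ (+-congʳ y≈x+w)) ⟩
      x * x + a * d + w * (x + w + x)    ≈⟨ S.solve 4 (λ a d x w →
        x :* x :+ a :* d :+ w :* (x :+ w :+ x) := (x :+ w) :* (x :+ w) :+ a :* d)
        refl a d x w ⟩
      (x + w) * (x + w) + a * d          ≈⟨ +-congʳ (*-cong y≈x+w y≈x+w) ⟨
      y * y + a * d                      ≈⟨ ry ⟩
      T * y + b * c                      ≈⟨ +-congʳ (*-congˡ y≈x+w) ⟩
      T * (x + w) + b * c                ≈⟨ S.solve 5 (λ T b c x w →
        T :* (x :+ w) :+ b :* c := T :* x :+ b :* c :+ w :* T) refl T b c x w ⟩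
      T * x + b * c + w * T              ≈⟨ +-congʳ rx ⟨
      x * x + a * d + w * T              ∎)

  x-[x-y]≈y : ∀ x y → x - (x - y) ≈ y
  x-[x-y]≈y x y = trans (+-congˡ (GroupP.⁻¹-anti-homo-// +-group x y))
    (trans (sym (+-assoc x y (- x))) (AbelianGroupP.xyx⁻¹≈y +-abelianGroup x y))

module Matrices (R : CommutativeRing 0ℓ 0ℓ) where
  open CommutativeRing R

  record M₂ : Set where
    constructor mat
    field
      e₁₁ e₁₂ e₂₁ e₂₂ : Carrier
  open M₂ public

  record Entrywise (_~_ : Rel Carrier 0ℓ) (A B : M₂) : Set where
    constructor entrywise
    field
      r₁₁ : e₁₁ A ~ e₁₁ B
      r₁₂ : e₁₂ A ~ e₁₂ B
      r₂₁ : e₂₁ A ~ e₂₁ B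
      r₂₂ : e₂₂ A ~ e₂₂ B

  record AllEntries (P : Pred Carrier 0ℓ) (A : M₂) : Set where
    constructor allEntries
    field
      p₁₁ : e₁₁ A ∈ P
      p₁₂ : e₁₂ A ∈ P
      p₂₁ : e₂₁ A ∈ P
      p₂₂ : e₂₂ A ∈ P

  infix 4 _≈ₘ_
  _≈ₘ_ : Rel M₂ 0ℓ
  _≈ₘ_ = Entrywise _≈_

  infixl 7 _·_
  _·_ : M₂ → M₂ → M₂
  mat a b c d · mat a' b' c' d' =
    mat (a * a' + b * c') (a * b' + b * d') (c * a' + d * c') (c * b' + d * d')

  infixl 6 _+ₘ_
  _+ₘ_ : M₂ → M₂ → M₂
  mat a b c d +ₘ mat a' b' c' d' = mat (a + a') (b + b') (c + c') (d + d')

  infixr 8 _•_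
  _•_ : Carrier → M₂ → M₂
  x • mat a b c d = mat (x * a) (x * b) (x * c) (x * d)

  1ₘ 0ₘ : M₂
  1ₘ = mat 1# 0# 0# 1#
  0ₘ = mat 0# 0# 0# 0#

  ·-rawMonoid : RawMonoid 0ℓ 0ℓ
  ·-rawMonoid = record { Carrier = M₂ ; _≈_ = _≈ₘ_ ; _∙_ = _·_ ; ε = 1ₘ }

  Inverses : M₂ → M₂ → Set
  Inverses A B = A · B ≈ₘ 1ₘ × B · A ≈ₘ 1ₘ

  Nilpotent : Pred M₂ 0ℓ
  Nilpotent N = ∃ λ n → n times N ≈ₘ 0ₘ
    where open import Algebra.Definitions.RawMonoid ·-rawMonoid
                 using () renaming (_×_ to _times_)

  -- The exponential series of a nilpotent X: the terms Xⁿ/n! with n ≥ 2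
  -- vanish, since a nilpotent 2 × 2 matrix over a field has square zero.
  exp-nilpotent : M₂ → M₂
  exp-nilpotent X = 1ₘ +ₘ X

-- π is a uniformiser of F.
module Galois {p : ℕ} (F : FiniteExtensionOfℚₚ p) (F̄ : AlgebraicClosure (FiniteExtensionOfℚₚ.asField F))
              (π : ∣ FiniteExtensionOfℚₚ.asField F ∣) where
  private
    module F = FiniteExtensionOfℚₚ F
    module F̄ = AlgebraicClosure F̄
  open FieldOps F̄.asField
  open Extension F̄.asField F̄.ι
  open Integers F̄.asField (_∘ʰ_ {K = F̄.asField} F̄.ι F.ι)

  record Automorphism : Set where
    field
      act               : Carrier → Carrier
      isRingIsomorphism : IsRingIsomorphism rawRing rawRing act
      fixesF            : ∀ c → act (⟦ F̄.ι ⟧ c) ≈ ⟦ F̄.ι ⟧ c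
    open IsRingIsomorphism isRingIsomorphism public
      renaming (⟦⟧-cong to cong)

    inv : Carrier → Carrier
    inv x = proj₁ (surjective x)

    act-inv : ∀ x → act (inv x) ≈ x
    act-inv x = proj₂ (surjective x) refl

    inv-act : ∀ x → inv (act x) ≈ x
    inv-act x = injective (act-inv (act x))

  open Automorphism using (act; cong; inv)

  private
    inverse : Automorphism → Automorphism
    inverse g = record
      { act = inv g
      ; isRingIsomorphism = record
        { isRingMonomorphism = record
          { isRingHomomorphism = record
            { isSemiringHomomorphism = record
              { isNearSemiringHomomorphism = record
                { +-isMonoidHomomorphism = record
                  { isMagmaHomomorphism = record
                    { isRelHomomorphism = record { cong = inv-cong }
                    ; homo = λ x y → g.injective (trans (g.act-inv _)
                        (sym (trans (g.+-homo _ _) (+-cong (g.act-inv x) (g.act-inv y)))))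
                    }
                  ; ε-homo = g.injective (trans (g.act-inv _) (sym g.0#-homo))
                  }
                ; *-homo = λ x y → g.injective (trans (g.act-inv _)
                    (sym (trans (g.*-homo _ _) (*-cong (g.act-inv x) (g.act-inv y)))))
                }
              ; 1#-homo = g.injective (trans (g.act-inv _) (sym g.1#-homo))
              }
            ; -‿homo = λ x → g.injective (trans (g.act-inv _)
                (sym (trans (g.-‿homo _) (-‿cong (g.act-inv x)))))
            }
          ; injective = λ {x} {y} eq →
              trans (sym (g.act-inv x)) (trans (g.cong eq) (g.act-inv y))
          }
        ; surjective = λ y → g.act y , λ eq → trans (inv-cong eq) (g.inv-act y)
        }
      ; fixesF = λ c → trans (inv-cong (sym (g.fixesF c))) (g.inv-act _)
      }
      where
      module g = Automorphism g
      inv-cong : ∀ {x y} → x ≈ y → inv g x ≈ inv g y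
      inv-cong {x} {y} eq = g.injective (trans (g.act-inv x) (trans eq (sym (g.act-inv y))))

  G : Group 0ℓ 0ℓ
  G = record
    { Carrier = Automorphism
    ; _≈_ = λ g h → ∀ x → act g x ≈ act h x
    ; _∙_ = λ g h → record
        { act = act g ∘ act h
        ; isRingIsomorphism = Comp.isRingIsomorphism trans
            (Automorphism.isRingIsomorphism h) (Automorphism.isRingIsomorphism g)
        ; fixesF = λ c → trans (cong g (Automorphism.fixesF h c)) (Automorphism.fixesF g c)
        }
    ; ε = record
        { act = id
        ; isRingIsomorphism = Id.isRingIsomorphism rawRing refl
        ; fixesF = λ _ → refl
        }
    ; _⁻¹ = inverse
    ; isGroup = record
      { isMonoid = record
        { isSemigroup = record
          { isMagma = record
            { isEquivalence = record
              { refl  = λ _ → refl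
              ; sym   = λ e x → sym (e x)
              ; trans = λ e f x → trans (e x) (f x)
              }
            ; ∙-cong = λ {g} e f x → trans (cong g (f x)) (e _)
            }
          ; assoc = λ _ _ _ _ → refl
          }
        ; identity = (λ _ _ → refl) , (λ _ _ → refl)
        }
      ; inverse = (λ g x → Automorphism.inv-act g x) , (λ g x → Automorphism.act-inv g x)
      ; ⁻¹-cong = λ {g} {h} e x → Automorphism.injective g
          (trans (Automorphism.act-inv g x)
            (sym (trans (e _) (Automorphism.act-inv h x))))
      }
    }

  open Group G using () renaming (_∙_ to _∘ᴳ_; _⁻¹ to _⁻¹ᴳ)
  open ℤPower G using (_^ᶻ_; ^ᶻ-homo-+)

  -- A subfield of F̄ containing F, of degree n over F.
  record FiniteSubextension (n : ℕ) : Set where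
    field
      basis       : Fin n → Carrier
      independent : LinearlyIndependent basis
      1-closed    : 1# ∈ Span basis
      *-closed    : ∀ {x y} → x ∈ Span basis → y ∈ Span basis → x * y ∈ Span basis
      ⁻¹-closed   : ∀ {x y} → x ∈ Span basis → x * y ≈ 1# → y ∈ Span basis

  ⌊_⌋ : ∀ {n} → FiniteSubextension n → Pred Carrier 0ℓ
  ⌊ L ⌋ = Span (FiniteSubextension.basis L)

  -- e(L/F) = e: for a uniformiser ϖ of L, the elements π and ϖᵉ generate the
  -- same ideal of the ring of integers of L.
  RamificationIndex : ∀ {n} → FiniteSubextension n → ℕ → Set
  RamificationIndex L e = ∃ λ ϖ → IsUniformiser O ϖ ×
    πL ∣[ O ] (ϖ ^ e) × (ϖ ^ e) ∣[ O ] πL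
    where
    O  = 𝓞 ⌊ L ⌋
    πL = ⟦ F̄.ι ⟧ π

  Unramified Ramified : ∀ {n} → FiniteSubextension n → Set
  Unramified L = RamificationIndex L 1
  Ramified L   = ∃ λ e → 1 ℕ.< e × RamificationIndex L e

  -- The maximal unramified extension of F in F̄: the composite of all finite
  -- unramified extensions.
  data Fⁿʳ : Pred Carrier 0ℓ where
    incl   : ∀ {n x} (L : FiniteSubextension n) → Unramified L → x ∈ ⌊ L ⌋ → Fⁿʳ x
    resp   : ∀ {x y} → x ≈ y → Fⁿʳ x → Fⁿʳ y
    +-clos : ∀ {x y} → Fⁿʳ x → Fⁿʳ y → Fⁿʳ (x + y)
    *-clos : ∀ {x y} → Fⁿʳ x → Fⁿʳ y → Fⁿʳ (x * y)
    -‿clos : ∀ {x} → Fⁿʳ x → Fⁿʳ (- x)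
    ⁻¹-clos : ∀ {x y} → Fⁿʳ x → x * y ≈ 1# → Fⁿʳ y

  module Transport (g : Automorphism) where
    open module g = Automorphism g using (0#-homo; 1#-homo; +-homo; *-homo; -‿homo; fixesF)
    open SetoidReasoning setoid

    sum-homo : ∀ {n} (f h : Fin n → Carrier) → (∀ i → act g (f i) ≈ h i) →
      act g (sum f) ≈ sum h
    sum-homo {zero}  f h e = 0#-homo
    sum-homo {suc n} f h e = trans (+-homo _ _)
      (+-cong (e zero) (sum-homo (f ∘ suc) (h ∘ suc) (e ∘ suc)))

    ^-homo : ∀ x n → act g (x ^ n) ≈ act g x ^ n
    ^-homo x zero    = 1#-homo
    ^-homo x (suc n) = trans (*-homo _ _) (*-congˡ (^-homo x n))

    combination-homo : ∀ {n} (b : Fin n → Carrier) c →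
      act g (combination b c) ≈ combination (act g ∘ b) c
    combination-homo b c = sum-homo (λ i → ⟦ F̄.ι ⟧ (c i) * b i)
      (λ i → ⟦ F̄.ι ⟧ (c i) * act g (b i))
      (λ i → trans (*-homo _ _) (*-congʳ (fixesF (c i))))

    span⁺ : ∀ {n} {b : Fin n → Carrier} {x} → x ∈ Span b → act g x ∈ Span (act g ∘ b)
    span⁺ {b = b} (c , e) = c , trans (cong g e) (combination-homo b c)

    span⁻ : ∀ {n} {b : Fin n → Carrier} {x} → x ∈ Span (act g ∘ b) → inv g x ∈ Span b
    span⁻ {b = b} {x} (c , e) = c , g.injective
      (trans (g.act-inv x) (trans e (sym (combination-homo b c))))

    span-resp : ∀ {n} {b : Fin n → Carrier} {x y} → x ≈ y → x ∈ Span b → y ∈ Span b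
    span-resp x≈y (c , e) = c , trans (sym x≈y) e

    image : ∀ {n} → FiniteSubextension n → FiniteSubextension n
    image L = record
      { basis = act g ∘ L.basis
      ; independent = λ c e → L.independent c
          (g.injective (trans (combination-homo L.basis c) (trans e (sym 0#-homo))))
      ; 1-closed = span-resp 1#-homo (span⁺ L.1-closed)
      ; *-closed = λ {x} {y} px py → span-resp
          (trans (*-homo _ _) (*-cong (g.act-inv x) (g.act-inv y)))
          (span⁺ (L.*-closed (span⁻ px) (span⁻ py)))
      ; ⁻¹-closed = λ {x} {y} px e → span-resp (g.act-inv y)
          (span⁺ (L.⁻¹-closed (span⁻ px) (g.injective (begin
            act g (inv g x * inv g y)          ≈⟨ *-homo _ _ ⟩
            act g (inv g x) * act g (inv g y)  ≈⟨ *-cong (g.act-inv x) (g.act-inv y) ⟩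
            x * y                              ≈⟨ e ⟩
            1#                                 ≈⟨ 1#-homo ⟨
            act g 1#                           ∎))))
      }
      where module L = FiniteSubextension L

    integral⁺ : ∀ {x} → x ∈ Integral → act g x ∈ Integral
    integral⁺ {x} (n , c , e) = n , c , (begin
      monic F̄.asField κ (act g x)
        ≈⟨ +-cong (^-homo x n) (sum-homo (λ i → κ i * x ^ toℕ i)
             (λ i → κ i * act g x ^ toℕ i) (λ i →
             trans (*-homo _ _) (*-cong (fixesF _) (^-homo x (toℕ i))))) ⟨
      act g (x ^ n) + act g (sum (λ i → κ i * x ^ toℕ i))
        ≈⟨ +-homo _ _ ⟨
      act g (monic F̄.asField κ x)  ≈⟨ cong g e ⟩
      act g 0#                      ≈⟨ 0#-homo ⟩
      0#                            ∎)
      where κ = λ i → ⟦ F̄.ι ⟧ (⟦ F.ι ⟧ (ℤₚ⇒ℚₚ (c i)))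

  module Stability (g : Automorphism) where
    private
      module g  = Automorphism g
      module T  = Transport g
      module T⁻ = Transport (g ⁻¹ᴳ)

      ∣-cong : ∀ {P : Pred Carrier 0ℓ} {x x' y y'} → x ≈ x' → y ≈ y' →
        x ∣[ P ] y → x' ∣[ P ] y'
      ∣-cong ex ey (z , pz , e) = z , pz , trans (sym ey) (trans e (*-congʳ ex))

      module _ {n} (L : FiniteSubextension n) where
        O O′ : Pred Carrier 0ℓ
        O  = 𝓞 ⌊ L ⌋
        O′ = 𝓞 ⌊ T.image L ⌋

        O⁺ : ∀ {x} → x ∈ O → act g x ∈ O′
        O⁺ (s , i) = T.span⁺ s , T.integral⁺ i

        O⁻ : ∀ {x} → x ∈ O′ → inv g x ∈ O
        O⁻ (s , i) = T.span⁻ s , T⁻.integral⁺ i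

        ∣⁺ : ∀ {x y} → x ∣[ O ] y → act g x ∣[ O′ ] act g y
        ∣⁺ (z , z∈O , e) = act g z , O⁺ z∈O , trans (cong g e) (g.*-homo _ _)

        ∣⁻ : ∀ {x y} → act g x ∣[ O′ ] y → x ∣[ O ] inv g y
        ∣⁻ {x} {y} (z , z∈O , e) = inv g z , O⁻ z∈O , g.injective
          (trans (g.act-inv y) (trans e (sym (trans (g.*-homo _ _) (*-congˡ (g.act-inv z))))))

        uniformiser : ∀ {ϖ} → IsUniformiser O ϖ → IsUniformiser O′ (act g ϖ)
        uniformiser {ϖ} u = record
          { mem = O⁺ u.mem
          ; nonzero = λ e → u.nonzero (g.injective (trans e (sym g.0#-homo)))
          ; proper = λ d → u.proper (∣-cong refl inv-1 (∣⁻ d))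
          ; maximal = λ {x} x∈O ¬d → maximal′ x∈O (u.maximal (O⁻ x∈O) (λ d →
              ¬d (∣-cong refl (g.act-inv x) (∣⁺ d))))
          }
          where
          module u = IsUniformiser u
          inv-1 : inv g 1# ≈ 1#
          inv-1 = T⁻.g.1#-homo
          maximal′ : ∀ {x} → x ∈ O′ →
            (∃ λ y → y ∈ O × ϖ ∣[ O ] (1# - inv g x * y)) →
            ∃ λ y → y ∈ O′ × act g ϖ ∣[ O′ ] (1# - x * y)
          maximal′ {x} x∈O (y , y∈O , d) = act g y , O⁺ y∈O , ∣-cong refl eq (∣⁺ d)
            where
            eq : act g (1# - inv g x * y) ≈ 1# - x * act g y
            eq = trans (g.+-homo _ _) (+-cong g.1#-homo (trans (g.-‿homo _)
              (-‿cong (trans (g.*-homo _ _) (*-congʳ (g.act-inv x))))))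

      unramified : ∀ {n} {L : FiniteSubextension n} → Unramified L → Unramified (T.image L)
      unramified {L = L} (ϖ , u , d , d') = act g ϖ , uniformiser L u ,
        ∣-cong (g.fixesF π) (T.^-homo ϖ 1) (∣⁺ L d) ,
        ∣-cong (T.^-homo ϖ 1) (g.fixesF π) (∣⁺ L d')

    stable : ∀ {x} → x ∈ Fⁿʳ → act g x ∈ Fⁿʳ
    stable (incl L u x∈L)  = incl (T.image L) (unramified {L = L} u) (T.span⁺ x∈L)
    stable (resp e m)      = resp (cong g e) (stable m)
    stable (+-clos m n)    = resp (sym (g.+-homo _ _)) (+-clos (stable m) (stable n))
    stable (*-clos m n)    = resp (sym (g.*-homo _ _)) (*-clos (stable m) (stable n))
    stable (-‿clos m)      = resp (sym (g.-‿homo _)) (-‿clos (stable m))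
    stable (⁻¹-clos m e)   = ⁻¹-clos (stable m)
      (trans (sym (g.*-homo _ _)) (trans (cong g e) g.1#-homo))

  abstract
    Fⁿʳ-stable : ∀ g {x} → x ∈ Fⁿʳ → act g x ∈ Fⁿʳ
    Fⁿʳ-stable g = Stability.stable g

  Fixes : Pred Carrier 0ℓ → Pred Automorphism 0ℓ
  Fixes L g = ∀ {x} → x ∈ L → act g x ≈ x

  private
    abstract
      fixes-∘ : ∀ L {g h} → Fixes L g → Fixes L h → Fixes L (g ∘ᴳ h)
      fixes-∘ L {g} fg fh m = trans (cong g (fh m)) (fg m)

      fixes-⁻¹ : ∀ L {g} → Fixes L g → Fixes L (g ⁻¹ᴳ)
      fixes-⁻¹ L {g} fg m = trans (cong (g ⁻¹ᴳ) (sym (fg m))) (Automorphism.inv-act g _)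

    -- Elements of E are roots of quadratic polynomials over F, so g acts on
    -- them as the identity or as x ↦ trace x - x.
    module Quadratic (E : FiniteSubextension 2) where
      private module E = FiniteSubextension E

      ≈-stable : ∀ {x y} → ¬ ¬ x ≈ y → x ≈ y
      ≈-stable {x} {y} ¬¬e = proj₁ (tight x y) (λ x#y → ¬¬e (λ e → proj₂ (tight x y) e x#y))

      private
        open QuadraticIdentities commutativeRing
        open SetoidReasoning setoid

        no-zero-divisors : ∀ {u v} → u * v ≈ 0# → ¬ u ≈ 0# → v ≈ 0#
        no-zero-divisors {u} {v} uv≈0 ¬u≈0 = ≈-stable λ ¬v≈0 →
          ¬u≈0 (proj₁ (tight u 0#) (λ u#0 → ¬v≈0 (cancel (#⇒invertible u#0))))
          where
          cancel : (∃ λ r → r * (u - 0#) ≈ 1# × (u - 0#) * r ≈ 1#) → v ≈ 0#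
          cancel (r , e , _) = begin
            v                   ≈⟨ *-identityˡ v ⟨
            1# * v              ≈⟨ *-congʳ e ⟨
            r * (u - 0#) * v    ≈⟨ *-congʳ (*-congˡ (trans (+-congˡ (RingP.-0#≈0# ring)) (+-identityʳ u))) ⟩
            r * u * v           ≈⟨ *-assoc r u v ⟩
            r * (u * v)         ≈⟨ *-congˡ uv≈0 ⟩
            r * 0#              ≈⟨ zeroʳ r ⟩
            0#                  ∎

        x-y≈0 : ∀ {x y} → x - y ≈ 0# → x ≈ y
        x-y≈0 {x} {y} e = GroupP.x∙y⁻¹≈ε⇒x≈y +-group x y e

      orbit : ∀ {x} → x ∈ ⌊ E ⌋ → ∃ λ T → (∀ g → act g T ≈ T) ×
        (∀ g → ¬ ¬ (act g x ≈ x ⊎ act g x ≈ T - x))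
      orbit {x} x∈E =
        row (E.*-closed x∈E (member zero)) (E.*-closed x∈E (member (suc zero))) E.1-closed
        where
        φ  = ⟦ F̄.ι ⟧
        b₀ = E.basis zero
        b₁ = E.basis (suc zero)
        module ι = RingHomomorphism F̄.ι
        open HeytingField F.asField using () renaming (0# to 0F; 1# to 1F)

        member : ∀ i → E.basis i ∈ ⌊ E ⌋
        member zero       = (λ { zero → 1F ; (suc _) → 0F }) , sym (begin
          φ 1F * b₀ + (φ 0F * b₁ + 0#)  ≈⟨ +-cong (*-congʳ ι.1#-homo)
                                                 (+-congʳ (*-congʳ ι.0#-homo)) ⟩
          1# * b₀ + (0# * b₁ + 0#)          ≈⟨ +-cong (*-identityˡ b₀)
                                                 (trans (+-identityʳ _) (zeroˡ b₁)) ⟩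
          b₀ + 0#                           ≈⟨ +-identityʳ b₀ ⟩
          b₀                                ∎)
        member (suc zero) = (λ { zero → 0F ; (suc _) → 1F }) , sym (begin
          φ 0F * b₀ + (φ 1F * b₁ + 0#)  ≈⟨ +-cong (*-congʳ ι.0#-homo)
                                                 (+-congʳ (*-congʳ ι.1#-homo)) ⟩
          0# * b₀ + (1# * b₁ + 0#)          ≈⟨ +-cong (zeroˡ b₀)
                                                 (trans (+-identityʳ _) (*-identityˡ b₁)) ⟩
          0# + b₁                           ≈⟨ +-identityˡ b₁ ⟩
          b₁                                ∎)

        row : x * b₀ ∈ ⌊ E ⌋ → x * b₁ ∈ ⌊ E ⌋ → 1# ∈ ⌊ E ⌋ →
          ∃ λ T → (∀ g → act g T ≈ T) × (∀ g → ¬ ¬ (act g x ≈ x ⊎ act g x ≈ T - x))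
        row (m , e₀) (n , e₁) (r , one) = a + d , fixed , dichotomy
          where
          a = φ (m zero)
          b = φ (m (suc zero))
          c = φ (n zero)
          d = φ (n (suc zero))

          flat : ∀ {z} → z ≈ a * b₀ + (b * b₁ + 0#) → z ≈ a * b₀ + b * b₁
          flat e = trans e (+-congˡ (+-identityʳ _))

          flat′ : ∀ {z} → z ≈ c * b₀ + (d * b₁ + 0#) → z ≈ c * b₀ + d * b₁
          flat′ e = trans e (+-congˡ (+-identityʳ _))

          root : Root a b c d x
          root = agree b₀ b₁ _ _
            (cayley-hamilton a b c d x b₀ b₁ (flat e₀) (flat′ e₁))
            (trans (*-congʳ (+-congˡ (*-comm a d))) (trans
              (cayley-hamilton d c b a x b₁ b₀ (trans (flat′ e₁) (+-comm _ _)) (trans (flat e₀) (+-comm _ _)))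
              (*-congʳ (+-cong (*-congʳ (+-comm d a)) (*-comm c b)))))
            one

          fixed : ∀ g → act g (a + d) ≈ a + d
          fixed g = trans (g.+-homo _ _) (+-cong (g.fixesF _) (g.fixesF _))
            where module g = Automorphism g

          conjugate-root : ∀ g → Root a b c d (act g x)
          conjugate-root g = begin
            act g x * act g x + a * d
              ≈⟨ +-cong (g.*-homo x x) (trans (g.*-homo a d) (*-cong (g.fixesF _) (g.fixesF _))) ⟨
            act g (x * x) + act g (a * d)          ≈⟨ g.+-homo _ _ ⟨
            act g (x * x + a * d)                  ≈⟨ g.cong root ⟩
            act g ((a + d) * x + b * c)            ≈⟨ g.+-homo _ _ ⟩
            act g ((a + d) * x) + act g (b * c)
              ≈⟨ +-cong (trans (g.*-homo _ _) (*-congʳ (fixed g)))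
                   (trans (g.*-homo b c) (*-cong (g.fixesF _) (g.fixesF _))) ⟩
            (a + d) * act g x + b * c              ∎
            where module g = Automorphism g

          dichotomy : ∀ g → ¬ ¬ (act g x ≈ x ⊎ act g x ≈ (a + d) - x)
          dichotomy g ¬both = ¬both (inj₂ (x-y≈0 (no-zero-divisors
            (second-root a b c d x (act g x) root (conjugate-root g))
            (λ e → ¬both (inj₁ (x-y≈0 e))))))

  -- Continuity for a topology on a set X of automorphisms in which the sets
  -- x₀·(I_F ∩ Gal(F̄/F(s₁,…,sₘ))) form a neighbourhood basis at x₀.  On I_F this is the
  -- Krull topology, on W_F the Weil group topology, in which I_F is open.
  Continuous : ∀ {X Y : Set} → (X → Automorphism) → (ℕ → Rel Y 0ℓ) → (X → Y) → Set
  Continuous {X} aut close f = ∀ x₀ n → ∃₂ λ m (s : Fin m → Carrier) → ∀ x →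
    (∀ i → act (aut x) (s i) ≈ act (aut x₀) (s i)) →
    (∀ {y} → y ∈ Fⁿʳ → act (aut x) y ≈ act (aut x₀) y) →
    close n (f x) (f x₀)

  I_F : Group 0ℓ 0ℓ
  I_F = subgroup G (Fixes Fⁿʳ) (λ {g} {h} → fixes-∘ Fⁿʳ {g} {h}) (λ _ → refl)
    (λ {g} → fixes-⁻¹ Fⁿʳ {g})

  Inertia : Set
  Inertia = Group.Carrier I_F

  -- Φ is a geometric Frobenius element: the inverse of x ↦ x^q on the residue
  -- fields of the finite unramified extensions, whose maximal ideals are
  -- generated by π.
  IsFrobenius : ℕ → Automorphism → Set
  IsFrobenius q Φ = ∀ {n} (L : FiniteSubextension n) → Unramified L →
    ∀ {x} → x ∈ 𝓞 ⌊ L ⌋ → ⟦ F̄.ι ⟧ π ∣[ 𝓞 ⌊ L ⌋ ] (act Φ x ^ q - x)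

  module Weil (Φ : Automorphism) where

    -- g lies in W_F when it agrees on Fⁿʳ with some power of Φ.
    InWeil : Pred Automorphism 0ℓ
    InWeil g = Σ ℤ λ k → ∀ {x} → x ∈ Fⁿʳ → act g x ≈ act (Φ ^ᶻ k) x

    private
      abstract
        weil-∘ : ∀ {g h} → InWeil g → InWeil h → InWeil (g ∘ᴳ h)
        weil-∘ {g} (k , e) (l , f) = k ℤ.+ l , λ {x} m →
          trans (cong g (f m)) (trans (e (Fⁿʳ-stable (Φ ^ᶻ l) m))
            (sym (^ᶻ-homo-+ Φ k l x)))

        weil-⁻¹ : ∀ {g} → InWeil g → InWeil (g ⁻¹ᴳ)
        weil-⁻¹ {g} (k , e) = ℤ.- k , λ {x} m → g.injective
          (trans (g.act-inv x) (sym (trans (e (Fⁿʳ-stable (Φ ^ᶻ (ℤ.- k)) m))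
            (trans (sym (^ᶻ-homo-+ Φ k (ℤ.- k) x))
              (reflexive (≡.cong (λ j → act (Φ ^ᶻ j) x) (ℤ.+-inverseʳ k)))))))
          where module g = Automorphism g

    W_F : Group 0ℓ 0ℓ
    W_F = subgroup G InWeil (λ {g} {h} → weil-∘ {g} {h}) (+ 0 , λ _ → refl)
      (λ {g} → weil-⁻¹ {g})

    open Group W_F public using () renaming (Carrier to W; _∙_ to _∘ʷ_; _⁻¹ to _⁻¹ʷ)

    Φ^_·_ : ℤ → Inertia → W
    Φ^ k · (τ , τ-inertial) =
      (Φ ^ᶻ k) ∘ᴳ τ , k , λ m → cong (Φ ^ᶻ k) (τ-inertial m)

    conjugate : W → Inertia → Inertia
    conjugate (g , _) (τ , τ-inertial) = (g ∘ᴳ τ) ∘ᴳ (g ⁻¹ᴳ) , λ {x} m →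
      trans (cong g (τ-inertial (Fⁿʳ-stable (g ⁻¹ᴳ) m))) (Automorphism.act-inv g x)

    module _ {n : ℕ} (E : FiniteSubextension n) where

      InW_E : Pred W 0ℓ
      InW_E (g , _) = Fixes ⌊ E ⌋ g

      W_E : Group 0ℓ 0ℓ
      W_E = subgroup W_F InW_E (λ {g} {h} → fixes-∘ ⌊ E ⌋ {proj₁ g} {proj₁ h})
        (λ _ → refl) (λ {g} → fixes-⁻¹ ⌊ E ⌋ {proj₁ g})

    module _ (E : FiniteSubextension 2) where

      private
        fixes-difference : ∀ g {T x} → act g T ≈ T → act g (T - x) ≈ T - act g x
        fixes-difference g e = trans (g.+-homo _ _) (+-cong e (g.-‿homo _))
          where module g = Automorphism g

      abstract
        σhσ⁻¹-closed : ∀ σ h → InW_E E h → InW_E E ((σ ∘ʷ h) ∘ʷ (σ ⁻¹ʷ))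
        σhσ⁻¹-closed (s , _) (h , _) hE {x} x∈E = cases (Quadratic.orbit E x∈E)
          where
          moves : act h (inv s x) ≈ inv s x → act s (act h (inv s x)) ≈ x
          moves e = trans (cong s e) (Automorphism.act-inv s x)

          cases : (∃ λ T → (∀ g → act g T ≈ T) × (∀ g → ¬ ¬ (act g x ≈ x ⊎ act g x ≈ T - x))) →
            act s (act h (inv s x)) ≈ x
          cases (T , fixed , dichotomy) = Quadratic.≈-stable E λ ¬e → dichotomy (s ⁻¹ᴳ) λ
            { (inj₁ y≈x)   → ¬e (moves (trans (cong h y≈x) (trans (hE x∈E) (sym y≈x))))
            ; (inj₂ y≈T-x) → ¬e (moves (trans (cong h y≈T-x)
                (trans (fixes-difference h (fixed h))
                  (trans (+-congˡ (-‿cong (hE x∈E))) (sym y≈T-x)))))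
            }

        σhσ-closed : ∀ σ h → InW_E E h → InW_E E ((σ ∘ʷ h) ∘ʷ σ)
        σhσ-closed (s , _) (h , _) hE {x} x∈E = cases (Quadratic.orbit E x∈E)
          where
          open SetoidReasoning setoid
          open QuadraticIdentities commutativeRing using (x-[x-y]≈y)

          cases : (∃ λ T → (∀ g → act g T ≈ T) × (∀ g → ¬ ¬ (act g x ≈ x ⊎ act g x ≈ T - x))) →
            act s (act h (act s x)) ≈ x
          cases (T , fixed , dichotomy) = Quadratic.≈-stable E λ ¬e → dichotomy s λ
            { (inj₁ y≈x)   → ¬e (trans (cong s (trans (cong h y≈x) (hE x∈E))) y≈x)
            ; (inj₂ y≈T-x) → ¬e (begin
                act s (act h (act s x))  ≈⟨ cong s (cong h y≈T-x) ⟩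
                act s (act h (T - x))    ≈⟨ cong s (fixes-difference h (fixed h)) ⟩
                act s (T - act h x)      ≈⟨ fixes-difference s (fixed s) ⟩
                T - act s (act h x)      ≈⟨ +-congˡ (-‿cong (cong s (hE x∈E))) ⟩
                T - act s x              ≈⟨ +-congˡ (-‿cong y≈T-x) ⟩
                T - (T - x)              ≈⟨ x-[x-y]≈y T x ⟩
                x                        ∎)
            }

      W_E-element : Set
      W_E-element = Group.Carrier (W_E E)

      conjugate-by : W → W_E-element → W_E-element
      conjugate-by σ (h , h∈E) = (σ ∘ʷ h) ∘ʷ (σ ⁻¹ʷ) , λ {x} → σhσ⁻¹-closed σ h h∈E {x}

      sandwich : W → W_E-element → W_E-element
      sandwich σ (h , h∈E) = (σ ∘ʷ h) ∘ʷ σ , λ {x} → σhσ-closed σ h h∈E {x}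

-- ϖ is a uniformiser of K.
module Representations
  {p : ℕ} (F : FiniteExtensionOfℚₚ p) (F̄ : AlgebraicClosure (FiniteExtensionOfℚₚ.asField F))
  (π : ∣ FiniteExtensionOfℚₚ.asField F ∣) (Φ : Galois.Automorphism F F̄ π)
  {ℓ : ℕ} (K : FiniteExtensionOfℚₚ ℓ) (Ω : AlgebraicClosure (FiniteExtensionOfℚₚ.asField K))
  (ϖ : ∣ FiniteExtensionOfℚₚ.asField K ∣)
  where

  private
    I_F = Galois.I_F F F̄ π
    W_F = Galois.Weil.W_F F F̄ π Φ
    W   = Group.Carrier W_F
    W_E = Galois.Weil.W_E F F̄ π Φ
    QuadraticExtension = Galois.FiniteSubextension F F̄ π 2

    infixl 7 _∘ʷ_
    _∘ʷ_ : W → W → W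
    _∘ʷ_ = Group._∙_ W_F

    Φ^_·_ : ℤ → Galois.Inertia F F̄ π → W
    Φ^_·_ = Galois.Weil.Φ^_·_ F F̄ π Φ

    Continuous : ∀ {X Y : Set} → (X → Galois.Automorphism F F̄ π) →
      (ℕ → Rel Y 0ℓ) → (X → Y) → Set
    Continuous = Galois.Continuous F F̄ π

    module K  = FiniteExtensionOfℚₚ K
    module Kᶠ = FieldOps K.asField
    module Ω  = AlgebraicClosure Ω
    module M  = Matrices (FieldOps.commutativeRing K.asField)
    module 𝓞K = Integers K.asField K.ι
    module 𝓞Ω = Integers Ω.asField (_∘ʰ_ {K = Ω.asField} Ω.ι K.ι)

  open FieldOps Ω.asField
  open Matrices commutativeRing

  j : Kᶠ.Carrier → Carrier
  j = ⟦ Ω.ι ⟧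

  jℤ : ℤₚ ℓ → Carrier
  jℤ z = j (⟦ K.ι ⟧ (ℤₚ⇒ℚₚ z))

  jₘ : M.M₂ → M₂
  jₘ (M.mat a b c d) = mat (j a) (j b) (j c) (j d)

  Character : Group 0ℓ 0ℓ → Set
  Character H = MonoidHomomorphism (Group.rawMonoid H) *-rawMonoid

  Representation : Set
  Representation = MonoidHomomorphism (Group.rawMonoid W_F) ·-rawMonoid

  ContinuousRepresentation : Representation → Set
  ContinuousRepresentation ρ =
    Continuous proj₁ (λ n → Entrywise (𝓞Ω.near n)) ⟪ ρ ⟫

  ContinuousCharacter : Character W_F → Set
  ContinuousCharacter χ = Continuous proj₁ 𝓞Ω.near ⟪ χ ⟫

  -- ω(Φᵏτ) = q⁻ᵏ.
  IsNormCharacter : ℕ → Character W_F → Set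
  IsNormCharacter q ω = ∀ n τ →
    ⟪ ω ⟫ (Φ^ (+ n) · τ) * natural q ^ n ≈ 1# ×
    ⟪ ω ⟫ (Φ^ (ℤ.- (+ n)) · τ) ≈ natural q ^ n

  InertiaCharacter : Set
  InertiaCharacter = MonoidHomomorphism (Group.rawMonoid I_F)
    (RawRing.+-rawMonoid (ℤₚ-rawRing ℓ))

  record IsTame (ω : Character W_F) (t : InertiaCharacter) : Set where
    field
      continuous : Continuous proj₁
        (λ n x y → + (ℓ ℕ.^ n) ∣ seq x n ℤ.- seq y n) ⟪ t ⟫
      surjective : Surjective (Group._≈_ I_F) (RawRing._≈_ (ℤₚ-rawRing ℓ)) ⟪ t ⟫
      equivariant : ∀ g τ → jℤ (⟪ t ⟫ (Galois.Weil.conjugate F F̄ π Φ g τ)) ≈ ⟪ ω ⟫ g * jℤ (⟪ t ⟫ τ)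

  -- (r , N′) is isomorphic to the Weil–Deligne representation of ρ.
  record HasWeilDeligne (t : InertiaCharacter) (ρ : Representation)
                        (r : W → M₂) (N′ : M₂) : Set where
    field
      N         : M₂
      nilpotent : Nilpotent N
      monodromy : ∃₂ λ m (s : Fin m → ∣ AlgebraicClosure.asField F̄ ∣) → ∀ τ →
        (∀ i → HeytingField._≈_ (AlgebraicClosure.asField F̄)
                 (Galois.Automorphism.act (proj₁ τ) (s i)) (s i)) →
        ⟪ ρ ⟫ (Φ^ (+ 0) · τ) ≈ₘ exp-nilpotent (jℤ (⟪ t ⟫ τ) • N)
      P P⁻¹     : M₂
      inverses  : Inverses P P⁻¹
      intertwines-r : ∀ k τ →
        P · (⟪ ρ ⟫ (Φ^ k · τ) · exp-nilpotent ((- jℤ (⟪ t ⟫ τ)) • N)) · P⁻¹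
          ≈ₘ r (Φ^ k · τ)
      intertwines-N : P · N · P⁻¹ ≈ₘ N′

  module _ (E : QuadraticExtension) (σ : W) where

    ContinuousCharacterᴱ : Character (W_E E) → Set
    ContinuousCharacterᴱ ξ = Continuous (proj₁ ∘ proj₁) 𝓞Ω.near ⟪ ξ ⟫

    twist : Character (W_E E) → Group.Carrier (W_E E) → Carrier
    twist ξ h = ⟪ ξ ⟫ (Galois.Weil.conjugate-by F F̄ π Φ E σ h)

    -- r = Ind ξ. When σ ∉ W_E the formulas determine r, as W_F = W_E ⊔ W_E σ.
    IsInduced : Character (W_E E) → Representation → Set
    IsInduced ξ r = (h : Group.Carrier (W_E E)) →
      ⟪ r ⟫ (proj₁ h)      ≈ₘ mat (⟪ ξ ⟫ h) 0# 0# (twist ξ h) ×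
      ⟪ r ⟫ (proj₁ h ∘ʷ σ) ≈ₘ mat 0# (⟪ ξ ⟫ h) (⟪ ξ ⟫ (Galois.Weil.sandwich F F̄ π Φ E σ h)) 0#

    IsTwistInvariant : Character (W_E E) → Set
    IsTwistInvariant ξ = (h : Group.Carrier (W_E E)) → ⟪ ξ ⟫ h ≈ twist ξ h

    -- (Ind ξ , 0) is the Weil–Deligne representation of ρ, where r = Ind ξ.
    record IsSupercuspidal (t : InertiaCharacter) (ρ : Representation)
                           (ξ : Character (W_E E)) (r : Representation) : Set where
      field
        ξ-continuous : ContinuousCharacterᴱ ξ
        induced      : IsInduced ξ r
        ξ≢ξ^σ        : ¬ IsTwistInvariant ξ
        weilDeligne  : HasWeilDeligne t ρ ⟪ r ⟫ 0ₘ

  -- (χω ⊕ χ , (0 1 ; 0 0)) is the Weil–Deligne representation of ρ.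
  record IsSpecial (t : InertiaCharacter) (ρ : Representation)
                   (ω χ : Character W_F) : Set where
    field
      χ-continuous : ContinuousCharacter χ
      weilDeligne  : HasWeilDeligne t ρ
        (λ w → mat (⟪ χ ⟫ w * ⟪ ω ⟫ w) 0# 0# (⟪ χ ⟫ w)) (mat 0# 1# 0# 0#)

  record UpperTriangularGL₂K : Set where
    field
      a b d   : Kᶠ.Carrier
      a⁻¹ d⁻¹ : Kᶠ.Carrier
      a-inv   : a Kᶠ.* a⁻¹ Kᶠ.≈ Kᶠ.1#
      d-inv   : d Kᶠ.* d⁻¹ Kᶠ.≈ Kᶠ.1#

    a/d b/d : Kᶠ.Carrier
    a/d = a Kᶠ.* d⁻¹
    b/d = b Kᶠ.* d⁻¹

    matrix inverse : M₂
    matrix  = jₘ (M.mat a b Kᶠ.0# d)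
    inverse = jₘ (M.mat a⁻¹ (Kᶠ.- (a⁻¹ Kᶠ.* b Kᶠ.* d⁻¹)) Kᶠ.0# d⁻¹)

  UnitOfK : Pred Kᶠ.Carrier 0ℓ
  UnitOfK x = 𝓞K.Integral x × ∃ λ y → 𝓞K.Integral y × x Kᶠ.* y Kᶠ.≈ Kᶠ.1#

  InGL₂𝓞K : Pred M.M₂ 0ℓ
  InGL₂𝓞K A = M.AllEntries 𝓞K.Integral A ×
    ∃ λ B → M.AllEntries 𝓞K.Integral B × M.Inverses A B

  Integrality : Representation → Set
  Integrality ρ = ∀ w → ∃ λ A → A ∈ InGL₂𝓞K × jₘ A ≈ₘ ⟪ ρ ⟫ w

  infix 4 _≡ϖ_
  _≡ϖ_ : Rel M.M₂ 0ℓ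
  _≡ϖ_ = M.Entrywise λ x y → ϖ 𝓞K.∣[ 𝓞K.Integral ] (x Kᶠ.- y)

  -- The reductions modulo ϖ, as representations to GL₂(𝓞_K/ϖ), are isomorphic.
  ReductionsIsomorphic : ∀ ρ₁ ρ₂ → Integrality ρ₁ → Integrality ρ₂ → Set
  ReductionsIsomorphic _ _ R₁ R₂ = ∃₂ λ P Q →
    M.AllEntries 𝓞K.Integral P × M.AllEntries 𝓞K.Integral Q ×
    P M.· Q ≡ϖ M.1ₘ × Q M.· P ≡ϖ M.1ₘ ×
    ∀ w → P M.· proj₁ (R₁ w) ≡ϖ proj₁ (R₂ w) M.· P

  ConjugateBy : UpperTriangularGL₂K → Representation → Representation → Set
  ConjugateBy U ρ r = ∀ k τ →
    ⟪ ρ ⟫ (Φ^ k · τ) ≈ₘ matrix · ⟪ r ⟫ (Φ^ k · τ) · inverse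
    where open UpperTriangularGL₂K U

  HasSpecialForm : UpperTriangularGL₂K → InertiaCharacter →
    (ω χ : Character W_F) → Representation → Set
  HasSpecialForm U t ω χ ρ = ∀ k τ → ⟪ ρ ⟫ (Φ^ k · τ) ≈ₘ
    mat (χω k τ)
        (j a/d * jℤ (⟪ t ⟫ τ) * χω k τ + j b/d * (⟪ χ ⟫ (Φ^ k · τ) - χω k τ))
        0#
        (⟪ χ ⟫ (Φ^ k · τ))
    where
    open UpperTriangularGL₂K U
    χω : ℤ → Galois.Inertia F F̄ π → Carrier
    χω k τ = ⟪ χ ⟫ (Φ^ k · τ) * ⟪ ω ⟫ (Φ^ k · τ)

{-# OPTIONS --safe #-}
-- If τ ∈ I_F moves E, then ρ₁(τ) is conjugate to an antidiagonal matrix and has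
-- trace 0, while ρ₂(τ) has the double eigenvalue χ(τ), so tr² = 4 det is a unit
-- of 𝓞_K because ℓ is odd. Isomorphic reductions would have equal traces modulo ϖ.
--
-- Such a τ exists because a uniformiser of the ramified extension E is not in Fⁿʳ:
-- let A be the ring generated by the integers of the finite unramified extensions.
-- As Φ(x)^q ≡ x modulo π on A, the ring A/π is reduced; hence A contains the
-- integral elements z with πz ∈ A, and up to a factor prime to π also the integral
-- elements of Fⁿʳ. Therefore π is no e-th power up to units in Fⁿʳ if e > 1.
-- The nontrivial automorphism of E·Fⁿʳ over Fⁿʳ extends to F̄ by Zorn's lemma,
-- applied to the subrings of F̄ × F̄ which are graphs.
module Submission where

open import Defs
open import Level using (Lift; lift; lower; 0ℓ)
import Level
open import Axiom.ExcludedMiddle using (ExcludedMiddle)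
open import Algebra.Bundles using (CommutativeRing; RawRing; Group)
open import Algebra.Morphism.Bundles using (RingHomomorphism; MonoidHomomorphism)
open import Algebra.Morphism.Structures using (IsRingIsomorphism)
open import Algebra.Solver.Ring.AlmostCommutativeRing
  using (fromCommutativeRing; _-Raw-AlmostCommutative⟶_)
open import Algebra.Apartness.Bundles using (HeytingField)
import Algebra.Solver.Ring as RingSolver
import Algebra.Solver.Ring.NaturalCoefficients.Default as SemiringSolver
import Algebra.Properties.Semiring.Exp as Exp
import Algebra.Properties.Semiring.Sum as Sum
import Algebra.Properties.Semiring.Mult as Mult
import Algebra.Properties.CommutativeSemiring.Exp as CommExp
import Algebra.Properties.Ring as RingP
import Algebra.Properties.Group as GroupP
import Algebra.Properties.AbelianGroup as AbelianGroupP
open import Data.Nat.Base as ℕ using (ℕ; zero; suc)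
import Data.Nat.Properties as ℕ
open import Data.Fin.Base as Fin using (Fin; zero; suc; toℕ; inject₁; fromℕ)
import Data.Fin.Properties as Fin
open import Data.Maybe.Base using (Maybe; just; nothing)
open import Data.Product.Base using (∃; ∃₂; _×_; _,_; proj₁; proj₂)
open import Data.Sum.Base using (_⊎_; inj₁; inj₂)
open import Data.Empty using (⊥)
open import Function.Base using (_∘_; id)
open import Relation.Binary.Core using (Rel)
open import Relation.Binary.PropositionalEquality.Core as ≡ using (_≡_; _≢_)
import Relation.Binary.PropositionalEquality.Properties as ≡ₚ
import Relation.Binary.Reasoning.Setoid as SetoidReasoning
open import Relation.Nullary using (Dec; yes; no)
open import Relation.Nullary.Negation.Core using (¬_; contradiction)
open import Relation.Unary using (Pred; _∈_; U)
open import Data.Integer.Base as ℤ using (ℤ; +_)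
import Data.Integer.Properties as ℤ
open import Data.Integer.Divisibility.Signed as ℤ∣
  using (_∣_; divides; ∣m∣n⇒∣m+n; ∣m⇒∣-m)
import Data.Integer.Solver as ℤSolver
import Data.Nat.Divisibility as ℕ∣
open import Data.Nat.Primality using (Prime; prime⇒irreducible; prime⇒nonZero; prime⇒nonTrivial)
open import Data.Nat.Coprimality using (Coprime; coprime-Bézout)
open import Data.Nat.GCD using (module Bézout)
open import Data.Nat.Combinatorics using (nCn≡1; nCk≡nC[n∸k])
import Data.Nat.Combinatorics as Comb
import Algebra.Properties.CommutativeSemiring.Binomial as Binomial
import Algebra.Construct.DirectProduct as DirectProduct
open import Relation.Binary.Structures using (IsPreorder)
open import Data.Fin.Relation.Unary.Top using (View; view; ‵fromℕ; ‵inject₁)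
open import Data.Unit.Base using (⊤; tt)

-- The obstacle is that `Fⁿʳ` is given only as a field generated by unramified extensions: that
-- their composites are unramified, or that valuations extend to F̄, would be a theory of its own.
-- Reducedness of A/π stands in for it. It survives the passage to the composite because Φ is one
-- map on all of A: the congruence holds on generators and extends to sums as soon as x ↦ x^q is
-- additive modulo π. Additivity holds because the inner binomial coefficients of q lie in (π), and
-- this in turn because the q residues are roots of X^q - X. If xᴺ lies in πA, then so does
-- Φᴺ(x)^(qᴺ), which is congruent to x. Denominators need an extra argument: elements of F̄ become
-- integral after multiplication by a power of p, and an integral equation of π over ℤₚ shows that
-- some multiple of p is a power of π times a factor prime to π. The trace of ρ₂(τ) is controlled
-- through its square, because integrality of ρ₂ directly provides a unit determinant.

-- The library's ring solver needs coefficients with decidable equality mapping to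
-- an arbitrary commutative ring; (m , n) stands for the integer m - n.
module Solver (C : CommutativeRing 0ℓ 0ℓ) where
  open CommutativeRing C
  open Mult semiring using (×-homo-+; ×1-homo-*) renaming (_×_ to _·ℕ_)
  open RingP ring using (-‿distribˡ-*; -‿distribʳ-*; -‿involutive; -0#≈0#)
  open AbelianGroupP +-abelianGroup using (⁻¹-∙-comm)
  open SetoidReasoning setoid
  private
    module S = SemiringSolver commutativeSemiring
    open S using (_:=_; _:+_; _:*_)

    ν : ℕ → Carrier
    ν n = n ·ℕ 1#

    value : ℕ × ℕ → Carrier
    value (m , n) = ν m - ν n

    crossed : ∀ {w x y z} → w + z ≈ y + x → w - x ≈ y - z
    crossed {w} {x} {y} {z} e = begin
      w - x                      ≈⟨ +-identityʳ _ ⟨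
      w - x + 0#                 ≈⟨ +-congˡ (-‿inverseʳ z) ⟨
      w - x + (z - z)            ≈⟨ S.solve 4 (λ w x' z z' → w :+ x' :+ (z :+ z') := w :+ z :+ (x' :+ z')) refl w (- x) z (- z) ⟩
      w + z + (- x + - z)        ≈⟨ +-congʳ e ⟩
      y + x + (- x + - z)        ≈⟨ S.solve 4 (λ x x' y z' → y :+ x :+ (x' :+ z') := y :+ z' :+ (x :+ x')) refl x (- x) y (- z) ⟩
      y - z + (x - x)            ≈⟨ +-congˡ (-‿inverseʳ x) ⟩
      y - z + 0#                 ≈⟨ +-identityʳ _ ⟩
      y - z                      ∎

    product : ∀ w x y z → (w - x) * (y - z) ≈ (w * y + x * z) - (w * z + x * y)
    product w x y z = begin
      (w - x) * (y - z)
        ≈⟨ S.solve 4 (λ w x' y z' → (w :+ x') :* (y :+ z') := w :* y :+ x' :* z' :+ (w :* z' :+ x' :* y)) refl w (- x) y (- z) ⟩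
      w * y + - x * - z + (w * - z + - x * y)
        ≈⟨ +-cong (+-congˡ (trans (sym (-‿distribˡ-* x (- z))) (trans (-‿cong (sym (-‿distribʳ-* x z))) (-‿involutive _))))
                  (+-cong (sym (-‿distribʳ-* w z)) (sym (-‿distribˡ-* x y))) ⟩
      w * y + x * z + (- (w * z) + - (x * y))
        ≈⟨ +-congˡ (⁻¹-∙-comm _ _) ⟩
      (w * y + x * z) - (w * z + x * y) ∎

    swap : ∀ x y → - (x - y) ≈ y - x
    swap x y = trans (sym (⁻¹-∙-comm x (- y))) (trans (+-congˡ (-‿involutive y)) (+-comm _ _))

    differences : RawRing 0ℓ 0ℓ
    differences = record
      { Carrier = ℕ × ℕ
      ; _≈_ = _≡_
      ; _+_ = λ { (a , b) (c , d) → a ℕ.+ c , b ℕ.+ d }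
      ; _*_ = λ { (a , b) (c , d) → a ℕ.* c ℕ.+ b ℕ.* d , a ℕ.* d ℕ.+ b ℕ.* c }
      ; -_  = λ { (a , b) → b , a }
      ; 0#  = 0 , 0
      ; 1#  = 1 , 0
      }

    ν-*+* : ∀ a b c d → ν (a ℕ.* c ℕ.+ b ℕ.* d) ≈ ν a * ν c + ν b * ν d
    ν-*+* a b c d = trans (×-homo-+ 1# (a ℕ.* c) (b ℕ.* d)) (+-cong (×1-homo-* a c) (×1-homo-* b d))

    morphism : differences -Raw-AlmostCommutative⟶ fromCommutativeRing C
    morphism = record
      { ⟦_⟧ = value
      ; +-homo = λ { (a , b) (c , d) → trans
          (+-cong (×-homo-+ 1# a c) (trans (-‿cong (×-homo-+ 1# b d)) (sym (⁻¹-∙-comm _ _))))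
          (S.solve 4 (λ a b c d → a :+ c :+ (b :+ d) := a :+ b :+ (c :+ d)) refl (ν a) (- ν b) (ν c) (- ν d)) }
      ; *-homo = λ { (a , b) (c , d) → sym (trans (product _ _ _ _)
          (+-cong (sym (ν-*+* a b c d)) (-‿cong (sym (ν-*+* a b d c))))) }
      ; -‿homo = λ { (a , b) → sym (swap _ _) }
      ; 0-homo = -‿inverseʳ 0#
      ; 1-homo = trans (+-congˡ -0#≈0#) (trans (+-identityʳ _) (+-identityʳ _))
      }

    _≟_ : ∀ x y → Maybe (value x ≈ value y)
    (a , b) ≟ (c , d) with a ℕ.+ d ℕ.≟ c ℕ.+ b
    ... | yes e = just (crossed (trans (sym (×-homo-+ 1# a d)) (trans (reflexive (≡.cong ν e)) (×-homo-+ 1# c b))))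
    ... | no _ = nothing

  open RingSolver differences (fromCommutativeRing C) morphism _≟_ public

-- Rings and subrings

module Ring (C : CommutativeRing 0ℓ 0ℓ) where
  open CommutativeRing C public hiding (zero)
  open Exp semiring public using (_^_; ^-congˡ; ^-homo-*; ^-assocʳ)
  open CommExp commutativeSemiring public using (^-distrib-*)
  open Sum semiring public using (sum; sum-cong-≋; ∑-distrib-+; ∑-comm; sum-init-last; *-distribˡ-sum; *-distribʳ-sum)
  open GroupP +-group public using (x∙y⁻¹≈ε⇒x≈y; inverseˡ-unique)
  open RingP ring public using (-‿distribˡ-*; -‿distribʳ-*; -‿involutive; -0#≈0#; -1*x≈-x)
  module S = Solver C

  -- The summands are explicit, for uses where unification cannot recover them from the sums.
  sum-cong : ∀ {n} (f g : Fin n → Carrier) → (∀ i → f i ≈ g i) → sum f ≈ sum g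
  sum-cong f g = sum-cong-≋

  open S public using (_:=_; _:+_; _:*_; _:-_; :-_)

record Subring (C : CommutativeRing 0ℓ 0ℓ) (R : Pred (CommutativeRing.Carrier C) 0ℓ) : Set where
  open Ring C
  field
    resp     : ∀ {x y} → x ≈ y → R x → R y
    +-closed : ∀ {x y} → R x → R y → R (x + y)
    *-closed : ∀ {x y} → R x → R y → R (x * y)
    -‿closed : ∀ {x} → R x → R (- x)
    1-closed : R 1#

  0-closed : R 0#
  0-closed = resp (-‿inverseʳ 1#) (+-closed 1-closed (-‿closed 1-closed))

  −-closed : ∀ {x y} → R x → R y → R (x - y)
  −-closed p q = +-closed p (-‿closed q)

  ^-closed : ∀ {x} n → R x → R (x ^ n)
  ^-closed zero    p = 1-closed
  ^-closed (suc n) p = *-closed p (^-closed n p)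

  sum-closed : ∀ {n} (f : Fin n → Carrier) → (∀ i → R (f i)) → R (sum f)
  sum-closed {zero}  f p = 0-closed
  sum-closed {suc n} f p = +-closed (p zero) (sum-closed (f ∘ suc) (p ∘ suc))

-- Values of polynomials

module Adjunction (C : CommutativeRing 0ℓ 0ℓ) where
  open Ring C
  open SetoidReasoning setoid

  sum-0 : ∀ {n} (f : Fin n → Carrier) → (∀ i → f i ≈ 0#) → sum f ≈ 0#
  sum-0 {zero}  f e = refl
  sum-0 {suc n} f e = trans (+-cong (e zero) (sum-0 (f ∘ suc) (e ∘ suc))) (+-identityˡ 0#)

  polynomial : ∀ {n} → (Fin n → Carrier) → Carrier → Carrier
  polynomial c x = sum (λ i → c i * x ^ toℕ i)

  polynomial-suc : ∀ {n} (c : Fin (suc n) → Carrier) x →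
    polynomial c x ≈ c zero + x * polynomial (c ∘ suc) x
  polynomial-suc c x = +-cong (*-identityʳ _) (begin
    sum (λ i → c (suc i) * (x * x ^ toℕ i))
      ≈⟨ sum-cong-≋ (λ i → S.solve 3 (λ c x y → c :* (x :* y) := x :* (c :* y)) refl (c (suc i)) x (x ^ toℕ i)) ⟩
    sum (λ i → x * (c (suc i) * x ^ toℕ i))
      ≈⟨ *-distribˡ-sum x (λ i → c (suc i) * x ^ toℕ i) ⟨
    x * sum (λ i → c (suc i) * x ^ toℕ i)  ∎)

  polynomial-last : ∀ {n} (c : Fin (suc n) → Carrier) x →
    polynomial c x ≈ polynomial (c ∘ inject₁) x + c (fromℕ n) * x ^ n
  polynomial-last {n} c x = trans (sum-init-last (λ i → c i * x ^ toℕ i)) (+-cong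
    (sum-cong-≋ (λ i → *-congˡ {x = c (inject₁ i)} (reflexive (≡.cong (x ^_) (Fin.toℕ-inject₁ i)))))
    (*-congˡ (reflexive (≡.cong (x ^_) (Fin.toℕ-fromℕ n)))))

  -- The R-module spanned by 1, x, ..., xⁿ⁻¹. Once it contains xⁿ it is the ring R[x], realised
  -- inside the given ring.
  Low : Pred Carrier 0ℓ → Carrier → ℕ → Pred Carrier 0ℓ
  Low R x n v = ∃ λ (c : Fin n → Carrier) → (∀ i → R (c i)) × v ≈ polynomial c x

  IntegralOver : Pred Carrier 0ℓ → Pred Carrier 0ℓ
  IntegralOver R x = ∃₂ λ n (c : Fin n → Carrier) → (∀ i → R (c i)) × x ^ n + polynomial c x ≈ 0#

  module OfSubring {R : Pred Carrier 0ℓ} (R-subring : Subring C R) where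
    open Subring R-subring

    module _ (x : Carrier) where

      low-resp : ∀ {n u v} → u ≈ v → Low R x n u → Low R x n v
      low-resp e (c , c∈R , f) = c , c∈R , trans (sym e) f

      low-+ : ∀ {n u v} → Low R x n u → Low R x n v → Low R x n (u + v)
      low-+ (c , c∈R , e) (d , d∈R , f) = (λ i → c i + d i) , (λ i → +-closed (c∈R i) (d∈R i)) ,
        trans (+-cong e f) (sym (trans (sum-cong-≋ (λ i → distribʳ _ (c i) (d i)))
          (∑-distrib-+ (λ i → c i * x ^ toℕ i) (λ i → d i * x ^ toℕ i))))

      low-scale : ∀ {n r v} → R r → Low R x n v → Low R x n (r * v)
      low-scale {r = r} r∈R (c , c∈R , e) = (λ i → r * c i) , (λ i → *-closed r∈R (c∈R i)) ,
        trans (*-congˡ e) (trans (*-distribˡ-sum r (λ i → c i * x ^ toℕ i))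
          (sum-cong-≋ (λ i → sym (*-assoc r (c i) _))))

      low-0 : ∀ {n} → Low R x n 0#
      low-0 {n} = (λ _ → 0#) , (λ _ → 0-closed) , sym (sum-0 {n} (λ i → 0# * x ^ toℕ i) (λ i → zeroˡ (x ^ toℕ i)))

      low-sum : ∀ {n k} (f : Fin k → Carrier) → (∀ i → Low R x n (f i)) → Low R x n (sum f)
      low-sum {k = zero}  f p = low-0
      low-sum {k = suc k} f p = low-+ (p zero) (low-sum (f ∘ suc) (p ∘ suc))

      low-shift : ∀ {n v} → Low R x n v → Low R x (suc n) (x * v)
      low-shift (c , c∈R , e) = c′ , c′∈R ,
        trans (*-congˡ e) (sym (trans (polynomial-suc c′ x) (+-identityˡ _)))
        where
        c′ : Fin _ → Carrier
        c′ zero    = 0#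
        c′ (suc i) = c i
        c′∈R : ∀ i → R (c′ i)
        c′∈R zero    = 0-closed
        c′∈R (suc i) = c∈R i

      low-constant : ∀ {n r} → R r → Low R x (suc n) r
      low-constant {n} {r} r∈R = c′ , c′∈R ,
        sym (trans (polynomial-suc c′ x) (trans (+-congˡ (trans (*-congˡ (sym (proj₂ (proj₂ zeros)))) (zeroʳ x))) (+-identityʳ r)))
        where
        zeros = low-0 {n}
        c′ : Fin _ → Carrier
        c′ zero    = r
        c′ (suc i) = proj₁ zeros i
        c′∈R : ∀ i → R (c′ i)
        c′∈R zero    = r∈R
        c′∈R (suc i) = proj₁ (proj₂ zeros) i

      module _ {m : ℕ} (reduction : Low R x (suc m) (x ^ suc m)) where
        private n = suc m

        -- Shifting produces a single term of degree n, and `reduction` rewrites that term in lower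
        -- powers.
        low-x* : ∀ {v} → Low R x n v → Low R x n (x * v)
        low-x* {v} p = split (low-shift p)
          where
          split : Low R x (suc n) (x * v) → Low R x n (x * v)
          split (c , c∈R , e) = low-resp (sym (trans e (polynomial-last c x)))
            (low-+ {u = polynomial (c ∘ inject₁) x} (c ∘ inject₁ , c∈R ∘ inject₁ , refl)
              (low-scale (c∈R (fromℕ n)) reduction))

        low-x^* : ∀ k {v} → Low R x n v → Low R x n (x ^ k * v)
        low-x^* zero    p = low-resp (sym (*-identityˡ _)) p
        low-x^* (suc k) p = low-resp (sym (*-assoc _ _ _)) (low-x* (low-x^* k p))

        low-* : ∀ {u v} → Low R x n u → Low R x n v → Low R x n (u * v)
        low-* {v = v} (c , c∈R , e) q = low-resp (sym (trans (*-congʳ e) (*-distribʳ-sum v (λ i → c i * x ^ toℕ i))))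
          (low-sum _ (λ i → low-resp (sym (*-assoc _ _ _)) (low-scale (c∈R i) (low-x^* (toℕ i) q))))

        low-subring : Subring C (Low R x n)
        low-subring = record
          { resp = low-resp
          ; +-closed = low-+
          ; *-closed = low-*
          ; -‿closed = λ {v} p → low-resp (-1*x≈-x v) (low-scale (-‿closed 1-closed) p)
          ; 1-closed = low-constant 1-closed
          }

        x∈low : Low R x n x
        x∈low = low-resp (*-identityʳ x) (low-x* (low-constant 1-closed))

    -- Poly x d c v: v is the value at x of a polynomial of formal degree d over R
    -- whose coefficient at Xᵈ is c.
    data Poly (x : Carrier) : ℕ → Carrier → Carrier → Set where
      const  : ∀ {c v} → R c → v ≈ c → Poly x 0 c v
      horner : ∀ {d c u v r} → Poly x d c v → R r → u ≈ x * v + r → Poly x (suc d) c u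

    module _ {x : Carrier} where

      poly-resp : ∀ {d c c′ v v′} → c ≈ c′ → v ≈ v′ → Poly x d c v → Poly x d c′ v′
      poly-resp e f (const p g)    = const (resp e p) (trans (sym f) (trans g e))
      poly-resp e f (horner p r g) = horner (poly-resp e refl p) r (trans (sym f) g)

      poly-+ : ∀ {d c c′ v v′} → Poly x d c v → Poly x d c′ v′ → Poly x d (c + c′) (v + v′)
      poly-+ (const p e) (const q f) = const (+-closed p q) (+-cong e f)
      poly-+ (horner p r e) (horner q s f) = horner (poly-+ p q) (+-closed r s) (trans (+-cong e f)
        (S.solve 5 (λ x u v r s → x :* u :+ r :+ (x :* v :+ s) := x :* (u :+ v) :+ (r :+ s))
          refl x _ _ _ _))

      poly-scale : ∀ {d c v r} → R r → Poly x d c v → Poly x d (r * c) (r * v)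
      poly-scale r∈R (const p e) = const (*-closed r∈R p) (*-congˡ e)
      poly-scale r∈R (horner p s e) = horner (poly-scale r∈R p) (*-closed r∈R s) (trans (*-congˡ e)
        (S.solve 4 (λ x v r s → r :* (x :* v :+ s) := x :* (r :* v) :+ r :* s) refl x _ _ _))

      poly-x* : ∀ {d c v} → Poly x d c v → Poly x (suc d) c (x * v)
      poly-x* p = horner p 0-closed (sym (+-identityʳ _))

      -- Degrees are formal. Padding with a zero leading coefficient allows summands of different
      -- degree to be added while the top coefficient stays visible.
      poly-pad : ∀ {d c v} → Poly x d c v → Poly x (suc d) 0# v
      poly-pad (const p e) = horner (const 0-closed refl) p (trans e (sym (trans (+-congʳ (zeroʳ x)) (+-identityˡ _))))
      poly-pad (horner p r e) = horner (poly-pad p) r e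

      poly-pad⁺ : ∀ k {d c v} → Poly x d c v → Poly x (suc k ℕ.+ d) 0# v
      poly-pad⁺ zero    p = poly-pad p
      poly-pad⁺ (suc k) p = poly-pad (poly-pad⁺ k p)

      poly-* : ∀ {d e c c′ v v′} → Poly x d c v → Poly x e c′ v′ → Poly x (d ℕ.+ e) (c * c′) (v * v′)
      poly-* (const p f) q = poly-resp refl (*-congʳ (sym f)) (poly-scale p q)
      poly-* {suc d} (horner p r f) q = poly-resp (+-identityʳ _)
        (trans (S.solve 4 (λ x v r w → x :* (v :* w) :+ r :* w := (x :* v :+ r) :* w) refl x _ _ _) (*-congʳ (sym f)))
        (poly-+ (poly-x* (poly-* p q)) (poly-pad⁺ d (poly-scale r q)))

      poly-neg : ∀ {d c v} → Poly x d c v → Poly x d (- c) (- v)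
      poly-neg p = poly-resp (-1*x≈-x _) (-1*x≈-x _) (poly-scale (-‿closed 1-closed) p)

      from-monic : ∀ {n} (c : Fin n → Carrier) → (∀ i → R (c i)) → ∀ {b} → R b →
        Poly x n b (b * x ^ n + polynomial c x)
      from-monic {zero}  c c∈R b∈R = const b∈R (trans (+-identityʳ _) (*-identityʳ _))
      from-monic {suc n} c c∈R {b} b∈R = horner (from-monic (c ∘ suc) (c∈R ∘ suc) b∈R) (c∈R zero)
        (trans (+-congˡ (polynomial-suc c x))
          (S.solve 5 (λ b x y c p → b :* (x :* y) :+ (c :+ x :* p) := x :* (b :* y :+ p) :+ c)
            refl b x (x ^ n) (c zero) (polynomial (c ∘ suc) x)))

      to-monic : ∀ {n b v} → Poly x n b v → ∃ λ (c : Fin n → Carrier) → (∀ i → R (c i)) × v ≈ b * x ^ n + polynomial c x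
      to-monic (const p e) = (λ ()) , (λ ()) , trans e (sym (trans (+-identityʳ _) (*-identityʳ _)))
      to-monic {suc n} {b} (horner {r = r} p r∈R e) with to-monic p
      ... | c , c∈R , f = c′ , c′∈R , trans e (trans (+-congʳ (*-congˡ f)) (trans
          (S.solve 5 (λ b x y c p → x :* (b :* y :+ p) :+ c := b :* (x :* y) :+ (c :+ x :* p))
            refl b x (x ^ n) r (polynomial c x)) (+-congˡ (sym (polynomial-suc c′ x)))))
        where
        c′ : Fin (suc n) → Carrier
        c′ zero    = r
        c′ (suc i) = c i
        c′∈R : ∀ i → R (c′ i)
        c′∈R zero    = r∈R
        c′∈R (suc i) = c∈R i

      integral⇒poly : IntegralOver R x → ∃ λ n → Poly x n 1# 0#
      integral⇒poly (n , c , c∈R , e) = n , poly-resp refl (trans (+-congʳ (*-identityˡ _)) e) (from-monic c c∈R 1-closed)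

      poly⇒integral : ∀ {n} → Poly x n 1# 0# → IntegralOver R x
      poly⇒integral p with to-monic p
      ... | c , c∈R , e = _ , c , c∈R , sym (trans e (+-congʳ (*-identityˡ _)))

    δ : ∀ {n} → Fin n → Fin n → Carrier
    δ zero    zero    = 1#
    δ zero    (suc _) = 0#
    δ (suc _) zero    = 0#
    δ (suc i) (suc j) = δ i j

    δ∈R : ∀ {n} (i j : Fin n) → R (δ i j)
    δ∈R zero    zero    = 1-closed
    δ∈R zero    (suc _) = 0-closed
    δ∈R (suc _) zero    = 0-closed
    δ∈R (suc i) (suc j) = δ∈R i j

    -- The rows have the shape X·1 - A up to lower order terms. Eliminating the
    -- unknown with index 1 preserves it, and no division occurs.
    elimination : ∀ {x} n {d} (v : Fin (suc n) → Carrier) (p : Fin (suc n) → Fin (suc n) → Carrier) →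
      (∀ i j → Poly x d (δ i j) (p i j)) → (∀ i → sum (λ j → p i j * v j) ≈ 0#) →
      ∃₂ λ d′ y → Poly x d′ 1# y × y * v zero ≈ 0#
    elimination zero {d} v p P e = d , p zero zero , P zero zero , trans (sym (+-identityʳ _)) (e zero)
    elimination {x} (suc n) {d} v p P e = elimination n (v ∘ emb) q Q vanish
      where
      ι₁ : Fin (suc (suc n))
      ι₁ = suc zero

      -- Index 0 survives every elimination, because the conclusion concerns `v zero`, which the
      -- applications take to be 1 or nonzero.
      emb : Fin (suc n) → Fin (suc (suc n))
      emb zero    = zero
      emb (suc i) = suc (suc i)

      -- The entries are 2 × 2 minors with pivot at (1, 1). The subtracted product has leading
      -- coefficient 0, since `emb` avoids the index 1, so the leading coefficients are again those
      -- of the identity matrix.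
      q : Fin (suc n) → Fin (suc n) → Carrier
      q i j = p ι₁ ι₁ * p (emb i) (emb j) + - (p (emb i) ι₁ * p ι₁ (emb j))

      δ-emb : ∀ i j → δ (emb i) (emb j) ≈ δ i j
      δ-emb zero zero = refl
      δ-emb zero (suc j) = refl
      δ-emb (suc i) zero = refl
      δ-emb (suc i) (suc j) = refl

      δ-emb-1 : ∀ i → δ (emb i) ι₁ ≈ 0#
      δ-emb-1 zero = refl
      δ-emb-1 (suc i) = refl

      Q : ∀ i j → Poly x (d ℕ.+ d) (δ i j) (q i j)
      Q i j = poly-resp
        (trans (+-cong (trans (*-identityˡ _) (δ-emb i j)) (-‿cong (trans (*-congʳ (δ-emb-1 i)) (zeroˡ _))))
          (trans (+-congˡ -0#≈0#) (+-identityʳ _))) refl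
        (poly-+ (poly-* (P ι₁ ι₁) (P (emb i) (emb j))) (poly-neg (poly-* (P (emb i) ι₁) (P ι₁ (emb j)))))

      split : ∀ i → sum (λ j → p i j * v j) ≈ sum (λ j → p i (emb j) * v (emb j)) + p i ι₁ * v ι₁
      split i = S.solve 3 (λ a b c → a :+ (b :+ c) := a :+ c :+ b) refl
        (p i zero * v zero) (p i ι₁ * v ι₁) (sum (λ j → p i (suc (suc j)) * v (suc (suc j))))

      vanish : ∀ i → sum (λ j → q i j * v (emb j)) ≈ 0#
      vanish i = begin
        sum (λ j → q i j * v (emb j))
          ≈⟨ sum-cong-≋ (λ j → S.solve 5 (λ a b c d v → (a :* b :+ (:- (c :* d))) :* v :=
               a :* (b :* v) :+ (:- c) :* (d :* v))
               refl (p ι₁ ι₁) (p (emb i) (emb j)) (p (emb i) ι₁) (p ι₁ (emb j)) (v (emb j))) ⟩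
        sum (λ j → p ι₁ ι₁ * r (emb i) j + - p (emb i) ι₁ * r ι₁ j)
          ≈⟨ ∑-distrib-+ (λ j → p ι₁ ι₁ * r (emb i) j) (λ j → - p (emb i) ι₁ * r ι₁ j) ⟩
        sum (λ j → p ι₁ ι₁ * r (emb i) j) + sum (λ j → - p (emb i) ι₁ * r ι₁ j)
          ≈⟨ +-cong (*-distribˡ-sum (p ι₁ ι₁) (r (emb i))) (*-distribˡ-sum (- p (emb i) ι₁) (r ι₁)) ⟨
        p ι₁ ι₁ * sum (r (emb i)) + - p (emb i) ι₁ * sum (r ι₁)
          ≈⟨ S.solve 5 (λ a b s t v → a :* s :+ (:- b) :* t :=
               a :* (s :+ b :* v) :- b :* (t :+ a :* v))
               refl (p ι₁ ι₁) (p (emb i) ι₁) (sum (r (emb i))) (sum (r ι₁)) (v ι₁) ⟩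
        p ι₁ ι₁ * (sum (r (emb i)) + p (emb i) ι₁ * v ι₁) - p (emb i) ι₁ * (sum (r ι₁) + p ι₁ ι₁ * v ι₁)
          ≈⟨ +-cong (*-congˡ (trans (sym (split (emb i))) (e (emb i)))) (-‿cong (*-congˡ (trans (sym (split ι₁)) (e ι₁)))) ⟩
        p ι₁ ι₁ * 0# - p (emb i) ι₁ * 0#
          ≈⟨ +-cong (zeroʳ _) (-‿cong (zeroʳ _)) ⟩
        0# - 0#
          ≈⟨ -‿inverseʳ 0# ⟩
        0#  ∎
        where
        r : Fin (suc (suc n)) → Fin (suc n) → Carrier
        r i j = p i (emb j) * v (emb j)

-- Integral elements

module Integrality (C : CommutativeRing 0ℓ 0ℓ) where
  open Ring C
  open Adjunction C
  open SetoidReasoning setoid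

  integral-mono : ∀ {R T : Pred Carrier 0ℓ} → (∀ {x} → R x → T x) → ∀ {x} → IntegralOver R x → IntegralOver T x
  integral-mono R⊆T (n , c , c∈R , e) = n , c , (λ i → R⊆T (c∈R i)) , e

  integral-resp : ∀ {R : Pred Carrier 0ℓ} {x y} → x ≈ y → IntegralOver R x → IntegralOver R y
  integral-resp {x = x} {y} x≈y (n , c , c∈R , e) = n , c , c∈R , trans
    (+-cong (^-congˡ n (sym x≈y)) (sum-cong-≋ (λ i → *-congˡ {x = c i} (^-congˡ (toℕ i) (sym x≈y))))) e

  module _ {R : Pred Carrier 0ℓ} (R-subring : Subring C R) where
    open OfSubring R-subring
    private module R = Subring R-subring

    member-integral : ∀ {x} → R x → IntegralOver R x
    member-integral {x} p = 1 , (λ _ → - x) , (λ _ → R.-‿closed p) , trans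
      (+-cong (*-identityʳ x) (trans (+-identityʳ _) (*-identityʳ _))) (-‿inverseʳ x)

    δ-sum : ∀ {n} (i : Fin n) (g : Fin n → Carrier) → sum (λ l → δ i l * g l) ≈ g i
    δ-sum zero g = trans (+-cong (*-identityˡ _) (sum-0 (λ l → 0# * g (suc l)) (λ l → zeroˡ (g (suc l))))) (+-identityʳ _)
    δ-sum (suc i) g = trans (+-cong (zeroˡ _) (δ-sum i (g ∘ suc))) (+-identityˡ _)

    module _ {a m} (c : Fin (suc m) → Carrier) (c∈R : ∀ i → R (c i)) (e : a ^ suc m + polynomial c a ≈ 0#) where

      reduction : Low R a (suc m) (a ^ suc m)
      reduction = low-resp a (trans (-1*x≈-x _) (sym (inverseˡ-unique _ _ e)))
        (low-scale a (R.-‿closed R.1-closed) (c , c∈R , refl))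

      -- Multiplying the relation for x by the powers of a gives a square linear
      -- system for these powers, with entries polynomials in x over R.
      descend : ∀ {x} → IntegralOver (Low R a (suc m)) x → IntegralOver R x
      descend {x} (k , f , f∈T , g) = conclude (elimination m (λ l → a ^ toℕ l) p P vanish)
        where
        rows : ∀ i j → Low R a (suc m) (a ^ toℕ i * f j)
        rows i j = low-x^* a reduction (toℕ i) (f∈T j)

        s : Fin (suc m) → Fin k → Fin (suc m) → Carrier
        s i j = proj₁ (rows i j)

        p : Fin (suc m) → Fin (suc m) → Carrier
        p i l = δ i l * x ^ k + polynomial (λ j → s i j l) x

        P : ∀ i l → Poly x k (δ i l) (p i l)
        P i l = from-monic (λ j → s i j l) (λ j → proj₁ (proj₂ (rows i j)) l) (δ∈R i l)

        vanish : ∀ i → sum (λ l → p i l * a ^ toℕ l) ≈ 0#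
        vanish i = begin
          sum (λ l → p i l * a ^ toℕ l)
            ≈⟨ sum-cong-≋ (λ l → trans (distribʳ _ _ _) (+-cong
                 (S.solve 3 (λ d x y → d :* x :* y := d :* (y :* x)) refl (δ i l) (x ^ k) (a ^ toℕ l))
                 (trans (*-distribʳ-sum (a ^ toℕ l) (λ j → s i j l * x ^ toℕ j)) (sum-cong-≋ (λ j →
                   S.solve 3 (λ d x y → d :* x :* y := x :* (d :* y)) refl (s i j l) (x ^ toℕ j) (a ^ toℕ l)))))) ⟩
          sum (λ l → δ i l * (a ^ toℕ l * x ^ k) + sum (λ j → x ^ toℕ j * (s i j l * a ^ toℕ l)))
            ≈⟨ ∑-distrib-+ (λ l → δ i l * (a ^ toℕ l * x ^ k)) (λ l → sum (λ j → x ^ toℕ j * (s i j l * a ^ toℕ l))) ⟩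
          sum (λ l → δ i l * (a ^ toℕ l * x ^ k)) + sum (λ l → sum (λ j → x ^ toℕ j * (s i j l * a ^ toℕ l)))
            ≈⟨ +-cong (δ-sum i (λ l → a ^ toℕ l * x ^ k)) (∑-comm (λ l j → x ^ toℕ j * (s i j l * a ^ toℕ l))) ⟩
          a ^ toℕ i * x ^ k + sum (λ j → sum (λ l → x ^ toℕ j * (s i j l * a ^ toℕ l)))
            ≈⟨ +-congˡ (sum-cong-≋ (λ j → trans (sym (*-distribˡ-sum (x ^ toℕ j) (λ l → s i j l * a ^ toℕ l)))
                 (trans (*-congˡ (sym (proj₂ (proj₂ (rows i j)))))
                 (S.solve 3 (λ x a f → x :* (a :* f) := a :* (f :* x)) refl (x ^ toℕ j) (a ^ toℕ i) (f j))))) ⟩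
          a ^ toℕ i * x ^ k + sum (λ j → a ^ toℕ i * (f j * x ^ toℕ j))
            ≈⟨ +-congˡ (*-distribˡ-sum (a ^ toℕ i) (λ j → f j * x ^ toℕ j)) ⟨
          a ^ toℕ i * x ^ k + a ^ toℕ i * polynomial f x
            ≈⟨ distribˡ _ _ _ ⟨
          a ^ toℕ i * (x ^ k + polynomial f x)
            ≈⟨ trans (*-congˡ g) (zeroʳ _) ⟩
          0#  ∎

        -- The entry `v zero` is the zeroth power of a, hence 1, so y itself vanishes.
        conclude : (∃₂ λ d y → Poly x d 1# y × y * 1# ≈ 0#) → IntegralOver R x
        conclude (d , y , q , y≈0) = poly⇒integral (poly-resp refl (trans (sym (*-identityʳ y)) y≈0) q)

  -- Of a finite extension only the consequence is kept that composes along towers: what is integral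
  -- over T is integral over R.
  record Extends (R T : Pred Carrier 0ℓ) : Set where
    field
      subring   : Subring C T
      inclusion : ∀ {x} → R x → T x
      descent   : ∀ {x} → IntegralOver T x → IntegralOver R x

  open Extends

  ext-trans : ∀ {R S T} → Extends R S → Extends S T → Extends R T
  ext-trans p q = record
    { subring = subring q
    ; inclusion = inclusion q ∘ inclusion p
    ; descent = descent p ∘ descent q
    }

  adjoin : ∀ {R} → Subring C R → ∀ {a} → IntegralOver R a → ∃ λ T → Extends R T × T a
  -- A relation of degree 0 says 1 ≈ 0, so a ≈ 0 lies in R already.
  adjoin {R} R-subring {a} (zero , c , c∈R , e) = R , record
      { subring = R-subring ; inclusion = id ; descent = id } ,
    Subring.resp R-subring (trans (sym (zeroˡ a)) (trans (*-congʳ (sym (trans (sym (+-identityʳ 1#)) e))) (*-identityˡ a)))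
      (Subring.0-closed R-subring)
  adjoin {R} R-subring {a} (suc m , c , c∈R , e) = Low R a (suc m) , record
      { subring = low-subring a red ; inclusion = low-constant a ; descent = descend R-subring c c∈R e } ,
    x∈low a red
    where
    open OfSubring R-subring
    red = reduction R-subring c c∈R e

  adjoin-all : ∀ {R} → Subring C R → ∀ {k} (c : Fin k → Carrier) → (∀ i → IntegralOver R (c i)) →
    ∃ λ T → Extends R T × (∀ i → T (c i))
  adjoin-all {R} R-subring {zero} c p = R , record
    { subring = R-subring ; inclusion = id ; descent = id } , λ ()
  adjoin-all {R} R-subring {suc k} c p with adjoin R-subring (p zero)
  ... | T , R⊂T , c₀∈T with adjoin-all (subring R⊂T) (c ∘ suc) (λ i → integral-mono {R} {T} (inclusion R⊂T) {c (suc i)} (p (suc i)))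
  ... | T′ , T⊂T′ , cᵢ∈T′ = T′ , ext-trans R⊂T T⊂T′ , λ { zero → inclusion T⊂T′ c₀∈T ; (suc i) → cᵢ∈T′ i }

  module _ {R : Pred Carrier 0ℓ} (R-subring : Subring C R) where

    -- Two integral elements lie in a common T reached by two adjunctions. Their sum and product are
    -- members of T, hence integral over T, and this descends to R.
    integral-subring : Subring C (IntegralOver R)
    integral-subring = record
      { resp = λ {x} {y} → integral-resp {R} {x} {y}
      ; +-closed = λ p q → two p q (λ T∋x T∋y sub → Subring.+-closed sub T∋x T∋y)
      ; *-closed = λ p q → two p q (λ T∋x T∋y sub → Subring.*-closed sub T∋x T∋y)
      ; -‿closed = λ p → two p p (λ T∋x _ sub → Subring.-‿closed sub T∋x)
      ; 1-closed = member-integral R-subring (Subring.1-closed R-subring)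
      }
      where
      two : ∀ {x y z} → IntegralOver R x → IntegralOver R y →
        (∀ {T} → T x → T y → Subring C T → T z) → IntegralOver R z
      two {x} {y} p q f with adjoin R-subring p
      ... | T , R⊂T , x∈T with adjoin (subring R⊂T) (integral-mono {R} {T} (inclusion R⊂T) {y} q)
      ... | T′ , T⊂T′ , y∈T′ = descent R⊂T (descent T⊂T′ (member-integral (subring T⊂T′)
        (f {T′} (inclusion T⊂T′ x∈T) y∈T′ (subring T⊂T′))))

    -- The finitely many coefficients of the equation of x lie in one T, so x is integral over T and
    -- `descent` applies.
    integral-trans : ∀ {x} → IntegralOver (IntegralOver R) x → IntegralOver R x
    integral-trans (n , c , p , e) with adjoin-all R-subring c p
    ... | T , R⊂T , c∈T = descent R⊂T (n , c , c∈T , e)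

-- The p-adic numbers

module PadicArithmetic (p : ℕ) where
  open RawRing (ℤₚ-rawRing p) using (_≈_; _*_; -_; 1#; 0#) renaming (_+_ to _⊕_)
  open ℤSolver.+-*-Solver

  ∣-resp : ∀ {k x y} → x ≡ y → k ∣ x → k ∣ y
  ∣-resp ≡.refl d = d

  equal : ∀ {k x y} → x ≡ y → k ∣ x ℤ.- y
  equal {y = y} e = divides (+ 0) (≡.trans (≡.cong (ℤ._- y) e) (ℤ.+-inverseʳ y))

  pointwise : ∀ {x y : ℤₚ p} → (∀ n → seq x n ≡ seq y n) → x ≈ y
  pointwise e n = equal (e n)

  p̂ : ℤₚ p
  p̂ = fromℤ p (+ p)

  pos-^ : ∀ n → + (p ℕ.^ suc n) ≡ + p ℤ.* + (p ℕ.^ n)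
  pos-^ n = ℤ.pos-* p (p ℕ.^ n)

  module _ (p-prime : Prime p) where
    private instance
      p≢0 : ℤ.NonZero (+ p)
      p≢0 = prime⇒nonZero p-prime

    -- Division by p costs one digit: the quotient modulo pⁿ is read off from the term of r modulo
    -- pⁿ⁺¹.
    divisible : ∀ (r : ℤₚ p) → + p ∣ seq r 1 → ∃ λ r′ → r ≈ p̂ * r′
    divisible r d = mkℤₚ quo coh , approx
      where
      p∣ : ∀ n → + p ∣ seq r (suc n)
      p∣ zero = d
      p∣ (suc n) = ∣-resp (solve 2 (λ a b → a :- b :+ b := a) ≡.refl (seq r (suc (suc n))) (seq r (suc n)))
        (∣m∣n⇒∣m+n (ℤ∣.∣-trans (divides (+ (p ℕ.^ n)) (≡.trans (pos-^ n) (ℤ.*-comm (+ p) _))) (coherent r (suc n))) (p∣ n))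

      quo : ℕ → ℤ
      quo n = ℤ∣._∣_.quotient (p∣ n)

      quo-eq : ∀ n → seq r (suc n) ≡ quo n ℤ.* + p
      quo-eq n = ℤ∣._∣_.equality (p∣ n)

      coh : ∀ n → + (p ℕ.^ n) ∣ quo (suc n) ℤ.- quo n
      coh n = ℤ∣.*-cancelˡ-∣ (+ p) (ℤ∣.∣-trans (ℤ∣.∣-reflexive (≡.sym (pos-^ n)))
        (∣-resp (≡.trans (≡.cong₂ ℤ._-_ (quo-eq (suc n)) (quo-eq n))
          (solve 3 (λ a b p → a :* p :- b :* p := p :* (a :- b)) ≡.refl (quo (suc n)) (quo n) (+ p)))
          (coherent r (suc n))))

      approx : ∀ n → + (p ℕ.^ n) ∣ seq r n ℤ.- + p ℤ.* quo n
      approx n = ∣-resp (≡.trans (solve 2 (λ a b → :- (a :- b) := b :- a) ≡.refl (seq r (suc n)) (seq r n))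
        (≡.cong (λ z → seq r n ℤ.- z) (≡.trans (quo-eq n) (ℤ.*-comm (quo n) (+ p))))) (∣m⇒∣-m (coherent r n))

    inverse-mod : ∀ z → ¬ + p ∣ z → ∃₂ λ w t → z ℤ.* w ≡ + 1 ℤ.+ t ℤ.* + p
    inverse-mod z p∤z = result (coprime-Bézout coprime)
      where
      coprime : Coprime ℤ.∣ z ∣ p
      coprime (d∣z , d∣p) with prime⇒irreducible p-prime d∣p
      ... | inj₁ d≡1 = d≡1
      ... | inj₂ d≡p = contradiction (ℤ∣.∣ᵤ⇒∣ (≡.subst (ℕ∣._∣ ℤ.∣ z ∣) d≡p d∣z)) p∤z

      absolute : ∃₂ (λ w t → + ℤ.∣ z ∣ ℤ.* w ≡ + 1 ℤ.+ t ℤ.* + p) → ∃₂ λ w t → z ℤ.* w ≡ + 1 ℤ.+ t ℤ.* + p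
      absolute (w , t , e) with ℤ.+∣i∣≡i⊎+∣i∣≡-i z
      ... | inj₁ f = w , t , ≡.trans (≡.cong (ℤ._* w) (≡.sym f)) e
      ... | inj₂ f = ℤ.- w , t , ≡.trans (≡.trans (solve 2 (λ z w → z :* (:- w) := (:- z) :* w) ≡.refl z w)
                                    (≡.cong (ℤ._* w) (≡.sym f))) e

      result : Bézout.Identity 1 ℤ.∣ z ∣ p → ∃₂ λ w t → z ℤ.* w ≡ + 1 ℤ.+ t ℤ.* + p
      result (Bézout.+- x y eq) = absolute (+ x , + y , ≡.trans (ℤ.*-comm (+ ℤ.∣ z ∣) (+ x))
        (≡.trans (≡.sym (ℤ.pos-* x _)) (≡.trans (≡.cong +_ (≡.sym eq))
          (≡.trans (ℤ.pos-+ 1 (y ℕ.* p)) (≡.cong (λ u → + 1 ℤ.+ u) (ℤ.pos-* y p))))))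
      result (Bézout.-+ x y eq) = absolute (ℤ.- + x , ℤ.- + y ,
        ≡.trans (solve 2 (λ m x → m :* (:- x) := con (+ 1) :- (con (+ 1) :+ x :* m)) ≡.refl (+ ℤ.∣ z ∣) (+ x))
        (≡.trans (≡.cong (λ u → + 1 ℤ.- u) (≡.trans (≡.cong (λ u → + 1 ℤ.+ u) (≡.sym (ℤ.pos-* x _)))
            (≡.trans (≡.sym (ℤ.pos-+ 1 _)) (≡.trans (≡.cong +_ eq) (ℤ.pos-* y p)))))
          (solve 2 (λ y p → con (+ 1) :- y :* p := con (+ 1) :+ (:- y) :* p) ≡.refl (+ y) (+ p))))

    -- ℤₚ is local, and the first digit decides. If p does not divide it, Bézout over ℤ gives an
    -- inverse modulo p, taken as a constant sequence.
    dichotomy : ∀ r → (∃ λ r′ → r ≈ p̂ * r′) ⊎ (∃₂ λ w r′ → r * w ⊕ (- 1#) ≈ p̂ * r′)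
    dichotomy r with (+ p) ℤ∣.∣? seq r 1
    ... | yes d = inj₁ (divisible r d)
    ... | no ¬d with inverse-mod (seq r 1) ¬d
    ... | w , t , e = inj₂ (fromℤ p w , divisible (r * fromℤ p w ⊕ (- 1#))
      (divides t (≡.trans (≡.cong (ℤ._+ (ℤ.- + 1)) e) (solve 2 (λ t p → con (+ 1) :+ t :* p :+ con (ℤ.- + 1) := t :* p) ≡.refl t (+ p)))))

    1≉0 : ¬ 1# ≈ 0#
    1≉0 e with ℤ∣.∣⇒∣ᵤ (e 1)
    ... | d = ℕ∣.>⇒∤ (ℕ.<-≤-trans (ℕ.nonTrivial⇒n>1 p {{prime⇒nonTrivial p-prime}}) (ℕ.≤-reflexive (≡.sym (ℕ.*-identityʳ p)))) d

  parity : ∀ n → ∃ λ m → n ≡ m ℕ.+ m ⊎ n ≡ suc (m ℕ.+ m)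
  parity zero = 0 , inj₁ ≡.refl
  parity (suc n) with parity n
  ... | m , inj₁ e = m , inj₂ (≡.cong suc e)
  ... | m , inj₂ e = suc m , inj₁ (≡.trans (≡.cong suc e) (≡.cong suc (≡.sym (ℕ.+-suc m m))))

  -- 1/2 is the limit of (pⁿ + 1)/2.
  half : Prime p → p ≢ 2 → ∃ λ h → (1# ⊕ 1#) * h ≈ 1#
  half p-prime p≢2 with parity p
  ... | m , inj₁ e with prime⇒irreducible p-prime (ℕ∣.divides m (≡.trans e (≡.trans (≡.cong (m ℕ.+_) (≡.sym (ℕ.+-identityʳ m))) (ℕ.*-comm 2 m))))
  ... | inj₁ ()
  ... | inj₂ 2≡p = contradiction (≡.sym 2≡p) p≢2
  half p-prime p≢2 | m , inj₂ e = mkℤₚ s coh , λ n → divides (+ 1) (≡.trans (twice n) (≡.sym (ℤ.*-identityˡ _)))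
    where
    s : ℕ → ℤ
    s zero = + 1
    -- As p = 2m + 1, the numbers (pⁿ⁺¹ + 1)/2 and (pⁿ + 1)/2 differ by m pⁿ.
    s (suc n) = s n ℤ.+ + m ℤ.* + (p ℕ.^ n)

    coh : ∀ n → + (p ℕ.^ n) ∣ s (suc n) ℤ.- s n
    coh n = divides (+ m) (solve 2 (λ s q → s :+ q :- s := q) ≡.refl (s n) (+ m ℤ.* + (p ℕ.^ n)))

    twice : ∀ n → (+ 1 ℤ.+ + 1) ℤ.* s n ℤ.- + 1 ≡ + (p ℕ.^ n)
    twice zero = ≡.refl
    twice (suc n) = ≡.trans (solve 3 (λ s m q → (con (+ 1) :+ con (+ 1)) :* (s :+ m :* q) :- con (+ 1) :=
        (con (+ 1) :+ con (+ 1)) :* s :- con (+ 1) :+ (m :+ m) :* q) ≡.refl (s n) (+ m) (+ (p ℕ.^ n)))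
      (≡.trans (≡.cong (ℤ._+ (+ m ℤ.+ + m) ℤ.* + (p ℕ.^ n)) (twice n))
      (≡.trans (solve 2 (λ m q → q :+ (m :+ m) :* q := (con (+ 1) :+ (m :+ m)) :* q) ≡.refl (+ m) (+ (p ℕ.^ n)))
      (≡.trans (≡.cong (ℤ._* + (p ℕ.^ n)) (≡.cong +_ (≡.sym e))) (≡.sym (pos-^ n)))))

-- Fields, and the image of ℤₚ in an extension of ℚₚ

module FieldProperties (em : ∀ {P : Set} → Dec P) (K : Field) where
  private module K = HeytingField K
  open Ring (FieldOps.commutativeRing K)

  1≉0 : ¬ 1# ≈ 0#
  1≉0 e = proj₂ (K.tight 0# 0#) refl (K.invertible⇒# (0# , trans (zeroˡ _) (sym e) , trans (zeroʳ _) (sym e)))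

  zero-or-unit : ∀ x → x ≈ 0# ⊎ ∃ λ y → x * y ≈ 1#
  zero-or-unit x with em {x K.# 0#}
  ... | no ¬x#0 = inj₁ (proj₁ (K.tight x 0#) ¬x#0)
  ... | yes x#0 with K.#⇒invertible x#0
  ... | y , _ , e = inj₂ (y , trans (*-congʳ (sym (trans (+-congˡ -0#≈0#) (+-identityʳ x)))) e)

  inverse : ∀ {x} → ¬ x ≈ 0# → ∃ λ y → x * y ≈ 1#
  inverse {x} x≉0 with zero-or-unit x
  ... | inj₁ e = contradiction e x≉0
  ... | inj₂ u = u

  unit≉0 : ∀ {x y} → x * y ≈ 1# → ¬ x ≈ 0#
  unit≉0 e x≈0 = 1≉0 (trans (sym e) (trans (*-congʳ x≈0) (zeroˡ _)))

  no-zero-divisors : ∀ {x y} → x * y ≈ 0# → ¬ x ≈ 0# → y ≈ 0#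
  no-zero-divisors {x} {y} xy≈0 x≉0 with inverse x≉0
  ... | z , e = trans (sym (*-identityˡ y)) (trans (*-congʳ (trans (sym e) (*-comm x z)))
    (trans (*-assoc z x y) (trans (*-congˡ xy≈0) (zeroʳ z))))

  cancel : ∀ {x y z} → ¬ x ≈ 0# → x * y ≈ x * z → y ≈ z
  cancel {x} {y} {z} x≉0 e = x∙y⁻¹≈ε⇒x≈y y z (no-zero-divisors
    (trans (S.solve 3 (λ x y z → x :* (y :- z) := x :* y :- x :* z) refl x y z)
      (trans (+-congʳ e) (-‿inverseʳ _))) x≉0)

module PadicImage {p : ℕ} (A : Field) (ι : RingHomomorphism (ℚₚ-rawRing p) (fieldRing A)) where
  open Ring (FieldOps.commutativeRing A)
  open Adjunction (FieldOps.commutativeRing A)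
  open Integrality (FieldOps.commutativeRing A)
  open Integers A ι
  open PadicArithmetic p using (equal; pointwise; ∣-resp; p̂)
  private
    module Z = RawRing (ℤₚ-rawRing p)
    module Q = RawRing (ℚₚ-rawRing p)
    module ι = RingHomomorphism ι

  𝕫 : ℤₚ p → Carrier
  𝕫 z = ι.⟦ ℤₚ⇒ℚₚ z ⟧

  𝕫-cong : ∀ {a b} → a Z.≈ b → 𝕫 a ≈ 𝕫 b
  𝕫-cong {a} {b} e = ι.⟦⟧-cong λ n → ∣-resp (≡.sym (≡.cong₂ ℤ._-_ (ℤ.*-identityʳ (seq a n)) (ℤ.*-identityʳ (seq b n)))) (e n)

  𝕫-+ : ∀ a b → 𝕫 (a Z.+ b) ≈ 𝕫 a + 𝕫 b
  𝕫-+ a b = trans (ι.⟦⟧-cong {ℤₚ⇒ℚₚ (a Z.+ b)} {ℤₚ⇒ℚₚ a Q.+ ℤₚ⇒ℚₚ b}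
      (λ n → equal (≡.cong (ℤ._* + 1) (≡.sym (≡.cong₂ ℤ._+_ (ℤ.*-identityʳ (seq a n)) (ℤ.*-identityʳ (seq b n)))))))
    (ι.+-homo (ℤₚ⇒ℚₚ a) (ℤₚ⇒ℚₚ b))

  𝕫-* : ∀ a b → 𝕫 (a Z.* b) ≈ 𝕫 a * 𝕫 b
  𝕫-* a b = ι.*-homo (ℤₚ⇒ℚₚ a) (ℤₚ⇒ℚₚ b)

  𝕫-neg : ∀ a → 𝕫 (Z.- a) ≈ - 𝕫 a
  𝕫-neg a = ι.-‿homo (ℤₚ⇒ℚₚ a)

  𝕫-1 : 𝕫 Z.1# ≈ 1#
  𝕫-1 = ι.1#-homo

  𝐩 : Carrier
  𝐩 = 𝕫 p̂

  ℤₚ-image : Pred Carrier 0ℓ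
  ℤₚ-image x = ∃ λ z → x ≈ 𝕫 z

  ℤₚ-subring : Subring (FieldOps.commutativeRing A) ℤₚ-image
  ℤₚ-subring = record
    { resp = λ { e (z , f) → z , trans (sym e) f }
    ; +-closed = λ { (y , e) (z , f) → y Z.+ z , trans (+-cong e f) (sym (𝕫-+ y z)) }
    ; *-closed = λ { (y , e) (z , f) → y Z.* z , trans (*-cong e f) (sym (𝕫-* y z)) }
    ; -‿closed = λ { (z , e) → Z.- z , trans (-‿cong e) (sym (𝕫-neg z)) }
    ; 1-closed = Z.1# , sym 𝕫-1
    }

  fromIntegral : ∀ {x} → Integral x → IntegralOver ℤₚ-image x
  fromIntegral (n , c , e) = n , (𝕫 ∘ c) , (λ i → c i , refl) , e

  toIntegral : ∀ {x} → IntegralOver ℤₚ-image x → Integral x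
  toIntegral {x} (n , c , c∈ℤₚ , e) = n , proj₁ ∘ c∈ℤₚ ,
    trans (+-congˡ (sum-cong-≋ (λ i → *-congʳ {x = x ^ toℕ i} (sym (proj₂ (c∈ℤₚ i)))))) e

  private module I = Subring (integral-subring ℤₚ-subring)

  Integral-subring : Subring (FieldOps.commutativeRing A) Integral
  Integral-subring = record
    { resp     = λ {x} {y} e m → toIntegral (I.resp e (fromIntegral m))
    ; +-closed = λ {x} {y} m n → toIntegral (I.+-closed {x} {y} (fromIntegral m) (fromIntegral n))
    ; *-closed = λ {x} {y} m n → toIntegral (I.*-closed {x} {y} (fromIntegral m) (fromIntegral n))
    ; -‿closed = λ {x} m → toIntegral (I.-‿closed {x} (fromIntegral m))
    ; 1-closed = toIntegral I.1-closed
    }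

  ℤₚ-integral : ∀ z → Integral (𝕫 z)
  ℤₚ-integral z = toIntegral (member-integral ℤₚ-subring (z , refl))

  Integral-trans : ∀ {x} → IntegralOver Integral x → Integral x
  Integral-trans {x} (n , c , m , e) = toIntegral (integral-trans ℤₚ-subring {x} (n , c , (λ i → fromIntegral (m i)) , e))

  module _ (p-prime : Prime p) where
    open PadicArithmetic p using (half)

    half-integral : p ≢ 2 → ∃ λ h → Integral h × (1# + 1#) * h ≈ 1#
    half-integral p≢2 with half p-prime p≢2
    ... | h , e = 𝕫 h , ℤₚ-integral h , trans (*-congʳ (trans (+-cong (sym 𝕫-1) (sym 𝕫-1)) (sym (𝕫-+ Z.1# Z.1#))))
      (trans (sym (𝕫-* (Z.1# Z.+ Z.1#) h)) (trans (𝕫-cong e) 𝕫-1))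

  𝐩-power : ∀ k → 𝕫 (fromℤ p (+ (p ℕ.^ k))) ≈ 𝐩 ^ k
  𝐩-power zero = 𝕫-1
  𝐩-power (suc k) = trans (𝕫-cong (pointwise {x = fromℤ p (+ (p ℕ.^ suc k))} {y = p̂ Z.* fromℤ p (+ (p ℕ.^ k))} (λ n → ℤ.pos-* p (p ℕ.^ k))))
    (trans (𝕫-* p̂ (fromℤ p (+ (p ℕ.^ k)))) (*-congˡ (𝐩-power k)))

  clear-denominator : ∀ x → ∃₂ λ k z → ι.⟦ x ⟧ * 𝐩 ^ k ≈ 𝕫 z
  clear-denominator (a /p^ k) = k , a , trans (*-congˡ (sym (𝐩-power k)))
    (trans (sym (ι.*-homo (a /p^ k) (ℤₚ⇒ℚₚ P)))
      (ι.⟦⟧-cong {(a /p^ k) Q.* ℤₚ⇒ℚₚ P} {ℤₚ⇒ℚₚ a} (pointwise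
        {x = (a Z.* P) Z.* fromℤ p (+ 1)} {y = a Z.* fromℤ p (+ (p ℕ.^ (k ℕ.+ 0)))}
        (λ n → ≡.trans (ℤ.*-identityʳ _) (≡.cong (λ l → seq a n ℤ.* + (p ℕ.^ l)) (≡.sym (ℕ.+-identityʳ k)))))))
    where
    P : ℤₚ p
    P = fromℤ p (+ (p ℕ.^ k))

-- Integral multiples and inverses in algebraic extensions

bounded : ∀ {n} (f : Fin n → ℕ) → ∃ λ N → ∀ i → f i ℕ.≤ N
bounded {zero}  f = 0 , λ ()
bounded {suc n} f with bounded (f ∘ suc)
... | N , f≤N = f zero ℕ.+ N , λ { zero → ℕ.m≤m+n _ _ ; (suc i) → ℕ.≤-trans (f≤N i) (ℕ.m≤n+m _ _) }

module FiniteExtension (em : ∀ {P : Set} → Dec P) {p : ℕ} (F : FiniteExtensionOfℚₚ p) where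
  open FiniteExtensionOfℚₚ F
  private
    C = FieldOps.commutativeRing asField
    module Q = RawRing (ℚₚ-rawRing p)
    module ι = RingHomomorphism ι
  open Ring C
  open FieldProperties em asField
  open Adjunction C
  open Integrality C
  open Integers asField ι
  open PadicImage asField ι
  open SetoidReasoning setoid

  private
    module Z = Subring ℤₚ-subring
    open OfSubring ℤₚ-subring

    𝐩-image : ℤₚ-image 𝐩
    𝐩-image = PadicArithmetic.p̂ p , refl

    module _ {n} (b : Fin (suc n) → Carrier) (b-span : ∀ x → ∃ λ (c : Fin (suc n) → Q.Carrier) → x ≈ sum (λ i → ι.⟦ c i ⟧ * b i))
             (b₀≉0 : ¬ b zero ≈ 0#) (x : Carrier) where

      row : ∀ i → ∃ λ (c : Fin (suc n) → Q.Carrier) → x * b i ≈ sum (λ j → ι.⟦ c j ⟧ * b j)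
      row i = b-span (x * b i)

      denominator : Fin (suc n) → Fin (suc n) → ℕ
      denominator i j = proj₁ (clear-denominator (proj₁ (row i) j))

      row-bound : ∀ i → ∃ λ N → ∀ j → denominator i j ℕ.≤ N
      row-bound i = bounded (denominator i)

      N : ℕ
      N = proj₁ (bounded (proj₁ ∘ row-bound))

      denominator≤N : ∀ i j → denominator i j ℕ.≤ N
      denominator≤N i j = ℕ.≤-trans (proj₂ (row-bound i) j) (proj₂ (bounded (proj₁ ∘ row-bound)) i)

      X : Carrier
      X = x * 𝐩 ^ N

      a : Fin (suc n) → Fin (suc n) → Carrier
      a i j = ι.⟦ proj₁ (row i) j ⟧ * 𝐩 ^ N

      clear-more : ∀ x k z → x * 𝐩 ^ k ≈ 𝕫 z → k ℕ.≤ N → ℤₚ-image (x * 𝐩 ^ N)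
      clear-more x k z e k≤N = Z.resp {x * 𝐩 ^ k * 𝐩 ^ (N ℕ.∸ k)} {x * 𝐩 ^ N} (trans (*-assoc x (𝐩 ^ k) (𝐩 ^ (N ℕ.∸ k))) (*-congˡ (trans (sym (^-homo-* 𝐩 k (N ℕ.∸ k)))
            (reflexive (≡.cong (𝐩 ^_) (ℕ.m+[n∸m]≡n k≤N))))))
          (Z.*-closed {x * 𝐩 ^ k} {𝐩 ^ (N ℕ.∸ k)} (z , e) (Z.^-closed {𝐩} (N ℕ.∸ k) 𝐩-image))

      a∈ℤₚ : ∀ i j → ℤₚ-image (a i j)
      a∈ℤₚ i j = clear-more ι.⟦ q ⟧ (proj₁ c) (proj₁ (proj₂ c)) (proj₂ (proj₂ c)) (denominator≤N i j)
        where
        q = proj₁ (row i) j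
        c = clear-denominator q

      entry : Fin (suc n) → Fin (suc n) → Carrier
      entry i j = X * δ i j + - a i j

      vanish : ∀ i → sum (λ j → entry i j * b j) ≈ 0#
      vanish i = begin
        sum (λ j → entry i j * b j)
          ≈⟨ sum-cong-≋ (λ j → S.solve 5 (λ X d q P b → (X :* d :+ (:- (q :* P))) :* b := d :* (X :* b) :+ (:- P) :* (q :* b))
               refl X (δ i j) ι.⟦ proj₁ (row i) j ⟧ (𝐩 ^ N) (b j)) ⟩
        sum (λ j → δ i j * (X * b j) + - 𝐩 ^ N * (ι.⟦ proj₁ (row i) j ⟧ * b j))
          ≈⟨ ∑-distrib-+ (λ j → δ i j * (X * b j)) (λ j → - 𝐩 ^ N * (ι.⟦ proj₁ (row i) j ⟧ * b j)) ⟩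
        sum (λ j → δ i j * (X * b j)) + sum (λ j → - 𝐩 ^ N * (ι.⟦ proj₁ (row i) j ⟧ * b j))
          ≈⟨ +-cong (δ-sum ℤₚ-subring i (λ j → X * b j)) (trans (sym (*-distribˡ-sum (- 𝐩 ^ N) (λ j → ι.⟦ proj₁ (row i) j ⟧ * b j)))
               (*-congˡ (sym (proj₂ (row i))))) ⟩
        X * b i + - 𝐩 ^ N * (x * b i)
          ≈⟨ S.solve 3 (λ x P b → x :* P :* b :+ (:- P) :* (x :* b) := P :* x :* b :- P :* x :* b) refl x (𝐩 ^ N) (b i) ⟩
        𝐩 ^ N * x * b i - 𝐩 ^ N * x * b i
          ≈⟨ -‿inverseʳ _ ⟩
        0#  ∎

      -- Multiplication by x has a matrix over ℚₚ in the spanning family b, and pᴺ clears its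
      -- denominators. For X = pᴺx, `elimination` then gives a monic expression y in X over ℤₚ with
      -- y · b₀ ≈ 0, in the role of the characteristic polynomial.
      X-integral : Integral X
      X-integral = conclude (elimination n b entry
          (λ i j → horner (const (δ∈R i j) refl) (Z.-‿closed {a i j} (a∈ℤₚ i j)) refl) vanish)
        where
        conclude : (∃₂ λ d y → Poly X d 1# y × y * b zero ≈ 0#) → Integral X
        conclude (d , y , P , y*b₀≈0) = toIntegral {X} (poly⇒integral (poly-resp refl
          (no-zero-divisors (trans (*-comm _ _) y*b₀≈0) b₀≉0) P))

  integral-multiple : ∀ x → ∃ λ N → Integral (x * 𝐩 ^ N)
  integral-multiple = go basis spanning independent
    where
    go : ∀ {n} (b : Fin n → Carrier) → (∀ x → ∃ λ (c : Fin n → Q.Carrier) → x ≈ sum (λ i → ι.⟦ c i ⟧ * b i)) →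
      (∀ (c : Fin n → Q.Carrier) → sum (λ i → ι.⟦ c i ⟧ * b i) ≈ 0# → ∀ i → c i Q.≈ Q.0#) → ∀ x → ∃ λ N → Integral (x * 𝐩 ^ N)
    go {zero}  b b-span b-independent x = contradiction (proj₂ (b-span 1#)) 1≉0
    go {suc n} b b-span b-independent x = N b b-span b₀≉0 x , X-integral b b-span b₀≉0 x
      where
      c : Fin (suc n) → Q.Carrier
      c zero    = Q.1#
      c (suc i) = Q.0#

      b₀≉0 : ¬ b zero ≈ 0#
      b₀≉0 e = 1≉0 (trans (sym ι.1#-homo) (trans (ι.⟦⟧-cong (b-independent c
        (trans (+-cong (trans (*-congˡ e) (zeroʳ _))
          (sum-0 (λ i → ι.⟦ Q.0# ⟧ * b (suc i)) (λ i → trans (*-congʳ ι.0#-homo) (zeroˡ _)))) (+-identityʳ 0#)) zero)) ι.0#-homo))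

module FieldHomomorphism (em : ∀ {P : Set} → Dec P) (K L : Field) (φ : RingHomomorphism (fieldRing K) (fieldRing L)) where
  private
    module K = Ring (FieldOps.commutativeRing K)
    module φ = RingHomomorphism φ
  open Ring (FieldOps.commutativeRing L)

  hom-^ : ∀ x n → φ.⟦ x K.^ n ⟧ ≈ φ.⟦ x ⟧ ^ n
  hom-^ x zero    = φ.1#-homo
  hom-^ x (suc n) = trans (φ.*-homo _ _) (*-congˡ (hom-^ x n))

  hom-sum : ∀ {n} (f : Fin n → K.Carrier) → φ.⟦ K.sum f ⟧ ≈ sum (φ.⟦_⟧ ∘ f)
  hom-sum {zero}  f = φ.0#-homo
  hom-sum {suc n} f = trans (φ.+-homo _ _) (+-congˡ (hom-sum (f ∘ suc)))

  hom-monic : ∀ {n} (c : Fin n → K.Carrier) x → φ.⟦ monic K c x ⟧ ≈ monic L (φ.⟦_⟧ ∘ c) φ.⟦ x ⟧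
  hom-monic {n} c x = trans (φ.+-homo _ _) (+-cong (hom-^ x n)
    (trans (hom-sum (λ i → c i K.* x K.^ toℕ i))
      (sum-cong-≋ (λ i → trans (φ.*-homo (c i) (x K.^ toℕ i)) (*-congˡ (hom-^ x (toℕ i)))))))

  hom-injective : ∀ {x} → φ.⟦ x ⟧ ≈ 0# → x K.≈ K.0#
  hom-injective {x} e with FieldProperties.zero-or-unit em K x
  ... | inj₁ x≈0 = x≈0
  ... | inj₂ (y , f) = contradiction (trans (sym φ.1#-homo) (trans (φ.⟦⟧-cong (K.sym f)) (trans (φ.*-homo _ _) (trans (*-congʳ e) (zeroˡ _)))))
    (FieldProperties.1≉0 em L)

  module _ {p : ℕ} (ι : RingHomomorphism (ℚₚ-rawRing p) (fieldRing K)) where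
    private
      module O  = Integers K ι
      module O′ = Integers L (_∘ʰ_ {K = L} φ ι)

    integral⁺ : ∀ {x} → O.Integral x → O′.Integral φ.⟦ x ⟧
    integral⁺ {x} (n , c , e) = n , c , trans (sym (hom-monic (λ i → RingHomomorphism.⟦_⟧ ι (ℤₚ⇒ℚₚ (c i))) x)) (trans (φ.⟦⟧-cong e) φ.0#-homo)

    integral⁻ : ∀ {x} → O′.Integral φ.⟦ x ⟧ → O.Integral x
    integral⁻ {x} (n , c , e) = n , c , hom-injective (trans (hom-monic (λ i → RingHomomorphism.⟦_⟧ ι (ℤₚ⇒ℚₚ (c i))) x) e)

module AlgebraicOver (em : ∀ {P : Set} → Dec P) (F : Field) (F̄ : AlgebraicClosure F) where
  open AlgebraicClosure F̄
  private
    C = FieldOps.commutativeRing asField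
    module F = Ring (FieldOps.commutativeRing F)
    module ι = RingHomomorphism ι
  open Ring C
  open Adjunction C
  open FieldProperties em asField

  -- An inverse w of z is a root of a polynomial over F, and wⁱzᵐ = zᵐ⁻ⁱ for i ≤ m.
  subring-inverse : ∀ {D : Pred Carrier 0ℓ} → Subring C D → (∀ c → D ι.⟦ c ⟧) → ∀ {z w} → D z → z * w ≈ 1# → D w
  subring-inverse {D} D-subring F⊆D {z} {w} z∈D zw≈1 with algebraic w
  ... | zero  , c , e = contradiction (trans (sym (+-identityʳ 1#)) e) 1≉0
  ... | suc m , c , e = D.resp w-eq (D.*-closed (D.-‿closed D.1-closed)
      (D.sum-closed _ (λ i → D.*-closed (F⊆D (c i)) (mixed (toℕ i) m (Fin.toℕ≤pred[n] i)))))
    where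
    module D = Subring D-subring

    mixed : ∀ i m → i ℕ.≤ m → D (w ^ i * z ^ m)
    mixed zero    m       i≤m         = D.resp (sym (*-identityˡ _)) (D.^-closed m z∈D)
    mixed (suc i) (suc m) (ℕ.s≤s i≤m) = D.resp
      (sym (trans (S.solve 4 (λ w u z v → w :* u :* (z :* v) := z :* w :* (u :* v)) refl w (w ^ i) z (z ^ m))
        (trans (*-congʳ zw≈1) (*-identityˡ _)))) (mixed i m i≤m)

    one : ∀ m → w ^ m * z ^ m ≈ 1#
    one zero    = *-identityˡ 1#
    one (suc m) = trans (S.solve 4 (λ w u z v → w :* u :* (z :* v) := z :* w :* (u :* v)) refl w (w ^ m) z (z ^ m))
      (trans (*-cong zw≈1 (one m)) (*-identityˡ _))

    w-eq : - 1# * sum (λ i → ι.⟦ c i ⟧ * (w ^ toℕ i * z ^ m)) ≈ w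
    w-eq = trans (*-congˡ (trans (sum-cong-≋ (λ i → sym (*-assoc ι.⟦ c i ⟧ (w ^ toℕ i) (z ^ m))))
        (sym (*-distribʳ-sum (z ^ m) (λ i → ι.⟦ c i ⟧ * w ^ toℕ i)))))
      (trans (-1*x≈-x _) (trans (-‿distribˡ-* _ _) (trans (*-congʳ (sym (inverseˡ-unique _ _ e)))
      (trans (*-assoc w (w ^ m) (z ^ m)) (trans (*-congˡ (one m)) (*-identityʳ w))))))

-- Congruences modulo π

module Congruences (C : CommutativeRing 0ℓ 0ℓ) where
  open Ring C
  open Adjunction C
  open Mult semiring using (×-congˡ; ×-congʳ; ×-homo-1; ×-assoc-*) renaming (_×_ to _·ℕ_)
  open SetoidReasoning setoid

  ν : ℕ → Carrier
  ν n = n ·ℕ 1#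

  middle : ∀ n x y → Fin n → Carrier
  middle n x y i = ν (suc n Comb.C suc (toℕ i)) * (x ^ suc (toℕ i) * y ^ (n ℕ.∸ toℕ i))

  -- The two outer terms have coefficient 1; they are separated from the inner ones, whose
  -- coefficients turn out to lie in (π) when `suc n` is q.
  binomial-split : ∀ n x y → (x + y) ^ suc n ≈ y ^ suc n + (sum (middle n x y) + x ^ suc n)
  binomial-split n x y = begin
    (x + y) ^ suc n
      ≈⟨ Binomial.theorem commutativeSemiring (suc n) x y ⟩
    term zero + sum (term ∘ suc)
      ≈⟨ +-cong first (sum-init-last (term ∘ suc)) ⟩
    y ^ suc n + (sum (term ∘ suc ∘ inject₁) + term (suc (fromℕ n)))
      ≈⟨ +-congˡ (+-cong (sum-cong-≋ middle-term) last-term) ⟩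
    y ^ suc n + (sum (middle n x y) + x ^ suc n)  ∎
    where
    term : Fin (suc (suc n)) → Carrier
    term k = (suc n Comb.C toℕ k) ·ℕ (x ^ toℕ k * y ^ (suc n ℕ.∸ toℕ k))

    scalar : ∀ m z → m ·ℕ z ≈ ν m * z
    scalar m z = trans (×-congʳ m (sym (*-identityˡ z))) (sym (×-assoc-* m 1# z))

    first : term zero ≈ y ^ suc n
    first = trans (×-congˡ {1# * y ^ suc n} (≡.trans (nCk≡nC[n∸k] {n = suc n} ℕ.z≤n) (nCn≡1 (suc n)))) (trans (×-homo-1 _) (*-identityˡ _))

    middle-term : ∀ i → term (suc (inject₁ i)) ≈ middle n x y i
    middle-term i = trans (scalar (suc n Comb.C suc (toℕ (inject₁ i))) _)
      (reflexive (≡.cong (λ k → ν (suc n Comb.C suc k) * (x ^ suc k * y ^ (n ℕ.∸ k))) (Fin.toℕ-inject₁ i)))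

    last-term : term (suc (fromℕ n)) ≈ x ^ suc n
    last-term = trans (scalar (suc n Comb.C suc (toℕ (fromℕ n))) _)
      (trans (reflexive (≡.cong (λ k → ν (suc n Comb.C suc k) * (x ^ suc k * y ^ (n ℕ.∸ k))) (Fin.toℕ-fromℕ n)))
        (trans (*-cong (trans (×-congˡ {1#} (nCn≡1 (suc n))) (+-identityʳ 1#)) (trans (*-congˡ (reflexive (≡.cong (y ^_) (ℕ.n∸n≡0 n)))) (*-identityʳ _)))
          (*-identityˡ _)))

  module Modulo {O : Pred Carrier 0ℓ} (O-subring : Subring C O) (π : Carrier) where
    open Subring O-subring

    I : Pred Carrier 0ℓ
    I x = ∃ λ z → O z × x ≈ π * z

    I-resp : ∀ {x y} → x ≈ y → I x → I y
    I-resp e (z , m , f) = z , m , trans (sym e) f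

    I-+ : ∀ {x y} → I x → I y → I (x + y)
    I-+ (z , m , e) (w , n , f) = z + w , +-closed m n , trans (+-cong e f) (sym (distribˡ π z w))

    I-* : ∀ {x y} → O x → I y → I (x * y)
    I-* {x} m (w , n , f) = x * w , *-closed m n ,
      trans (*-congˡ f) (S.solve 3 (λ x π w → x :* (π :* w) := π :* (x :* w)) refl x π w)

    I-neg : ∀ {x} → I x → I (- x)
    I-neg p = I-resp (-1*x≈-x _) (I-* (-‿closed 1-closed) p)

    I-0 : I 0#
    I-0 = 0# , 0-closed , sym (zeroʳ π)

    I-sum : ∀ {n} (f : Fin n → Carrier) → (∀ i → I (f i)) → I (sum f)
    I-sum {zero}  f m = I-0
    I-sum {suc n} f m = I-+ (m zero) (I-sum (f ∘ suc) (m ∘ suc))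

    I-^ : ∀ {x y} n → O x → O y → I (x - y) → I (x ^ n - y ^ n)
    I-^ zero x∈O y∈O m = I-resp (sym (-‿inverseʳ 1#)) I-0
    I-^ {x} {y} (suc n) x∈O y∈O m = I-resp
      (S.solve 4 (λ x y u v → u :* (x :- y) :+ y :* (u :- v) := x :* u :- y :* v) refl x y (x ^ n) (y ^ n))
      (I-+ (I-* (^-closed n x∈O) m) (I-* y∈O (I-^ n x∈O y∈O m)))

    -- The coefficients of (f(X) - f(r)) / (X - r) are the values at r of the
    -- polynomials obtained from f by dropping the lowest terms.
    quotient : ∀ {n} → Carrier → (Fin (suc n) → Carrier) → Fin n → Carrier
    quotient {suc n} r c zero    = polynomial (c ∘ suc) r
    quotient {suc n} r c (suc i) = quotient r (c ∘ suc) i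

    quotient-eq : ∀ {n} (c : Fin (suc n) → Carrier) x r →
      polynomial c x - polynomial c r ≈ (x - r) * polynomial (quotient r c) x
    quotient-eq {zero} c x r = trans (-‿inverseʳ _) (sym (zeroʳ _))
    quotient-eq {suc n} c x r = begin
      polynomial c x - polynomial c r
        ≈⟨ +-cong (polynomial-suc c x) (-‿cong (polynomial-suc c r)) ⟩
      (c zero + x * gx) - (c zero + r * gr)
        ≈⟨ S.solve 5 (λ c x r g h → (c :+ x :* g) :- (c :+ r :* h) := (x :- r) :* h :+ x :* (g :- h))
             refl (c zero) x r gx gr ⟩
      (x - r) * gr + x * (gx - gr)
        ≈⟨ +-congˡ (*-congˡ (quotient-eq (c ∘ suc) x r)) ⟩
      (x - r) * gr + x * ((x - r) * Q)
        ≈⟨ S.solve 4 (λ x r g Q → (x :- r) :* g :+ x :* ((x :- r) :* Q) := (x :- r) :* (g :+ x :* Q))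
             refl x r gr Q ⟩
      (x - r) * (gr + x * Q)
        ≈⟨ *-congˡ (polynomial-suc (quotient r c) x) ⟨
      (x - r) * polynomial (quotient r c) x  ∎
      where
      gx = polynomial (c ∘ suc) x
      gr = polynomial (c ∘ suc) r
      Q  = polynomial (quotient r (c ∘ suc)) x

    polynomial-closed : ∀ {n} (c : Fin n → Carrier) {x} → (∀ i → O (c i)) → O x → O (polynomial c x)
    polynomial-closed c {x} m x∈O = sum-closed (λ i → c i * x ^ toℕ i) (λ i → *-closed (m i) (^-closed (toℕ i) x∈O))

    quotient-closed : ∀ {n} r (c : Fin (suc n) → Carrier) → O r → (∀ i → O (c i)) → ∀ i → O (quotient r c i)
    quotient-closed {suc n} r c r∈O m zero    = polynomial-closed (c ∘ suc) (m ∘ suc) r∈O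
    quotient-closed {suc n} r c r∈O m (suc i) = quotient-closed r (c ∘ suc) r∈O (m ∘ suc) i

    -- Back-substitution: the constant coefficient is the value at r minus r times the lowest
    -- coefficient of the quotient. That lowest coefficient is the value at r of the truncated
    -- polynomial, which is the remainder needed for the recursion.
    recover : ∀ {n} r (c : Fin (suc n) → Carrier) → O r → I (polynomial c r) → (∀ i → I (quotient r c i)) → ∀ i → I (c i)
    recover {zero} r c r∈O m k zero = I-resp (trans (polynomial-suc c r) (trans (+-congˡ (zeroʳ r)) (+-identityʳ _))) m
    recover {suc n} r c r∈O m k zero = I-resp
      (trans (+-congʳ (polynomial-suc c r)) (trans (+-assoc _ _ _) (trans (+-congˡ (-‿inverseʳ _)) (+-identityʳ _))))
      (I-+ m (I-neg (I-* r∈O (k zero))))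
    recover {suc n} r c r∈O m k (suc i) = recover r (c ∘ suc) r∈O (k zero) (k ∘ suc) i

    -- Dividing by X - r₀ leaves a quotient that vanishes modulo π at the other roots, as rᵢ - r₀
    -- cancels modulo π. Cancellation is a hypothesis because O/π is an arbitrary ring here.
    roots : ∀ {n} (c r : Fin n → Carrier) → (∀ i → O (c i)) → (∀ i → O (r i)) →
      (∀ i j → i ≢ j → ∀ {x} → O x → I ((r i - r j) * x) → I x) →
      (∀ i → I (polynomial c (r i))) → ∀ i → I (c i)
    roots {suc n} c r c∈O r∈O distinct vanish =
      recover (r zero) c (r∈O zero) (vanish zero)
        (roots (quotient (r zero) c) (r ∘ suc) (quotient-closed (r zero) c (r∈O zero) c∈O) (r∈O ∘ suc)
          (λ i j i≢j → distinct (suc i) (suc j) (λ { ≡.refl → i≢j ≡.refl }))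
          (λ i → distinct (suc i) zero (λ ())
            (polynomial-closed (quotient (r zero) c) (quotient-closed (r zero) c (r∈O zero) c∈O) (r∈O (suc i)))
            (I-resp (quotient-eq c (r (suc i)) (r zero)) (I-+ (vanish (suc i)) (I-neg (vanish zero))))))

    -- With q = n + 1, the polynomial (X + 1)^q - X^q - 1 has degree < q and vanishes
    -- modulo π at the q roots of X^q - X; so x ↦ x^q is additive modulo π.
    module _ {n : ℕ} (r : Fin (suc n) → Carrier) (r∈O : ∀ i → O (r i))
      (distinct : ∀ i j → i ≢ j → ∀ {x} → O x → I ((r i - r j) * x) → I x)
      (fermat : ∀ {x} → O x → I (x ^ suc n - x)) where

      ν-closed : ∀ m → O (ν m)
      ν-closed zero    = 0-closed
      ν-closed (suc m) = +-closed 1-closed (ν-closed m)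

      private
        c : Fin (suc n) → Carrier
        c zero    = 0#
        c (suc i) = ν (suc n Comb.C suc (toℕ i))

        c∈O : ∀ i → O (c i)
        c∈O zero    = 0-closed
        c∈O (suc i) = ν-closed (suc n Comb.C suc (toℕ i))

        1^ : ∀ k → 1# ^ k ≈ 1#
        1^ zero    = refl
        1^ (suc k) = trans (*-identityˡ _) (1^ k)

        value : ∀ x → polynomial c x ≈ sum (middle n x 1#)
        value x = trans (+-congʳ (zeroˡ _)) (trans (+-identityˡ _)
          (sum-cong (λ i → c (suc i) * x ^ suc (toℕ i)) (middle n x 1#) (λ i → *-congˡ (sym (trans (*-congˡ (1^ (n ℕ.∸ toℕ i))) (*-identityʳ _))))))

        vanish : ∀ {x} → O x → I (polynomial c x)
        -- The value (x + 1)^q - x^q - 1 is the difference of (x + 1)^q - (x + 1) and x^q - x.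
        vanish {x} x∈O = I-resp (sym (value x)) (I-resp
          (trans (+-congʳ (+-congʳ (binomial-split n x 1#)))
            (trans (+-congʳ (+-congʳ (+-congʳ (1^ (suc n)))))
            (S.solve 4 (λ o m y x → (o :+ (m :+ y)) :- (x :+ o) :- (y :- x) := m) refl 1# (sum (middle n x 1#)) (x ^ suc n) x)))
          (I-+ (fermat (+-closed x∈O 1-closed)) (I-neg (fermat x∈O))))

      binomial-divisible : ∀ i → I (ν (suc n Comb.C suc (toℕ {n} i)))
      binomial-divisible i = roots c r c∈O r∈O distinct (λ i → vanish (r∈O i)) (suc i)

-- Integers of the maximal unramified extension

module MaximalUnramified
  (em : ∀ {P : Set} → Dec P) {p n : ℕ}
  (F : FiniteExtensionOfℚₚ p) (F̄ : AlgebraicClosure (FiniteExtensionOfℚₚ.asField F))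
  (π : ∣ FiniteExtensionOfℚₚ.asField F ∣) (π-uniformiser : UniformiserOf F π)
  (residue : ResidueOrder F π (suc n))
  (Φ : Galois.Automorphism F F̄ π) (frobenius : Galois.IsFrobenius F F̄ π (suc n) Φ) where

  module F   = FiniteExtensionOfℚₚ F
  module F̄   = AlgebraicClosure F̄
  module Fʳ  = Ring (FieldOps.commutativeRing F.asField)
  module 𝓞F  = Integers F.asField F.ι
  module Fᵖ  = PadicImage F.asField F.ι
  module Ff  = FieldProperties em F.asField
  module Hom = FieldHomomorphism em F.asField F̄.asField F̄.ι
  module ι   = RingHomomorphism F̄.ι
  module π   = 𝓞F.IsUniformiser π-uniformiser
  module res = 𝓞F.HasResidueOrder residue
  module Φ   = Galois.Automorphism Φ
  C = FieldOps.commutativeRing F̄.asField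
  open Galois F F̄ π
  open Ring C
  open FieldProperties em F̄.asField
  open Adjunction C
  open Congruences C
  open Integers F̄.asField (_∘ʰ_ {K = F̄.asField} F̄.ι F.ι)
  module P = PadicImage F̄.asField (_∘ʰ_ {K = F̄.asField} F̄.ι F.ι)
  module Int = Subring P.Integral-subring
  module IntF = Subring Fᵖ.Integral-subring

  q : ℕ
  q = suc n

  φ : Fʳ.Carrier → Carrier
  φ = ι.⟦_⟧

  π̄ : Carrier
  π̄ = φ π

  φ-injective : ∀ {x y} → φ x ≈ φ y → x Fʳ.≈ y
  φ-injective {x} {y} e = Fʳ.x∙y⁻¹≈ε⇒x≈y x y (Hom.hom-injective
    (trans (ι.+-homo _ _) (trans (+-cong e (ι.-‿homo y)) (-‿inverseʳ _))))

  π̄≉0 : ¬ π̄ ≈ 0#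
  π̄≉0 e = π.nonzero (Hom.hom-injective e)

  φ-inverse : ∀ {a z} → φ a * z ≈ 1# → ∃ λ b → a Fʳ.* b Fʳ.≈ Fʳ.1# × z ≈ φ b
  φ-inverse {a} {z} e = uniqueness (Ff.inverse λ a≈0 → unit≉0 e (trans (ι.⟦⟧-cong a≈0) ι.0#-homo))
    where
    uniqueness : (∃ λ b → a Fʳ.* b Fʳ.≈ Fʳ.1#) → _
    uniqueness (b , f) = b , f , cancel (unit≉0 e) (trans e (sym (trans (sym (ι.*-homo a b)) (trans (ι.⟦⟧-cong f) ι.1#-homo))))

  OF : Pred Carrier 0ℓ
  OF x = ∃ λ a → 𝓞F.Integral a × x ≈ φ a

  OF-subring : Subring C OF
  OF-subring = record
    { resp     = λ { e (a , m , f) → a , m , trans (sym e) f }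
    ; +-closed = λ { (a , m , e) (b , k , f) → a Fʳ.+ b , IntF.+-closed m k , trans (+-cong e f) (sym (ι.+-homo a b)) }
    ; *-closed = λ { (a , m , e) (b , k , f) → a Fʳ.* b , IntF.*-closed m k , trans (*-cong e f) (sym (ι.*-homo a b)) }
    ; -‿closed = λ { (a , m , e) → Fʳ.- a , IntF.-‿closed m , trans (-‿cong e) (sym (ι.-‿homo a)) }
    ; 1-closed = Fʳ.1# , IntF.1-closed , sym ι.1#-homo
    }

  module OF = Subring OF-subring
  module Iᶠ = Modulo OF-subring π̄

  OF-integral : ∀ {x} → OF x → Integral x
  OF-integral (a , m , e) = Int.resp (sym e) (Hom.integral⁺ F.ι m)

  π̄∈OF : OF π̄
  π̄∈OF = π , proj₂ π.mem , refl

  -- An inverse of π in F̄ comes from F, and integrality is reflected by F → F̄, so properness of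
  -- (π) in 𝓞_F carries over to all integral elements of F̄.
  π̄-proper : ∀ {z} → Integral z → ¬ π̄ * z ≈ 1#
  π̄-proper {z} m e = result (φ-inverse e)
    where
    result : (∃ λ b → π Fʳ.* b Fʳ.≈ Fʳ.1# × z ≈ φ b) → ⊥
    result (b , f , g) = π.proper (b , (_ , Hom.integral⁻ F.ι (Int.resp g m)) , Fʳ.sym f)

  unit-modulo : ∀ {x} → OF x → ¬ Iᶠ.I x → ∃ λ y → OF y × Iᶠ.I (1# - x * y)
  unit-modulo {x} (a , m , e) x∉I = result (π.maximal (_ , m) λ { (b , (_ , k) , f) →
      x∉I (φ b , (b , k , refl) , trans e (trans (ι.⟦⟧-cong f) (ι.*-homo π b))) })
    where
    result : (∃ λ y → y ∈ 𝓞F.𝓞 U × π 𝓞F.∣[ 𝓞F.𝓞 U ] (Fʳ.1# Fʳ.- a Fʳ.* y)) → ∃ λ y → OF y × Iᶠ.I (1# - x * y)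
    result (y , (_ , k) , (z , (_ , l) , f)) = φ y , (y , k , refl) , φ z , (z , l , refl) ,
      trans (sym (trans (ι.+-homo _ _) (+-cong ι.1#-homo (trans (ι.-‿homo _) (-‿cong (trans (ι.*-homo a y) (*-congʳ (sym e))))))))
        (trans (ι.⟦⟧-cong f) (ι.*-homo π z))

  -- F as a subextension of itself. `IsFrobenius` and `Fⁿʳ` speak of subextensions only, and this is
  -- how they are applied to elements of F.
  base : FiniteSubextension 1
  base = record
    { basis       = λ _ → 1#
    ; independent = λ { c e zero → Hom.hom-injective (trans (sym (flat c)) e) }
    ; 1-closed    = (λ _ → Fʳ.1#) , sym (trans (flat (λ _ → Fʳ.1#)) ι.1#-homo)
    ; *-closed    = λ { (c , e) (d , f) → (λ _ → c zero Fʳ.* d zero) ,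
        trans (*-cong (trans e (flat c)) (trans f (flat d))) (trans (sym (ι.*-homo _ _)) (sym (flat (λ _ → c zero Fʳ.* d zero)))) }
    ; ⁻¹-closed   = λ { (c , e) f → inverse-span c (φ-inverse (trans (*-congʳ (sym (trans e (flat c)))) f)) }
    }
    where
    flat : ∀ (c : Fin 1 → Fʳ.Carrier) → φ (c zero) * 1# + 0# ≈ φ (c zero)
    flat c = trans (+-identityʳ _) (*-identityʳ _)
    inverse-span : ∀ (c : Fin 1 → Fʳ.Carrier) {y} → (∃ λ b → c zero Fʳ.* b Fʳ.≈ Fʳ.1# × y ≈ φ b) →
      ∃ λ (c : Fin 1 → Fʳ.Carrier) → y ≈ φ (c zero) * 1# + 0#
    inverse-span c (b , _ , g) = (λ _ → b) , trans g (sym (flat (λ _ → b)))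

  OF⇒base : ∀ {x} → OF x → x ∈ 𝓞 ⌊ base ⌋
  OF⇒base m@(a , k , e) = ((λ _ → a) , trans e (sym (trans (+-identityʳ _) (*-identityʳ _)))) , OF-integral m

  base⇒OF : ∀ {x} → x ∈ 𝓞 ⌊ base ⌋ → OF x
  base⇒OF ((c , e) , m) = c zero , Hom.integral⁻ F.ι (Int.resp f m) , f
    where f = trans e (trans (+-identityʳ _) (*-identityʳ _))

  base-unramified : Unramified base
  base-unramified = π̄ , record
      { mem     = OF⇒base π̄∈OF
      ; nonzero = π̄≉0
      ; proper  = λ { (z , (_ , m) , e) → π̄-proper m (sym e) }
      ; maximal = λ {x} m x∉I → unit (unit-modulo (base⇒OF m) λ { (z , k , e) → x∉I (z , OF⇒base k , e) })
      } , (1# , OF⇒base OF.1-closed , refl) ,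
    (1# , OF⇒base OF.1-closed , sym (trans (*-identityʳ _) (*-identityʳ _)))
    where
    unit : ∀ {x} → (∃ λ y → OF y × Iᶠ.I (1# - x * y)) → ∃ λ y → y ∈ 𝓞 ⌊ base ⌋ × π̄ ∣[ 𝓞 ⌊ base ⌋ ] (1# - x * y)
    unit (y , k , z , l , e) = y , OF⇒base k , z , OF⇒base l , e

  -- Φ fixes F, so its Frobenius congruence on `base` becomes the one of Fermat.
  fermat : ∀ {x} → OF x → Iᶠ.I (x ^ q - x)
  fermat {x} m@(a , _ , e) = convert (frobenius base base-unramified (OF⇒base m))
    where
    convert : π̄ ∣[ 𝓞 ⌊ base ⌋ ] (Φ.act x ^ q - x) → Iᶠ.I (x ^ q - x)
    convert (z , k , f) = z , base⇒OF k ,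
      trans (+-congʳ (^-congˡ q (trans e (trans (sym (Φ.fixesF a)) (Φ.cong (sym e)))))) f

  -- The difference d of two representatives has an inverse y modulo π, by maximality of (π), and x
  -- = x(1 - dy) + y(dx).
  distinct : ∀ i j → i ≢ j → ∀ {x} → OF x → Iᶠ.I ((φ (res.rep i) - φ (res.rep j)) * x) → Iᶠ.I x
  distinct i j i≢j {x} x∈OF m = result (unit-modulo d∈OF d∉I)
    where
    d = φ (res.rep i) - φ (res.rep j)
    rep∈ : ∀ i → OF (φ (res.rep i))
    rep∈ i = res.rep i , proj₂ (res.rep-mem i) , refl
    d∈OF : OF d
    d∈OF = OF.−-closed (rep∈ i) (rep∈ j)
    d∉I : ¬ Iᶠ.I d
    d∉I (z , (b , k , f) , e) = i≢j (res.injective (b , (_ , k) ,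
      φ-injective (trans (trans (ι.+-homo _ _) (+-congˡ (ι.-‿homo _))) (trans e (trans (*-congˡ f) (sym (ι.*-homo π b)))))))
    result : (∃ λ y → OF y × Iᶠ.I (1# - d * y)) → Iᶠ.I x
    result (y , y∈OF , k) = Iᶠ.I-resp
      (trans (+-cong (S.solve 4 (λ x o d y → x :* (o :- d :* y) := x :* o :- x :* d :* y) refl x 1# d y)
         (S.solve 3 (λ x d y → y :* (d :* x) := x :* d :* y) refl x d y))
       (trans (S.solve 2 (λ a b → a :- b :+ b := a) refl (x * 1#) (x * d * y)) (*-identityʳ x)))
      (Iᶠ.I-+ (Iᶠ.I-* x∈OF k) (Iᶠ.I-* y∈OF m))

  -- The source is a count of roots: the q residues are roots of X^q - X, and a polynomial of lower
  -- degree vanishing at all of them is zero modulo π.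
  binomial-coefficients : ∀ i → Iᶠ.I (ν (q Comb.C suc (toℕ {n} i)))
  binomial-coefficients = Iᶠ.binomial-divisible (φ ∘ res.rep) (λ i → res.rep i , proj₂ (res.rep-mem i) , refl) distinct fermat

  -- With a single residue class, 0 and 1 would be congruent modulo π.
  2≤q : 2 ℕ.≤ q
  2≤q = two n (res.exhaust (_ , IntF.0-closed)) (res.exhaust (_ , IntF.1-closed)) ≡.refl
    where
    two : ∀ m → (∃ λ i → π 𝓞F.∣[ 𝓞F.𝓞 U ] (Fʳ.0# Fʳ.- res.rep i)) → (∃ λ i → π 𝓞F.∣[ 𝓞F.𝓞 U ] (Fʳ.1# Fʳ.- res.rep i)) →
      m ≡ n → 2 ℕ.≤ suc m
    two (suc m) _ _ _ = ℕ.s≤s (ℕ.s≤s ℕ.z≤n)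
    two zero (i , (z , (_ , k) , e)) (j , (w , (_ , l) , f)) ≡.refl = contradiction
      (w Fʳ.- z , (_ , IntF.−-closed l k) , Fʳ.trans (Fʳ.sym difference) (Fʳ.trans (Fʳ.+-cong f (Fʳ.-‿cong e))
        (Fʳ.S.solve 3 (λ π w z → π Fʳ.:* w Fʳ.:- π Fʳ.:* z Fʳ.:= π Fʳ.:* (w Fʳ.:- z)) Fʳ.refl π w z))) π.proper
      where
      i≡j : ∀ (i j : Fin 1) → i ≡ j
      i≡j zero zero = ≡.refl
      difference : (Fʳ.1# Fʳ.- res.rep j) Fʳ.- (Fʳ.0# Fʳ.- res.rep i) Fʳ.≈ Fʳ.1#
      difference = Fʳ.trans (Fʳ.+-congʳ (Fʳ.+-congˡ (Fʳ.-‿cong (Fʳ.reflexive (≡.cong res.rep (i≡j j i))))))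
        (Fʳ.trans (Fʳ.S.solve 3 (λ o z r → (o Fʳ.:- r) Fʳ.:- (z Fʳ.:- r) Fʳ.:= o Fʳ.:- z) Fʳ.refl Fʳ.1# Fʳ.0# (res.rep i))
          (Fʳ.trans (Fʳ.+-congˡ Fʳ.-0#≈0#) (Fʳ.+-identityʳ _)))

-- The ring generated by unramified integers is reduced modulo π

module UnramifiedIntegers
  (em : ∀ {P : Set} → Dec P) {p n : ℕ}
  (F : FiniteExtensionOfℚₚ p) (F̄ : AlgebraicClosure (FiniteExtensionOfℚₚ.asField F))
  (π : ∣ FiniteExtensionOfℚₚ.asField F ∣) (π-uniformiser : UniformiserOf F π)
  (residue : ResidueOrder F π (suc n))
  (Φ : Galois.Automorphism F F̄ π) (frobenius : Galois.IsFrobenius F F̄ π (suc n) Φ) where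

  open MaximalUnramified em F F̄ π π-uniformiser residue Φ frobenius public
  open Galois F F̄ π
  open Ring C
  open FieldProperties em F̄.asField
  open Adjunction C
  open Congruences C
  open Integers F̄.asField (_∘ʰ_ {K = F̄.asField} F̄.ι F.ι)

  iterate : ℕ → Carrier → Carrier
  iterate zero    x = x
  iterate (suc k) x = Φ.act (iterate k x)

  -- The subring generated by the integers of the finite unramified extensions;
  -- the conjugates make its stability under Φ evident.
  data A : Pred Carrier 0ℓ where
    conjugate : ∀ {m x} (L : FiniteSubextension m) → Unramified L → x ∈ 𝓞 ⌊ L ⌋ → ∀ k → A (iterate k x)
    resp      : ∀ {x y} → x ≈ y → A x → A y
    +-closed  : ∀ {x y} → A x → A y → A (x + y)
    *-closed  : ∀ {x y} → A x → A y → A (x * y)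

  OF⊆A : ∀ {x} → OF x → A x
  OF⊆A m = conjugate base base-unramified (OF⇒base m) 0

  A-subring : Subring C A
  A-subring = record
    { resp     = resp
    ; +-closed = +-closed
    ; *-closed = *-closed
    ; -‿closed = λ m → resp (-1*x≈-x _) (*-closed (OF⊆A (OF.-‿closed OF.1-closed)) m)
    ; 1-closed = OF⊆A OF.1-closed
    }

  module Aˢ = Subring A-subring
  open Modulo A-subring π̄ public

  iterate-integral : ∀ k {x} → Integral x → Integral (iterate k x)
  iterate-integral zero    m = m
  iterate-integral (suc k) m = Transport.integral⁺ Φ (iterate-integral k m)

  A-integral : ∀ {x} → A x → Integral x
  A-integral (conjugate L u (_ , m) k) = iterate-integral k m
  A-integral (resp e m)     = Int.resp e (A-integral m)
  A-integral (+-closed m k) = Int.+-closed (A-integral m) (A-integral k)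
  A-integral (*-closed m k) = Int.*-closed (A-integral m) (A-integral k)

  Φ-A : ∀ {x} → A x → A (Φ.act x)
  Φ-A (conjugate L u m k) = conjugate L u m (suc k)
  Φ-A (resp e m)     = resp (Φ.cong e) (Φ-A m)
  Φ-A (+-closed m k) = resp (sym (Φ.+-homo _ _)) (+-closed (Φ-A m) (Φ-A k))
  Φ-A (*-closed m k) = resp (sym (Φ.*-homo _ _)) (*-closed (Φ-A m) (Φ-A k))

  Φ-I : ∀ {x} → I x → I (Φ.act x)
  Φ-I (z , m , e) = Φ.act z , Φ-A m , trans (Φ.cong e) (trans (Φ.*-homo _ _) (*-congʳ (Φ.fixesF π)))

  Iᶠ⊆I : ∀ {x} → Iᶠ.I x → I x
  Iᶠ⊆I (z , m , e) = z , OF⊆A m , e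

  q-power-additive : ∀ {x y} → A x → A y → I ((x + y) ^ q - (x ^ q + y ^ q))
  q-power-additive {x} {y} m k = I-resp
    (sym (trans (+-congʳ (binomial-split n x y))
      (S.solve 3 (λ a b c → (b :+ (c :+ a)) :- (a :+ b) := c) refl (x ^ q) (y ^ q) (sum (middle n x y)))))
    (I-sum (middle n x y) (λ i → I-resp (*-comm _ _)
      (I-* (*-closed (Aˢ.^-closed (suc (toℕ i)) m) (Aˢ.^-closed (n ℕ.∸ toℕ i) k)) (Iᶠ⊆I (binomial-coefficients i)))))

  -- The hypothesis covers the integers of one extension at a time. It passes to the generated ring
  -- because both sides of the congruence are additive and multiplicative modulo π.
  Φ-power : ∀ {x} → A x → I (Φ.act x ^ q - x)
  Φ-power (conjugate {x = x} L u m k) = go k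
    where
    start : π̄ ∣[ 𝓞 ⌊ L ⌋ ] (Φ.act x ^ q - x) → I (Φ.act x ^ q - x)
    start (z , z∈ , e) = z , conjugate L u z∈ 0 , e
    go : ∀ k → I (Φ.act (iterate k x) ^ q - iterate k x)
    go zero    = start (frobenius L u m)
    -- Φ maps πA into itself as it fixes π, so it may be applied to the previous congruence.
    go (suc k) = I-resp (trans (Φ.+-homo _ _) (+-cong (Transport.^-homo Φ _ q) (Φ.-‿homo _))) (Φ-I (go k))
  Φ-power (resp e m) = I-resp (+-cong (^-congˡ q (Φ.cong e)) (-‿cong e)) (Φ-power m)
  Φ-power (+-closed {x} {y} m k) = I-resp
    (trans (S.solve 5 (λ w a b x y → w :- (a :+ b) :+ ((a :- x) :+ (b :- y)) := w :- (x :+ y)) refl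
        ((Φ.act x + Φ.act y) ^ q) (Φ.act x ^ q) (Φ.act y ^ q) x y)
      (+-congʳ (^-congˡ q (sym (Φ.+-homo x y)))))
    (I-+ (q-power-additive (Φ-A m) (Φ-A k)) (I-+ (Φ-power m) (Φ-power k)))
  Φ-power (*-closed {x} {y} m k) = I-resp
    (trans (S.solve 4 (λ a b x y → b :* (a :- x) :+ x :* (b :- y) := a :* b :- x :* y) refl
        (Φ.act x ^ q) (Φ.act y ^ q) x y)
      (+-congʳ (sym (trans (^-congˡ q (Φ.*-homo x y)) (^-distrib-* _ _ q)))))
    (I-+ (I-* (Aˢ.^-closed q (Φ-A k)) (Φ-power m)) (I-* m (Φ-power k)))

  iterate-A : ∀ k {x} → A x → A (iterate k x)
  iterate-A zero    m = m
  iterate-A (suc k) m = Φ-A (iterate-A k m)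

  iterate-power : ∀ k {x} → A x → I (iterate k x ^ (q ℕ.^ k) - x)
  iterate-power zero {x} m = I-resp (sym (trans (+-congʳ (*-identityʳ x)) (-‿inverseʳ x))) I-0
  iterate-power (suc k) {x} m = I-resp
    (trans (+-congʳ (+-congʳ (^-assocʳ _ q (q ℕ.^ k))))
      (S.solve 3 (λ a b x → a :- b :+ (b :- x) := a :- x) refl _ (iterate k x ^ (q ℕ.^ k)) x))
    (I-+ (I-^ (q ℕ.^ k) (Aˢ.^-closed q (Φ-A (iterate-A k m))) (iterate-A k m) (Φ-power (iterate-A k m))) (iterate-power k m))

  iterate-I : ∀ k {x} → I x → I (iterate k x)
  iterate-I zero    m = m
  iterate-I (suc k) m = Φ-I (iterate-I k m)

  iterate-^ : ∀ k m x → iterate k (x ^ m) ≈ iterate k x ^ m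
  iterate-^ zero    m x = refl
  iterate-^ (suc k) m x = trans (Φ.cong (iterate-^ k m x)) (Transport.^-homo Φ _ m)

  N<q^N : ∀ N → N ℕ.< q ℕ.^ N
  N<q^N zero    = ℕ.s≤s ℕ.z≤n
  N<q^N (suc N) = ℕ.≤-trans (ℕ.+-mono-≤ (ℕ.≤-trans (ℕ.s≤s ℕ.z≤n) (N<q^N N)) (N<q^N N))
    (ℕ.≤-trans (ℕ.≤-reflexive (≡.cong (q ℕ.^ N ℕ.+_) (≡.sym (ℕ.+-identityʳ _)))) (ℕ.*-monoˡ-≤ (q ℕ.^ N) 2≤q))

  -- The Frobenius congruence Φᵏ(x)^(qᵏ) ≡ x makes A/π reduced.
  reduced : ∀ N {x} → A x → I (x ^ N) → I x
  reduced N {x} m x^N∈I = I-resp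
    (S.solve 2 (λ a x → a :- (a :- x) := x) refl (iterate N x ^ (q ℕ.^ N)) x)
    (I-+ (I-resp (iterate-^ N (q ℕ.^ N) x) (iterate-I N power)) (I-neg (iterate-power N m)))
    where
    power : I (x ^ (q ℕ.^ N))
    -- The exponent qᴺ is at least N, so xᴺ divides the power.
    power = I-resp (trans (sym (^-homo-* x (q ℕ.^ N ℕ.∸ N) N)) (reflexive (≡.cong (x ^_) (ℕ.m∸n+n≡m (ℕ.<⇒≤ (N<q^N N))))))
      (I-* (Aˢ.^-closed (q ℕ.^ N ℕ.∸ N) m) x^N∈I)

  -- Each factor z is paired with one factor π, which is possible as i ≤ m; the factors π left over
  -- are in A anyway.
  mixed : ∀ {z} → A (π̄ * z) → ∀ i m → i ℕ.≤ m → A (z ^ i * π̄ ^ m)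
  mixed πz∈A zero    m       i≤m         = resp (sym (*-identityˡ _)) (Aˢ.^-closed m (OF⊆A π̄∈OF))
  mixed {z} πz∈A (suc i) (suc m) (ℕ.s≤s i≤m) = resp
    (S.solve 4 (λ π z u v → π :* z :* (u :* v) := z :* u :* (π :* v)) refl π̄ z (z ^ i) (π̄ ^ m))
    (*-closed πz∈A (mixed πz∈A i m i≤m))

  -- πz is nilpotent modulo π by the integral equation of z.
  saturated : ∀ {z} → Integral z → A (π̄ * z) → A z
  saturated (zero , c , e) πz∈A = contradiction (trans (sym (+-identityʳ 1#)) e) 1≉0
  saturated {z} (suc m , c , e) πz∈A = divide (reduced (suc m) πz∈A (t , t∈A , power))
    where
    divide : I (π̄ * z) → A z
    divide (w , w∈A , f) = resp (sym (cancel π̄≉0 f)) w∈A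
    c̄ : Fin (suc m) → Carrier
    c̄ i = P.𝕫 (c i)
    t : Carrier
    -- Of the m + 1 factors π in (πz)ᵐ⁺¹ one stays outside as the multiple of π. The other m
    -- suffice, because the equation of z replaces zᵐ⁺¹ by powers with exponent at most m.
    t = - 1# * sum (λ i → c̄ i * (z ^ toℕ i * π̄ ^ m))
    t∈A : A t
    t∈A = *-closed (OF⊆A (OF.-‿closed OF.1-closed)) (Aˢ.sum-closed _ (λ i →
      *-closed (OF⊆A (Fᵖ.𝕫 (c i) , Fᵖ.ℤₚ-integral (c i) , refl)) (mixed πz∈A (toℕ i) m (Fin.toℕ≤pred[n] i))))
    power : (π̄ * z) ^ suc m ≈ π̄ * t
    power = trans (^-distrib-* π̄ z (suc m)) (trans (*-assoc _ _ _) (*-congˡ (trans (*-comm _ _)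
      (trans (*-congʳ (inverseˡ-unique _ _ e)) (trans (sym (-‿distribˡ-* _ _)) (trans (-‿cong
        (trans (*-distribʳ-sum (π̄ ^ m) (λ i → c̄ i * z ^ toℕ i))
          (sum-cong (λ i → c̄ i * z ^ toℕ i * π̄ ^ m) (λ i → c̄ i * (z ^ toℕ i * π̄ ^ m)) (λ i → *-assoc (c̄ i) (z ^ toℕ i) (π̄ ^ m)))))
        (sym (-1*x≈-x _))))))))

-- Denominators in the maximal unramified extension

module ScaledIntegrality (C : CommutativeRing 0ℓ 0ℓ) {R : Pred (CommutativeRing.Carrier C) 0ℓ} (R-subring : Subring C R) where
  open Ring C
  open Adjunction C
  open Subring R-subring

  -- Multiplication by Pⁿ turns the polynomial into one in xP with coefficients cᵢPⁿ⁻ⁱ. As i < n,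
  -- each keeps a factor P that clears the denominator of cᵢ.
  scaled-polynomial : ∀ {P x n} (c : Fin n → Carrier) → R P → (∀ i → R (c i * P)) →
    ∃ λ (d : Fin n → Carrier) → (∀ i → R (d i)) × P ^ n * polynomial c x ≈ polynomial d (x * P)
  scaled-polynomial {n = zero} c m k = (λ ()) , (λ ()) , zeroʳ _
  scaled-polynomial {P} {x} {suc n} c m k = extend (scaled-polynomial {P} {x} (c ∘ suc) m (k ∘ suc))
    where
    extend : (∃ λ (d : Fin n → Carrier) → (∀ i → R (d i)) × P ^ n * polynomial (c ∘ suc) x ≈ polynomial d (x * P)) → _
    extend (d , d∈R , e) = d′ , d′∈R , trans (*-congˡ (polynomial-suc c x)) (trans
        (S.solve 5 (λ P Q c x g → P :* Q :* (c :+ x :* g) := Q :* (c :* P) :+ x :* P :* (Q :* g))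
          refl P (P ^ n) (c zero) x (polynomial (c ∘ suc) x))
        (trans (+-congˡ (*-congˡ e)) (sym (polynomial-suc d′ (x * P)))))
      where
      d′ : Fin (suc n) → Carrier
      d′ zero    = P ^ n * (c zero * P)
      d′ (suc i) = d i
      d′∈R : ∀ i → R (d′ i)
      d′∈R zero    = *-closed (^-closed n m) (k zero)
      d′∈R (suc i) = d∈R i

  scaled-integral : ∀ {P x n} (c : Fin n → Carrier) → R P → (∀ i → R (c i * P)) →
    x ^ n + polynomial c x ≈ 0# → IntegralOver R (x * P)
  scaled-integral {P} {x} {n} c m k e = conclude (scaled-polynomial {P} {x} c m k)
    where
    conclude : (∃ λ (d : Fin n → Carrier) → (∀ i → R (d i)) × P ^ n * polynomial c x ≈ polynomial d (x * P)) → IntegralOver R (x * P)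
    conclude (d , d∈R , f) = n , d , d∈R , trans
      (+-cong (trans (^-distrib-* x P n) (*-comm _ _)) (sym f)) (trans (sym (distribˡ _ _ _)) (trans (*-congˡ e) (zeroʳ _)))

module MaximalUnramifiedValuation
  (em : ∀ {P : Set} → Dec P) {p n : ℕ} (p-prime : Prime p)
  (F : FiniteExtensionOfℚₚ p) (F̄ : AlgebraicClosure (FiniteExtensionOfℚₚ.asField F))
  (π : ∣ FiniteExtensionOfℚₚ.asField F ∣) (π-uniformiser : UniformiserOf F π)
  (residue : ResidueOrder F π (suc n))
  (Φ : Galois.Automorphism F F̄ π) (frobenius : Galois.IsFrobenius F F̄ π (suc n) Φ) where

  open UnramifiedIntegers em F F̄ π π-uniformiser residue Φ frobenius
  open Galois F F̄ π
  open Ring C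
  open FieldProperties em F̄.asField
  open Adjunction C
  open Integrality C
  open Integers F̄.asField (_∘ʰ_ {K = F̄.asField} F̄.ι F.ι)
  open PadicArithmetic p using (p̂; dichotomy)
  private module Z = RawRing (ℤₚ-rawRing p)

  𝐩∈OF : OF P.𝐩
  𝐩∈OF = Fᵖ.𝕫 p̂ , Fᵖ.ℤₚ-integral p̂ , refl

  ℤₚ⊆OF : ∀ {x} → P.ℤₚ-image x → OF x
  ℤₚ⊆OF (z , e) = Fᵖ.𝕫 z , Fᵖ.ℤₚ-integral z , e

  F-multiple : ∀ c → ∃ λ N → OF (φ c * P.𝐩 ^ N)
  F-multiple c = convert (FiniteExtension.integral-multiple em F c)
    where
    convert : (∃ λ N → 𝓞F.Integral (c Fʳ.* Fᵖ.𝐩 Fʳ.^ N)) → ∃ λ N → OF (φ c * P.𝐩 ^ N)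
    convert (N , m) = N , c Fʳ.* Fᵖ.𝐩 Fʳ.^ N , m , sym (trans (ι.*-homo c (Fᵖ.𝐩 Fʳ.^ N)) (*-congˡ (Hom.hom-^ Fᵖ.𝐩 N)))

  integral-multiple : ∀ x → ∃ λ N → Integral (x * P.𝐩 ^ N)
  integral-multiple x = multiple (F̄.algebraic x)
    where
    multiple : (∃₂ λ m (c : Fin m → Fʳ.Carrier) → monic F̄.asField (φ ∘ c) x ≈ 0#) → ∃ λ N → Integral (x * P.𝐩 ^ N)
    multiple (m , c , e) = N , OF-trans
        (ScaledIntegrality.scaled-integral C OF-subring {P.𝐩 ^ N} {x} (φ ∘ c) (OF.^-closed N 𝐩∈OF) coefficient e)
      where
      N = proj₁ (bounded (λ i → proj₁ (F-multiple (c i))))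
      OF-trans : ∀ {y} → IntegralOver OF y → Integral y
      OF-trans (k , d , d∈OF , f) = P.Integral-trans (k , d , (λ i → OF-integral (d∈OF i)) , f)
      coefficient : ∀ i → OF (φ (c i) * P.𝐩 ^ N)
      coefficient i = OF.resp (trans (*-assoc (φ (c i)) (P.𝐩 ^ k) (P.𝐩 ^ (N ℕ.∸ k)))
          (*-congˡ (trans (sym (^-homo-* P.𝐩 k (N ℕ.∸ k)))
            (reflexive (≡.cong (P.𝐩 ^_) (ℕ.m+[n∸m]≡n (proj₂ (bounded (λ i → proj₁ (F-multiple (c i)))) i)))))))
          (OF.*-closed (proj₂ (F-multiple (c i))) (OF.^-closed (N ℕ.∸ k) 𝐩∈OF))
        where k = proj₁ (F-multiple (c i))

  -- A factor prime to π, witnessed by an inverse modulo π, which is the form in which maximality of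
  -- (π) delivers it.
  record UnitModulo (M : Carrier) : Set where
    constructor unitModulo
    field
      {inv rest} : Carrier
      mem        : OF M
      inv-mem    : OF inv
      rest-mem   : OF rest
      equation   : M * inv ≈ 1# + π̄ * rest

  unit-* : ∀ {M N} → UnitModulo M → UnitModulo N → UnitModulo (M * N)
  unit-* {M} {N} (unitModulo {M′} {X} a b c e) (unitModulo {N′} {Y} a′ b′ c′ e′) = unitModulo
    (OF.*-closed a a′) (OF.*-closed b b′) (OF.+-closed (OF.+-closed c c′) (OF.*-closed π̄∈OF (OF.*-closed c c′)))
    (trans (S.solve 4 (λ M N M′ N′ → M :* N :* (M′ :* N′) := M :* M′ :* (N :* N′)) refl M N M′ N′)
      (trans (*-cong e e′) (trans (S.solve 4 (λ o π X Y → (o :+ π :* X) :* (o :+ π :* Y) :=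
          o :* o :+ (o :* (π :* X) :+ o :* (π :* Y) :+ π :* (π :* (X :* Y)))) refl 1# π̄ X Y)
        (+-cong (*-identityˡ 1#) (trans (+-congʳ (+-cong (*-identityˡ _) (*-identityˡ _)))
          (S.solve 3 (λ π X Y → π :* X :+ π :* Y :+ π :* (π :* (X :* Y)) := π :* (X :+ Y :+ π :* (X :* Y))) refl π̄ X Y))))))

  unit-1 : UnitModulo 1#
  unit-1 = unitModulo OF.1-closed OF.1-closed OF.0-closed
    (trans (*-identityˡ 1#) (sym (trans (+-congˡ (zeroʳ π̄)) (+-identityʳ 1#))))

  unit-^ : ∀ {M} k → UnitModulo M → UnitModulo (M ^ k)
  unit-^ zero    u = unit-1
  unit-^ (suc k) u = unit-* u (unit-^ k u)

  -- The admissible denominators: a power of π, which saturation strips off later, times a factor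
  -- prime to π, which stays.
  record Denominator (D : Carrier) : Set where
    constructor denominator
    field
      order : ℕ
      {M}   : Carrier
      unit  : UnitModulo M
      equal : D ≈ π̄ ^ order * M

  denominator-* : ∀ {D E} → Denominator D → Denominator E → Denominator (D * E)
  denominator-* (denominator k {M} u e) (denominator l {N} v f) = denominator (k ℕ.+ l) (unit-* u v)
    (trans (*-cong e f) (trans (S.solve 4 (λ a M b N → a :* M :* (b :* N) := a :* b :* (M :* N)) refl (π̄ ^ k) M (π̄ ^ l) N)
      (*-congʳ (sym (^-homo-* π̄ k l)))))

  denominator-1 : Denominator 1#
  denominator-1 = denominator 0 unit-1 (sym (*-identityˡ 1#))

  denominator-^ : ∀ {D} k → Denominator D → Denominator (D ^ k)
  denominator-^ zero    d = denominator-1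
  denominator-^ (suc k) d = denominator-* d (denominator-^ k d)

  denominator-OF : ∀ {D} → Denominator D → OF D
  denominator-OF (denominator k u e) = OF.resp (sym e) (OF.*-closed (OF.^-closed k π̄∈OF) (UnitModulo.mem u))

  -- The coefficients of a polynomial over ℤₚ are units or divisible by p;
  -- the lowest unit coefficient gives the term of least order at π modulo p.
  module _ (𝐩∈I : Iᶠ.I P.𝐩) where
    open OfSubring P.ℤₚ-subring

    Split : Carrier → Set
    Split v = ∃₂ λ k M → ∃ λ Y → UnitModulo M × OF Y × v ≈ π̄ ^ k * M + P.𝐩 * Y

    split-OF : ∀ {v} → Split v → OF v
    split-OF (k , M , Y , u , m , e) = OF.resp (sym e)
      (OF.+-closed (OF.*-closed (OF.^-closed k π̄∈OF) (UnitModulo.mem u)) (OF.*-closed 𝐩∈OF m))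

    split : ∀ {d c v} → Poly π̄ d c v → c ≈ 1# → Split v
    split (const _ e) f = 0 , 1# , 0# , unit-1 , OF.0-closed ,
      trans e (trans f (sym (trans (+-cong (*-identityˡ 1#) (zeroʳ _)) (+-identityʳ 1#))))
    split {suc d} {c} {u} (horner {v = v} {r = r} P (z , r≈z) e) f = step (dichotomy p-prime z) (split P f)
      where
      step : (∃ λ z′ → z Z.≈ p̂ Z.* z′) ⊎ (∃₂ λ w z′ → z Z.* w Z.+ Z.- Z.1# Z.≈ p̂ Z.* z′) → Split v → Split u
      step (inj₁ (z′ , g)) (k , M , Y , unit , m , h) = suc k , M , π̄ * Y + P.𝕫 z′ , unit ,
        OF.+-closed (OF.*-closed π̄∈OF m) (ℤₚ⊆OF (z′ , refl)) ,
        trans e (trans (+-cong (*-congˡ h) (trans r≈z (trans (P.𝕫-cong g) (P.𝕫-* p̂ z′))))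
          (S.solve 6 (λ π a M p Y z → π :* (a :* M :+ p :* Y) :+ p :* z := π :* a :* M :+ p :* (π :* Y :+ z))
            refl π̄ (π̄ ^ k) M P.𝐩 Y (P.𝕫 z′)))
      step (inj₂ (w , z′ , g)) s = 0 , u , 0# , unit 𝐩∈I , OF.0-closed ,
        sym (trans (+-cong (*-identityˡ u) (zeroʳ _)) (+-identityʳ u))
        where
        r-unit : r * P.𝕫 w + - 1# ≈ P.𝐩 * P.𝕫 z′
        r-unit = trans (+-cong (trans (*-congʳ r≈z) (sym (P.𝕫-* z w))) (trans (-‿cong (sym P.𝕫-1)) (sym (P.𝕫-neg Z.1#))))
          (trans (sym (P.𝕫-+ (z Z.* w) (Z.- Z.1#))) (trans (P.𝕫-cong g) (P.𝕫-* p̂ z′)))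
        unit : Iᶠ.I P.𝐩 → UnitModulo u
        unit (X , X∈ , h) = unitModulo
          (OF.resp (sym e) (OF.+-closed (OF.*-closed π̄∈OF (split-OF s)) (ℤₚ⊆OF (z , r≈z))))
          (ℤₚ⊆OF (w , refl))
          (OF.+-closed (OF.*-closed (split-OF s) (ℤₚ⊆OF (w , refl))) (OF.*-closed X∈ (ℤₚ⊆OF (z′ , refl))))
          (trans (*-congʳ e) (trans (S.solve 5 (λ π v r w o → (π :* v :+ r) :* w := o :+ (π :* (v :* w) :+ (r :* w :+ (:- o))))
              refl π̄ v r (P.𝕫 w) 1#)
            (+-congˡ (trans (+-congˡ (trans r-unit (*-congʳ h)))
              (S.solve 4 (λ π a X z → π :* a :+ π :* X :* z := π :* (a :+ X :* z)) refl π̄ (v * P.𝕫 w) X (P.𝕫 z′))))))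

  -- Elements become integral through powers of p, whereas `saturated` removes powers of π. If π
  -- divides p, an integral equation of π over ℤₚ reads πᵏM + pY = 0, which makes πᵏM a multiple of
  -- p; otherwise p itself is prime to π.
  𝐩-denominator : ∃₂ λ D Y → Denominator D × OF Y × D ≈ P.𝐩 * Y
  𝐩-denominator = cases em
    where
    open OfSubring P.ℤₚ-subring
    unit : (∃ λ y → OF y × Iᶠ.I (1# - P.𝐩 * y)) → UnitModulo P.𝐩
    unit (y , y∈ , (z , z∈ , e)) = unitModulo 𝐩∈OF y∈ (OF.-‿closed z∈)
      (trans (S.solve 2 (λ o a → a := o :+ (:- (o :- a))) refl 1# (P.𝐩 * y))
        (+-congˡ (trans (-‿cong e) (-‿distribʳ-* π̄ z))))
    fromSplit : ∀ {v} → v ≈ 0# → (∃₂ λ k M → ∃ λ Y → UnitModulo M × OF Y × v ≈ π̄ ^ k * M + P.𝐩 * Y) →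
      ∃₂ λ D Y → Denominator D × OF Y × D ≈ P.𝐩 * Y
    fromSplit v≈0 (k , M , Y , u , m , e) = π̄ ^ k * M , - Y , denominator k u refl , OF.-‿closed m ,
      trans (inverseˡ-unique _ _ (trans (sym e) v≈0)) (-‿distribʳ-* P.𝐩 Y)
    relation : ∃ λ d → Poly π̄ d 1# 0#
    relation = integral⇒poly (P.fromIntegral (OF-integral π̄∈OF))
    cases : Dec (Iᶠ.I P.𝐩) → ∃₂ λ D Y → Denominator D × OF Y × D ≈ P.𝐩 * Y
    cases (yes 𝐩∈I) = fromSplit refl (split 𝐩∈I (proj₂ relation) refl)
    cases (no 𝐩∉I) = P.𝐩 , 1# , denominator 0 (unit (unit-modulo 𝐩∈OF 𝐩∉I)) (sym (*-identityˡ _)) , OF.1-closed , sym (*-identityʳ _)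

  Fraction : Pred Carrier 0ℓ
  Fraction x = ∃ λ D → Denominator D × A (D * x)

  fraction : ∀ {x N} → A (x * P.𝐩 ^ N) → Fraction x
  fraction {x} {N} m = clear 𝐩-denominator
    where
    clear : (∃₂ λ D Y → Denominator D × OF Y × D ≈ P.𝐩 * Y) → Fraction x
    clear (D , Y , d , Y∈ , e) = D ^ N , denominator-^ N d , resp
      (trans (S.solve 3 (λ Y x p → Y :* (x :* p) := p :* Y :* x) refl (Y ^ N) x (P.𝐩 ^ N))
        (*-congʳ (sym (trans (^-congˡ N e) (^-distrib-* P.𝐩 Y N)))))
      (*-closed (Aˢ.^-closed N (OF⊆A Y∈)) m)

  Fraction-subring : Subring C Fraction
  Fraction-subring = record
    { resp     = λ { e (D , d , m) → D , d , resp (*-congˡ e) m }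
    ; +-closed = λ { {x} {y} (D , d , m) (E , e , k) → D * E , denominator-* d e , resp
        (S.solve 4 (λ D E x y → E :* (D :* x) :+ D :* (E :* y) := D :* E :* (x :+ y)) refl D E x y)
        (+-closed (*-closed (OF⊆A (denominator-OF e)) m) (*-closed (OF⊆A (denominator-OF d)) k)) }
    ; *-closed = λ { {x} {y} (D , d , m) (E , e , k) → D * E , denominator-* d e , resp
        (S.solve 4 (λ D E x y → D :* x :* (E :* y) := D :* E :* (x :* y)) refl D E x y) (*-closed m k) }
    ; -‿closed = λ { (D , d , m) → D , d , resp (-‿distribʳ-* _ _) (Aˢ.-‿closed m) }
    ; 1-closed = 1# , denominator-1 , *-closed Aˢ.1-closed Aˢ.1-closed
    }

  F⊆Fraction : ∀ c → Fraction (φ c)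
  F⊆Fraction c = fraction {N = proj₁ (F-multiple c)} (OF⊆A (proj₂ (F-multiple c)))

  -- An element of a single extension enters through an integral multiple by pᴺ. Inverses are not
  -- evident in a localisation of A; they come from `subring-inverse`, since F̄ is algebraic over F.
  Fⁿʳ⊆Fraction : ∀ {x} → Fⁿʳ x → Fraction x
  Fⁿʳ⊆Fraction (incl {x = x} L u m) = integers (integral-multiple x)
    where
    span-scale : ∀ N → x ∈ ⌊ L ⌋ → x * P.𝐩 ^ N ∈ ⌊ L ⌋
    span-scale N (c , e) = (λ i → Fᵖ.𝐩 Fʳ.^ N Fʳ.* c i) , trans (*-comm _ _) (trans (*-congˡ e) (trans
        (*-distribˡ-sum (P.𝐩 ^ N) (λ i → φ (c i) * b i))
        (sum-cong (λ i → P.𝐩 ^ N * (φ (c i) * b i)) (λ i → φ (Fᵖ.𝐩 Fʳ.^ N Fʳ.* c i) * b i)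
          (λ i → trans (sym (*-assoc _ _ _)) (*-congʳ (sym (trans (ι.*-homo _ _) (*-congʳ (Hom.hom-^ Fᵖ.𝐩 N)))))))))
      where b = FiniteSubextension.basis L
    integers : (∃ λ N → Integral (x * P.𝐩 ^ N)) → Fraction x
    integers (N , k) = fraction {N = N} (conjugate L u (span-scale N m , k) 0)
  Fⁿʳ⊆Fraction (resp e m)     = Subring.resp Fraction-subring e (Fⁿʳ⊆Fraction m)
  Fⁿʳ⊆Fraction (+-clos m k)   = Subring.+-closed Fraction-subring (Fⁿʳ⊆Fraction m) (Fⁿʳ⊆Fraction k)
  Fⁿʳ⊆Fraction (*-clos m k)   = Subring.*-closed Fraction-subring (Fⁿʳ⊆Fraction m) (Fⁿʳ⊆Fraction k)
  Fⁿʳ⊆Fraction (-‿clos m)     = Subring.-‿closed Fraction-subring (Fⁿʳ⊆Fraction m)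
  Fⁿʳ⊆Fraction (⁻¹-clos m e)  = AlgebraicOver.subring-inverse em F.asField F̄ Fraction-subring F⊆Fraction (Fⁿʳ⊆Fraction m) e

  strip : ∀ k {x} → Integral x → A (π̄ ^ k * x) → A x
  strip zero    m k = resp (*-identityˡ _) k
  strip (suc j) m k = strip j m (saturated (Int.*-closed (Int.^-closed j (OF-integral π̄∈OF)) m) (resp (*-assoc _ _ _) k))

  -- For a suitable M prime to π, the element y = Mϖ lies in A, and yᵉ = πMᵉv lies in πA, so y = πz
  -- by reducedness. Then π divides Mᵉv, although M is invertible modulo π and v is a unit with
  -- inverse w.
  no-root : ∀ {ϖ v w} e → 1 ℕ.< e → Integral ϖ → Integral v → Integral w →
    ϖ ^ e ≈ π̄ * v → π̄ ≈ ϖ ^ e * w → ¬ Fⁿʳ ϖ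
  no-root {ϖ} {v} {w} (suc (suc e)) (ℕ.s≤s (ℕ.s≤s _)) ϖ-int v-int w-int ϖᵉ≈πv π≈ϖᵉw m = from-fraction (Fⁿʳ⊆Fraction m)
    where
    vw≈1 : v * w ≈ 1#
    vw≈1 = cancel π̄≉0 (trans (sym (*-assoc _ _ _)) (trans (*-congʳ (sym ϖᵉ≈πv)) (trans (sym π≈ϖᵉw) (sym (*-identityʳ _)))))

    contradictory : ∀ {M} → UnitModulo M → I (M * ϖ) → ⊥
    contradictory {M} u (z , z∈A , f) = unit (unit-^ (suc (suc e)) u)
      where
      y = M * ϖ
      -- Of the e + 2 factors π on the right one cancels against ϖᵉ⁺² = πv, and another remains in
      -- front: here the ramification index must exceed 1.
      Mᵉv : M ^ suc (suc e) * v ≈ π̄ * (π̄ ^ e * z ^ suc (suc e))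
      Mᵉv = cancel π̄≉0 (trans (S.solve 3 (λ π M v → π :* (M :* v) := M :* (π :* v)) refl π̄ (M ^ suc (suc e)) v)
        (trans (*-congˡ (sym ϖᵉ≈πv)) (trans (sym (^-distrib-* M ϖ (suc (suc e)))) (trans (^-congˡ (suc (suc e)) f)
        (trans (^-distrib-* π̄ z (suc (suc e))) (S.solve 3 (λ π a z → π :* (π :* a) :* z := π :* (π :* (a :* z))) refl π̄ (π̄ ^ e) (z ^ suc (suc e))))))))
      unit : UnitModulo (M ^ suc (suc e)) → ⊥
      unit (unitModulo {inv} {rest} _ i r g) = π̄-proper
        {π̄ ^ e * z ^ suc (suc e) * (w * inv) - rest}
        (Int.−-closed (Int.*-closed (Int.*-closed (Int.^-closed e (OF-integral π̄∈OF)) (Int.^-closed (suc (suc e)) (A-integral z∈A)))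
          (Int.*-closed w-int (OF-integral i))) (OF-integral r))
        (trans (S.solve 4 (λ π a b r → π :* (a :* b :- r) := π :* a :* b :- π :* r) refl π̄ (π̄ ^ e * z ^ suc (suc e)) (w * inv) rest)
          (trans (+-congʳ (trans (*-congʳ (sym Mᵉv)) (trans
             (S.solve 4 (λ M v w i → M :* v :* (w :* i) := v :* w :* (M :* i)) refl (M ^ suc (suc e)) v w inv)
             (trans (*-cong vw≈1 g) (*-identityˡ _)))))
            (S.solve 2 (λ o a → o :+ a :- a := o) refl 1# (π̄ * rest))))

    from-fraction : Fraction ϖ → ⊥
    from-fraction (D , denominator k {M} u d≈ , Dϖ∈A) = contradictory u (reduced (suc (suc e)) y∈A
        -- The cofactor is integral, and π times it is a power of `M * ϖ`, hence in A; saturation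
        -- puts the cofactor itself in A.
        (M ^ suc (suc e) * v , saturated (Int.*-closed (Int.^-closed (suc (suc e)) M-int) v-int) (resp yᵉ (Aˢ.^-closed (suc (suc e)) y∈A)) , yᵉ))
      where
      M-int : Integral M
      M-int = OF-integral (UnitModulo.mem u)
      y∈A : A (M * ϖ)
      y∈A = strip k (Int.*-closed M-int ϖ-int) (resp (trans (*-congʳ d≈) (*-assoc _ _ _)) Dϖ∈A)
      yᵉ : (M * ϖ) ^ suc (suc e) ≈ π̄ * (M ^ suc (suc e) * v)
      yᵉ = trans (^-distrib-* M ϖ (suc (suc e))) (trans (*-congˡ ϖᵉ≈πv)
        (S.solve 3 (λ π M v → M :* (π :* v) := π :* (M :* v)) refl π̄ (M ^ suc (suc e)) v))

  ramified⇒∉Fⁿʳ : ∀ {m} (E : FiniteSubextension m) → Ramified E → ∃ λ ϖ → ϖ ∈ ⌊ E ⌋ × ¬ Fⁿʳ ϖ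
  ramified⇒∉Fⁿʳ E (e , 1<e , ϖ , unif , (v , (_ , v-int) , f) , (w , (_ , w-int) , g)) =
    ϖ , proj₁ (IsUniformiser.mem unif) , no-root e 1<e (proj₂ (IsUniformiser.mem unif)) v-int w-int f g

-- Extension of automorphisms

least : (∀ {P : Set} → Dec P) → (P : ℕ → Set) → ∃ P → ∃ λ n → P n × (∀ k → k ℕ.< n → ¬ P k)
least em P (n , Pn) = search n 0 (≡.subst P (≡.sym (ℕ.+-identityʳ n)) Pn) (λ _ ())
  where
  search : ∀ d m → P (d ℕ.+ m) → (∀ k → k ℕ.< m → ¬ P k) → ∃ λ n → P n × (∀ k → k ℕ.< n → ¬ P k)
  search zero    m Pm below = m , Pm , below
  search (suc d) m Pm below with em {P m}
  ... | yes p = m , p , below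
  ... | no ¬p = search d (suc m) (≡.subst P (≡.sym (ℕ.+-suc d m)) Pm) (λ k k<1+m Pk → extend k (ℕ.m≤n⇒m<n∨m≡n (ℕ.≤-pred k<1+m)) Pk)
    where
    extend : ∀ k → k ℕ.< m ⊎ k ≡ m → ¬ P k
    extend k (inj₁ k<m)   = below k k<m
    extend k (inj₂ ≡.refl) = ¬p

module PairRing (C : CommutativeRing 0ℓ 0ℓ) where
  private
    module R = Ring C
    module A = Adjunction C

  -- Partial automorphisms are subrings of this product. Adjoining a root together with its
  -- conjugate is then the adjunction of one element, and `Low` applies as it stands.
  C² : CommutativeRing 0ℓ 0ℓ
  C² = DirectProduct.commutativeRing C C

  open Ring C²
  open Adjunction C²

  ^-proj₁ : ∀ (w : Carrier) n → proj₁ (w ^ n) ≡ proj₁ w R.^ n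
  ^-proj₁ w zero    = ≡.refl
  ^-proj₁ w (suc n) = ≡.cong (proj₁ w R.*_) (^-proj₁ w n)

  ^-proj₂ : ∀ (w : Carrier) n → proj₂ (w ^ n) ≡ proj₂ w R.^ n
  ^-proj₂ w zero    = ≡.refl
  ^-proj₂ w (suc n) = ≡.cong (proj₂ w R.*_) (^-proj₂ w n)

  sum-proj₁ : ∀ {n} (f : Fin n → Carrier) → proj₁ (sum f) ≡ R.sum (proj₁ ∘ f)
  sum-proj₁ {zero}  f = ≡.refl
  sum-proj₁ {suc n} f = ≡.cong (proj₁ (f zero) R.+_) (sum-proj₁ (f ∘ suc))

  sum-proj₂ : ∀ {n} (f : Fin n → Carrier) → proj₂ (sum f) ≡ R.sum (proj₂ ∘ f)
  sum-proj₂ {zero}  f = ≡.refl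
  sum-proj₂ {suc n} f = ≡.cong (proj₂ (f zero) R.+_) (sum-proj₂ (f ∘ suc))

  polynomial-proj₁ : ∀ {n} (c : Fin n → Carrier) w → proj₁ (polynomial c w) R.≈ A.polynomial (proj₁ ∘ c) (proj₁ w)
  polynomial-proj₁ c w = R.trans (R.reflexive (sum-proj₁ (λ i → c i * w ^ toℕ i)))
    (R.sum-cong (λ i → proj₁ (c i * w ^ toℕ i)) (λ i → proj₁ (c i) R.* proj₁ w R.^ toℕ i)
      (λ i → R.*-congˡ (R.reflexive (^-proj₁ w (toℕ i)))))

  polynomial-proj₂ : ∀ {n} (c : Fin n → Carrier) w → proj₂ (polynomial c w) R.≈ A.polynomial (proj₂ ∘ c) (proj₂ w)
  polynomial-proj₂ c w = R.trans (R.reflexive (sum-proj₂ (λ i → c i * w ^ toℕ i)))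
    (R.sum-cong (λ i → proj₂ (c i * w ^ toℕ i)) (λ i → proj₂ (c i) R.* proj₂ w R.^ toℕ i)
      (λ i → R.*-congˡ (R.reflexive (^-proj₂ w (toℕ i)))))

module PartialAutomorphisms (em : ∀ {P : Set} → Dec P) (F : Field) (F̄ : AlgebraicClosure F) where
  private module F̄ = AlgebraicClosure F̄
  module φ = RingHomomorphism F̄.ι
  C = FieldOps.commutativeRing F̄.asField
  open Ring C public
  open FieldProperties em F̄.asField public
  open Adjunction C
  open PairRing C public
  module Pairs = Adjunction C²

  Relation : Set₁
  Relation = Pred (Carrier × Carrier) 0ℓ

  -- A subring of F̄ × F̄ which is the graph of a map, necessarily of an
  -- F-embedding of a subfield.
  record IsGraph (R : Relation) : Set where
    field
      subring  : Subring C² R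
      base     : ∀ c → R (φ.⟦ c ⟧ , φ.⟦ c ⟧)
      function : ∀ {x y} → R (x , y) → x ≈ 0# → y ≈ 0#
    open Subring subring public

    Domain : Pred Carrier 0ℓ
    Domain x = ∃ λ y → R (x , y)

    domain-subring : Subring C Domain
    domain-subring = record
      { resp     = λ { e (y , m) → y , resp (e , refl) m }
      ; +-closed = λ { (y , m) (z , k) → y + z , +-closed m k }
      ; *-closed = λ { (y , m) (z , k) → y * z , *-closed m k }
      ; -‿closed = λ { (y , m) → - y , -‿closed m }
      ; 1-closed = 1# , 1-closed
      }

    domain-inverse : ∀ {x w} → Domain x → x * w ≈ 1# → Domain w
    domain-inverse = AlgebraicOver.subring-inverse em F F̄ domain-subring (λ c → φ.⟦ c ⟧ , base c)

    -- A nonzero x has an inverse in the domain, and multiplying the two pairs would send 1 to 0.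
    injective : ∀ {x y} → R (x , y) → y ≈ 0# → x ≈ 0#
    injective {x} {y} m y≈0 = cases (zero-or-unit x)
      where
      cases : (x ≈ 0# ⊎ ∃ λ w → x * w ≈ 1#) → x ≈ 0#
      cases (inj₁ e) = e
      cases (inj₂ (w , e)) = absurd (domain-inverse (y , m) e)
        where
        absurd : Domain w → x ≈ 0#
        absurd (v , k) = contradiction (trans (sym (-‿involutive 1#)) (trans (-‿cong (trans (sym (+-identityˡ _))
            (trans (+-congʳ (sym (trans (*-congʳ y≈0) (zeroˡ v)))) (function (−-closed (*-closed m k) 1-closed)
              (trans (+-congʳ e) (-‿inverseʳ 1#)))))) -0#≈0#)) 1≉0

    unique : ∀ {x y x′ y′} → R (x , y) → R (x′ , y′) → x ≈ x′ → y ≈ y′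
    unique {x} {y} {x′} {y′} m k e = x∙y⁻¹≈ε⇒x≈y y y′ (function (−-closed m k) (trans (+-congʳ e) (-‿inverseʳ _)))

  converse : Relation → Relation
  converse R (x , y) = R (y , x)

  converse-graph : ∀ {R} → IsGraph R → IsGraph (converse R)
  converse-graph g = record
    { subring = record
      { resp     = λ { (e , f) → G.resp (f , e) }
      ; +-closed = λ m k → G.+-closed m k
      ; *-closed = λ m k → G.*-closed m k
      ; -‿closed = λ m → G.-‿closed m
      ; 1-closed = G.1-closed
      }
    ; base = G.base
    ; function = λ m → G.injective m
    }
    where module G = IsGraph g

  module _ {R : Relation} (g : IsGraph R) where
    private module G = IsGraph g

    Independent : Carrier → ℕ → Set
    Independent z n = ∀ (d : Fin n → Carrier × Carrier) → (∀ i → R (d i)) →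
      polynomial (proj₁ ∘ d) z ≈ 0# → ∀ i → proj₁ (d i) ≈ 0#

    module _ {m : ℕ} (c : Fin (suc m) → Carrier × Carrier) (c∈R : ∀ i → R (c i)) {z z′ : Carrier}
             (root  : z ^ suc m + polynomial (proj₁ ∘ c) z ≈ 0#)
             (root′ : z′ ^ suc m + polynomial (proj₂ ∘ c) z′ ≈ 0#)
             (independent : Independent z (suc m)) where
      private
        module C² = Ring C²
        w = z , z′

        relation : w C².^ suc m C².+ Pairs.polynomial c w C².≈ C².0#
        relation = trans (+-cong (reflexive (^-proj₁ w (suc m))) (polynomial-proj₁ c w)) root ,
                   trans (+-cong (reflexive (^-proj₂ w (suc m))) (polynomial-proj₂ c w)) root′

        reduction : Pairs.Low R w (suc m) (w C².^ suc m)
        reduction = Integrality.reduction C² G.subring c c∈R relation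

      module Low = Pairs.OfSubring G.subring

      adjoined : Relation
      adjoined = Pairs.Low R w (suc m)

      adjoined-graph : IsGraph adjoined
      adjoined-graph = record
        { subring  = Low.low-subring w reduction
        ; base     = λ a → Low.low-constant w (G.base a)
        -- Independence makes the coefficients of a representation of 0 vanish, hence also their
        -- images, and with them the value at z′.
        ; function = λ { (d , d∈R , e , f) x≈0 → trans f (trans (polynomial-proj₂ d w)
            (sum-0 (λ i → proj₂ (d i) * z′ ^ toℕ i) (λ i → trans (*-congʳ (G.function (d∈R i)
              (independent d d∈R (trans (sym (polynomial-proj₁ d w)) (trans (sym e) x≈0)) i))) (zeroˡ _)))) }
        }

      R⊆adjoined : ∀ {x} → R x → adjoined x
      R⊆adjoined = Low.low-constant w

      w∈adjoined : adjoined w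
      w∈adjoined = Low.x∈low w reduction

    MonicRelation : Carrier → ℕ → Set
    MonicRelation z n = ∃ λ (c : Fin n → Carrier × Carrier) → (∀ i → R (c i)) × z ^ n + polynomial (proj₁ ∘ c) z ≈ 0#

    -- A nonzero leading coefficient is invertible in the domain, and division by it gives a monic
    -- relation of smaller degree. So it vanishes, and the argument repeats for the shorter
    -- polynomial.
    minimal⇒independent : ∀ z n → (∀ k → k ℕ.< n → ¬ MonicRelation z k) → Independent z n
    minimal⇒independent z zero minimal d d∈R e ()
    minimal⇒independent z (suc n) minimal d d∈R e i = each (view i)
      where
      t = d (fromℕ n)
      last-zero : proj₁ t ≈ 0#
      last-zero = cases (zero-or-unit (proj₁ t))
        where
        cases : (proj₁ t ≈ 0# ⊎ ∃ λ s → proj₁ t * s ≈ 1#) → proj₁ t ≈ 0#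
        cases (inj₁ f) = f
        cases (inj₂ (s , f)) = absurd (G.domain-inverse (proj₂ t , d∈R (fromℕ n)) f)
          where
          absurd : G.Domain s → proj₁ t ≈ 0#
          absurd (s′ , k) = contradiction ((λ i → s * proj₁ (d (inject₁ i)) , s′ * proj₂ (d (inject₁ i))) ,
            (λ i → G.*-closed k (d∈R (inject₁ i))) , trans
              (+-cong (trans (sym (*-identityˡ _)) (trans (*-congʳ (trans (sym f) (*-comm _ _))) (*-assoc s (proj₁ t) (z ^ n))))
                (trans (sum-cong (λ i → s * proj₁ (d (inject₁ i)) * z ^ toℕ i) (λ i → s * (proj₁ (d (inject₁ i)) * z ^ toℕ i)) (λ i → *-assoc _ _ _))
                  (sym (*-distribˡ-sum s (λ i → proj₁ (d (inject₁ i)) * z ^ toℕ i)))))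
              (trans (sym (distribˡ _ _ _)) (trans (*-congˡ (trans (+-comm _ _) (trans (sym (polynomial-last (proj₁ ∘ d) z)) e))) (zeroʳ s))))
            (minimal n (ℕ.n<1+n n))
      rest : polynomial (proj₁ ∘ d ∘ inject₁) z ≈ 0#
      rest = trans (sym (+-identityʳ _)) (trans (+-congˡ (sym (trans (*-congʳ last-zero) (zeroˡ _)))) (trans (sym (polynomial-last (proj₁ ∘ d) z)) e))
      each : ∀ {i} → View i → proj₁ (d i) ≈ 0#
      each ‵fromℕ      = last-zero
      each (‵inject₁ j) = minimal⇒independent z n (λ k k<n → minimal k (ℕ.m<n⇒m<1+n k<n)) (d ∘ inject₁) (d∈R ∘ inject₁) rest j

    -- z′ is a root of the image under R of the minimal relation of z; it exists because F̄ is
    -- algebraically closed.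
    extend : ∀ z → ∃ λ S → IsGraph S × (∀ {x} → R x → S x) × ∃ λ z′ → S (z , z′)
    extend z = fromLeast (least em (MonicRelation z) (algebraic (F̄.algebraic z)))
      where
      algebraic : (∃₂ λ n (c : Fin n → ∣ F ∣) → monic F̄.asField (φ.⟦_⟧ ∘ c) z ≈ 0#) → ∃ (MonicRelation z)
      algebraic (n , c , e) = n , (λ i → φ.⟦ c i ⟧ , φ.⟦ c i ⟧) , (λ i → G.base (c i)) , e
      fromLeast : (∃ λ n → MonicRelation z n × (∀ k → k ℕ.< n → ¬ MonicRelation z k)) →
        ∃ λ S → IsGraph S × (∀ {x} → R x → S x) × ∃ λ z′ → S (z , z′)
      fromLeast (zero , (c , c∈R , e) , _) = contradiction (trans (sym (+-identityʳ 1#)) e) 1≉0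
      fromLeast (suc m , (c , c∈R , e) , minimal) = withRoot (F̄.closed (proj₂ ∘ c))
        where
        withRoot : (∃ λ x → monic F̄.asField (proj₂ ∘ c) x ≈ 0#) → _
        withRoot (z′ , e′) = adjoined c c∈R e e′ ind , adjoined-graph c c∈R e e′ ind , (λ {x} → R⊆adjoined c c∈R e e′ ind {x}) ,
            z′ , w∈adjoined c c∈R e e′ ind
          where ind = minimal⇒independent z (suc m) minimal

-- A maximal partial automorphism

module MaximalPartialAutomorphisms (em₁ : ExcludedMiddle (Level.suc 0ℓ)) (zorn : ZornsLemma)
  (em : ∀ {P : Set} → Dec P) (F : Field) (F̄ : AlgebraicClosure F) where
  open PartialAutomorphisms em F F̄ public

  module _ {R₀ : Relation} (R₀-graph : IsGraph R₀) where

    Graph : Set₁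
    Graph = ∃ λ R → IsGraph R × (∀ {x} → R₀ x → R x)

    _≲_ : Rel Graph (Level.suc 0ℓ)
    R ≲ S = Lift (Level.suc 0ℓ) (∀ {x} → proj₁ R x → proj₁ S x)

    ≲-isPreorder : IsPreorder _≡_ _≲_
    ≲-isPreorder = record
      { isEquivalence = ≡ₚ.isEquivalence
      ; reflexive = λ { ≡.refl → lift id }
      ; trans = λ { (lift f) (lift g) → lift (λ m → g (f m)) }
      }

    -- Excluded middle replaces a large proposition by a small one.
    Small : Set₁ → Set
    Small P = shrink (em₁ {P})
      where
      shrink : Dec P → Set
      shrink (yes _) = ⊤
      shrink (no _)  = ⊥

    small : ∀ {P} → P → Small P
    small {P} p with em₁ {P}
    ... | yes _ = tt
    ... | no ¬p = ¬p p

    large : ∀ {P} → Small P → P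
    large {P} s with em₁ {P}
    ... | yes p = p

    module _ (𝒞 : Pred Graph (Level.suc 0ℓ)) (chain : ∀ {R S} → 𝒞 R → 𝒞 S → R ≲ S ⊎ S ≲ R) where

      Union : Carrier × Carrier → Set₁
      Union x = ∃ λ R → 𝒞 R × proj₁ R x

      union : Relation
      union x = Small (Union x)

      together : ∀ {x y} → Union x → Union y → ∃ λ R → 𝒞 R × proj₁ R x × proj₁ R y
      together (R , R∈ , m) (S , S∈ , k) = pick (chain R∈ S∈)
        where
        pick : R ≲ S ⊎ S ≲ R → _
        pick (inj₁ (lift f)) = S , S∈ , f m , k
        pick (inj₂ (lift f)) = R , R∈ , m , f k

      module _ {R : Graph} (R∈ : 𝒞 R) where

        union-graph : IsGraph union
        union-graph = record
          { subring = record
            { resp     = λ e m → small (resp e (large m))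
            ; +-closed = λ m k → small (binary (λ G → IsGraph.+-closed G) (together (large m) (large k)))
            ; *-closed = λ m k → small (binary (λ G → IsGraph.*-closed G) (together (large m) (large k)))
            ; -‿closed = λ m → small (negate (large m))
            ; 1-closed = small (R , R∈ , IsGraph.1-closed (proj₁ (proj₂ R)))
            }
          ; base = λ a → small (R , R∈ , IsGraph.base (proj₁ (proj₂ R)) a)
          ; function = λ m → function (large m)
          }
          where
          module C² = Ring C²
          resp : ∀ {x y} → x C².≈ y → Union x → Union y
          resp e (S , S∈ , m) = S , S∈ , IsGraph.resp (proj₁ (proj₂ S)) e m
          binary : ∀ {x y z} → (∀ {S} → IsGraph S → S x → S y → S z) →
            (∃ λ S → 𝒞 S × proj₁ S x × proj₁ S y) → Union z
          binary f (S , S∈ , m , k) = S , S∈ , f (proj₁ (proj₂ S)) m k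
          negate : ∀ {x} → Union x → Union (C².- x)
          negate (S , S∈ , m) = S , S∈ , IsGraph.-‿closed (proj₁ (proj₂ S)) m
          function : ∀ {x y} → Union (x , y) → x ≈ 0# → y ≈ 0#
          function (S , S∈ , m) = IsGraph.function (proj₁ (proj₂ S)) m

      bound : ∃ λ u → ∀ {R} → 𝒞 R → R ≲ u
      bound = cases em₁
        where
        cases : Dec (∃ 𝒞) → ∃ λ u → ∀ {R} → 𝒞 R → R ≲ u
        cases (yes (R , R∈)) = (union , union-graph R∈ , λ m → small (R , R∈ , proj₂ (proj₂ R) m)) ,
          λ {S} S∈ → lift (λ m → small (S , S∈ , m))
        -- The union over an empty chain would contain nothing, so `R₀` serves as its bound.
        cases (no empty) = (R₀ , R₀-graph , id) , λ {S} S∈ → contradiction (S , S∈) empty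

    private
      maximal : ∃ λ M → ∀ {S} → M ≲ S → S ≲ M
      maximal = zorn ≲-isPreorder bound

    M : Relation
    M = proj₁ (proj₁ maximal)

    M-graph : IsGraph M
    M-graph = proj₁ (proj₂ (proj₁ maximal))

    R₀⊆M : ∀ {x} → R₀ x → M x
    R₀⊆M = proj₂ (proj₂ (proj₁ maximal))

    M-maximal : ∀ {S} → IsGraph S → (∀ {x} → M x → S x) → ∀ {x} → S x → M x
    M-maximal {S} g M⊆S = lower (proj₂ maximal {S , g , λ m → M⊆S (R₀⊆M m)} (lift M⊆S))

    total : ∀ z → ∃ λ z′ → M (z , z′)
    total z = conclude (extend M-graph z)
      where
      conclude : (∃ λ S → IsGraph S × (∀ {x} → M x → S x) × ∃ λ z′ → S (z , z′)) → ∃ λ z′ → M (z , z′)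
      conclude (S , g , M⊆S , z′ , m) = z′ , M-maximal g M⊆S m

    -- Graphs are closed under converse, so a preimage is obtained by extending the converse of M at
    -- z and turning the result around.
    surjective : ∀ z → ∃ λ z′ → M (z′ , z)
    surjective z = conclude (extend (converse-graph M-graph) z)
      where
      conclude : (∃ λ S → IsGraph S × (∀ {x} → converse M x → S x) × ∃ λ z′ → S (z , z′)) → ∃ λ z′ → M (z′ , z)
      conclude (S , g , M⊆S , z′ , m) = z′ , M-maximal (converse-graph g) (λ k → M⊆S k) m

    private
      module M = IsGraph M-graph
      act : Carrier → Carrier
      act z = proj₁ (total z)
      graph : ∀ z → M (z , act z)
      graph z = proj₂ (total z)

    isRingIsomorphism : IsRingIsomorphism rawRing rawRing act
    isRingIsomorphism = record
      { isRingMonomorphism = record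
        { isRingHomomorphism = record
          { isSemiringHomomorphism = record
            { isNearSemiringHomomorphism = record
              { +-isMonoidHomomorphism = record
                { isMagmaHomomorphism = record
                  { isRelHomomorphism = record { cong = λ {x} {y} e → M.unique (graph x) (graph y) e }
                  ; homo = λ x y → M.unique (graph (x + y)) (M.+-closed (graph x) (graph y)) refl
                  }
                ; ε-homo = M.unique (graph 0#) M.0-closed refl
                }
              ; *-homo = λ x y → M.unique (graph (x * y)) (M.*-closed (graph x) (graph y)) refl
              }
            ; 1#-homo = M.unique (graph 1#) M.1-closed refl
            }
          ; -‿homo = λ x → M.unique (graph (- x)) (M.-‿closed (graph x)) refl
          }
        ; injective = λ {x} {y} e → IsGraph.unique (converse-graph M-graph) (graph x) (graph y) e
        }
      ; surjective = λ z → proj₁ (surjective z) , λ {w} e → M.unique (graph w) (proj₂ (surjective z)) e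
      }

    act-graph : ∀ {x y} → R₀ (x , y) → act x ≈ y
    act-graph m = M.unique (graph _) (R₀⊆M m) refl

    act-base : ∀ c → act (φ.⟦ c ⟧) ≈ φ.⟦ c ⟧
    act-base c = M.unique (graph _) (M.base c) refl

-- Conjugation in a quadratic extension

module QuadraticLifting (em₁ : ExcludedMiddle (Level.suc 0ℓ)) (zorn : ZornsLemma)
  (em : ∀ {P : Set} → Dec P) {p : ℕ} (F : FiniteExtensionOfℚₚ p)
  (F̄ : AlgebraicClosure (FiniteExtensionOfℚₚ.asField F)) (π : ∣ FiniteExtensionOfℚₚ.asField F ∣) where
  private module F = FiniteExtensionOfℚₚ F
  open MaximalPartialAutomorphisms em₁ zorn em F.asField F̄
  open Galois F F̄ π
  open Adjunction C

  module _ {N : Pred Carrier 0ℓ} (N-subring : Subring C N) (F⊆N : ∀ c → N φ.⟦ c ⟧)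
           {y : Carrier} (y∉N : ¬ N y) {u v : Carrier} (u∈N : N u) (v∈N : N v) (y²≈u+vy : y * y ≈ u + v * y) where
    private
      module N = Subring N-subring

      diagonal : Relation
      diagonal (x , x′) = N x × x ≈ x′

      diagonal-graph : IsGraph diagonal
      diagonal-graph = record
        { subring = record
          { resp     = λ { (e , f) (m , g) → N.resp e m , trans (sym e) (trans g f) }
          ; +-closed = λ { (m , e) (k , f) → N.+-closed m k , +-cong e f }
          ; *-closed = λ { (m , e) (k , f) → N.*-closed m k , *-cong e f }
          ; -‿closed = λ { (m , e) → N.-‿closed m , -‿cong e }
          ; 1-closed = N.1-closed , refl
          }
        ; base = λ c → F⊆N c , refl
        ; function = λ { (_ , e) x≈0 → trans (sym e) x≈0 }
        }

      -- The lower coefficients of X² - vX - u. Both components agree because the identity on N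
      -- fixes them.
      c : Fin 2 → Carrier × Carrier
      c zero       = - u , - u
      c (suc zero) = - v , - v

      c∈ : ∀ i → diagonal (c i)
      c∈ zero       = N.-‿closed u∈N , refl
      c∈ (suc zero) = N.-‿closed v∈N , refl

      root : ∀ {z} → z * z ≈ u + v * z → z ^ 2 + (- u * z ^ 0 + (- v * z ^ 1 + 0#)) ≈ 0#
      root {z} e = trans (+-cong (*-congˡ (*-identityʳ z)) (+-cong (*-identityʳ _) (trans (+-identityʳ _) (*-congˡ (*-identityʳ z)))))
        (trans (+-congʳ e) (trans (S.solve 3 (λ u v z → u :+ v :* z :+ (:- u :+ :- v :* z) := u :+ v :* z :- (u :+ v :* z)) refl u v z)
          (-‿inverseʳ _)))

      conjugate-root : (v - y) * (v - y) ≈ u + v * (v - y)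
      conjugate-root = trans (S.solve 2 (λ v y → (v :- y) :* (v :- y) := y :* y :+ (v :* (v :- y) :- v :* y)) refl v y)
        (trans (+-congʳ y²≈u+vy) (S.solve 4 (λ u v y w → u :+ v :* y :+ (w :- v :* y) := u :+ w) refl u v y (v * (v - y))))

      -- If d₁ were nonzero, y = -d₀/d₁ would lie in N, which has inverses because F̄ is algebraic
      -- over F.
      independent : Independent diagonal-graph y 2
      independent d d∈ e = each (zero-or-unit d₁)
        where
        d₀ = proj₁ (d zero)
        d₁ = proj₁ (d (suc zero))
        flat : d₀ + d₁ * y ≈ 0#
        flat = trans (sym (+-cong (*-identityʳ _) (trans (+-identityʳ _) (*-congˡ (*-identityʳ y))))) e
        each : (d₁ ≈ 0# ⊎ ∃ λ s → d₁ * s ≈ 1#) → ∀ i → proj₁ (d i) ≈ 0#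
        each (inj₁ f) zero       = trans (sym (+-identityʳ _)) (trans (+-congˡ (sym (trans (*-congʳ f) (zeroˡ y)))) flat)
        each (inj₁ f) (suc zero) = f
        each (inj₂ (s , f)) = contradiction (N.resp
            (trans (*-congˡ (inverseˡ-unique _ _ flat)) (trans (S.solve 3 (λ s d y → (:- s) :* (:- (d :* y)) := d :* s :* y) refl s d₁ y)
              (trans (*-congʳ f) (*-identityˡ y))))
            (N.*-closed (N.-‿closed s∈N) (proj₁ (d∈ zero)))) y∉N
          where
          s∈N : N s
          s∈N = AlgebraicOver.subring-inverse em F.asField F̄ N-subring F⊆N (proj₁ (d∈ (suc zero))) f

      R₀ : Relation
      R₀ = adjoined diagonal-graph c c∈ (root y²≈u+vy) (root conjugate-root) independent

      R₀-graph : IsGraph R₀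
      R₀-graph = adjoined-graph diagonal-graph c c∈ (root y²≈u+vy) (root conjugate-root) independent

    conjugation : ∃ λ (g : Automorphism) → Fixes N g × Automorphism.act g y ≈ v - y
    conjugation = record
        { act = λ z → proj₁ (total R₀-graph z)
        ; isRingIsomorphism = isRingIsomorphism R₀-graph
        ; fixesF = act-base R₀-graph
        } ,
      (λ m → act-graph R₀-graph (R⊆adjoined diagonal-graph c c∈ (root y²≈u+vy) (root conjugate-root) independent (m , refl))) ,
      act-graph R₀-graph (w∈adjoined diagonal-graph c c∈ (root y²≈u+vy) (root conjugate-root) independent)

module QuadraticExtension (em : ∀ {P : Set} → Dec P) {p : ℕ} (F : FiniteExtensionOfℚₚ p)
  (F̄ : AlgebraicClosure (FiniteExtensionOfℚₚ.asField F)) (π : ∣ FiniteExtensionOfℚₚ.asField F ∣)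
  (E : Galois.FiniteSubextension F F̄ π 2) where
  private
    module F   = FiniteExtensionOfℚₚ F
    module F̄  = AlgebraicClosure F̄
    module Fʳ  = Ring (FieldOps.commutativeRing F.asField)
    module φ   = RingHomomorphism F̄.ι
    module E   = Galois.FiniteSubextension E
    C = FieldOps.commutativeRing F̄.asField
  open Galois F F̄ π
  open Ring C
  open FieldProperties em F̄.asField

  InF : Pred Carrier 0ℓ
  InF x = ∃ λ a → x ≈ φ.⟦ a ⟧

  InF-subring : Subring C InF
  InF-subring = record
    { resp     = λ { e (a , f) → a , trans (sym e) f }
    ; +-closed = λ { (a , e) (b , f) → a Fʳ.+ b , trans (+-cong e f) (sym (φ.+-homo a b)) }
    ; *-closed = λ { (a , e) (b , f) → a Fʳ.* b , trans (*-cong e f) (sym (φ.*-homo a b)) }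
    ; -‿closed = λ { (a , e) → Fʳ.- a , trans (-‿cong e) (sym (φ.-‿homo a)) }
    ; 1-closed = Fʳ.1# , sym φ.1#-homo
    }

  private module I = Subring InF-subring

  InF-inverse : ∀ {z w} → InF z → z * w ≈ 1# → InF w
  InF-inverse = AlgebraicOver.subring-inverse em F.asField F̄ InF-subring (λ c → c , refl)

  fixes-InF : ∀ g {x} → InF x → Automorphism.act g x ≈ x
  fixes-InF g (a , e) = trans (g.cong e) (trans (g.fixesF a) (sym e))
    where module g = Automorphism g

  module _ {y : Carrier} (y∈E : y ∈ ⌊ E ⌋) (y∉F : ¬ InF y) where
    private
      b₀ = E.basis zero
      b₁ = E.basis (suc zero)

      F+Fy : Pred Carrier 0ℓ
      F+Fy x = ∃₂ λ r s → InF r × InF s × x ≈ r + s * y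

      span : ∀ {x} → x ∈ ⌊ E ⌋ → ∃₂ λ r s → InF r × InF s × x ≈ r * b₀ + s * b₁
      span (c , e) = φ.⟦ c zero ⟧ , φ.⟦ c (suc zero) ⟧ , (_ , refl) , (_ , refl) , trans e (+-congˡ (+-identityʳ _))

    -- Cramer's rule for the coordinates of y and 1 in the basis of E. If Δ vanished, then δy = β
    -- and γy = α; as y is not in F, this forces γ = δ = 0, against 1 = γb₀ + δb₁.
    generated : ∀ {x} → x ∈ ⌊ E ⌋ → F+Fy x
    generated {x} x∈E = solve-for (span y∈E) (span E.1-closed) (span x∈E)
      where
      solve-for : (∃₂ λ r s → InF r × InF s × y ≈ r * b₀ + s * b₁) → (∃₂ λ r s → InF r × InF s × 1# ≈ r * b₀ + s * b₁) →
        (∃₂ λ r s → InF r × InF s × x ≈ r * b₀ + s * b₁) → F+Fy x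
      solve-for (α , β , α∈ , β∈ , y≈) (γ , δ , γ∈ , δ∈ , 1≈) (r , s , r∈ , s∈ , x≈) = finish (zero-or-unit Δ)
        where
        Δ = α * δ - β * γ
        Δb₀ : Δ * b₀ ≈ δ * y - β
        Δb₀ = trans (S.solve 6 (λ α β γ δ b c → (α :* δ :- β :* γ) :* b := δ :* (α :* b :+ β :* c) :- β :* (γ :* b :+ δ :* c)) refl α β γ δ b₀ b₁)
          (+-cong (*-congˡ (sym y≈)) (-‿cong (trans (*-congˡ (sym 1≈)) (*-identityʳ β))))
        Δb₁ : Δ * b₁ ≈ α - γ * y
        Δb₁ = trans (S.solve 6 (λ α β γ δ b c → (α :* δ :- β :* γ) :* c := α :* (γ :* b :+ δ :* c) :- γ :* (α :* b :+ β :* c)) refl α β γ δ b₀ b₁)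
          (+-cong (trans (*-congˡ (sym 1≈)) (*-identityʳ α)) (-‿cong (*-congˡ (sym y≈))))
        not-unit : ∀ {a b} → InF a → InF b → a * y ≈ b → a ≈ 0#
        not-unit {a} {b} a∈ b∈ e = cases (zero-or-unit a)
          where
          cases : (a ≈ 0# ⊎ ∃ λ w → a * w ≈ 1#) → a ≈ 0#
          cases (inj₁ f) = f
          cases (inj₂ (w , f)) = contradiction (I.resp (trans (*-congˡ (sym e)) (trans (sym (*-assoc w a y))
            (trans (*-congʳ (trans (*-comm w a) f)) (*-identityˡ y)))) (I.*-closed (InF-inverse a∈ f) b∈)) y∉F
        finish : (Δ ≈ 0# ⊎ ∃ λ w → Δ * w ≈ 1#) → F+Fy x
        finish (inj₁ Δ≈0) = contradiction (trans 1≈ (trans (+-cong (trans (*-congʳ γ≈0) (zeroˡ _)) (trans (*-congʳ δ≈0) (zeroˡ _))) (+-identityʳ 0#))) 1≉0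
          where
          δ≈0 : δ ≈ 0#
          δ≈0 = not-unit δ∈ β∈ (x∙y⁻¹≈ε⇒x≈y _ _ (trans (sym Δb₀) (trans (*-congʳ Δ≈0) (zeroˡ _))))
          γ≈0 : γ ≈ 0#
          γ≈0 = not-unit γ∈ α∈ (sym (x∙y⁻¹≈ε⇒x≈y _ _ (trans (sym Δb₁) (trans (*-congʳ Δ≈0) (zeroˡ _)))))
        finish (inj₂ (w , e)) = w * (s * α - r * β) , w * (r * δ - s * γ) ,
          I.*-closed w∈ (I.−-closed (I.*-closed s∈ α∈) (I.*-closed r∈ β∈)) ,
          I.*-closed w∈ (I.−-closed (I.*-closed r∈ δ∈) (I.*-closed s∈ γ∈)) ,
          trans (sym (*-identityˡ x)) (trans (*-cong (trans (sym e) (*-comm Δ w)) x≈)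
            (trans (S.solve 6 (λ w D r b s c → w :* D :* (r :* b :+ s :* c) := w :* (r :* (D :* b) :+ s :* (D :* c))) refl w Δ r b₀ s b₁)
              (trans (*-congˡ (+-cong (*-congˡ Δb₀) (*-congˡ Δb₁)))
                (S.solve 8 (λ w r s α β γ δ y → w :* (r :* (δ :* y :- β) :+ s :* (α :- γ :* y)) :=
                  w :* (s :* α :- r :* β) :+ w :* (r :* δ :- s :* γ) :* y) refl w r s α β γ δ y))))
          where
          w∈ : InF w
          w∈ = InF-inverse (I.−-closed (I.*-closed α∈ δ∈) (I.*-closed β∈ γ∈)) e

    fixes : ∀ g → Automorphism.act g y ≈ y → Fixes ⌊ E ⌋ g
    fixes g gy≈y {x} x∈E = conclude (generated x∈E)
      where
      module g = Automorphism g
      conclude : F+Fy x → g.act x ≈ x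
      conclude (r , s , r∈ , s∈ , e) = trans (g.cong e) (trans (g.+-homo _ _)
        (trans (+-cong (fixes-InF g r∈) (trans (g.*-homo _ _) (*-cong (fixes-InF g s∈) gy≈y))) (sym e)))

    quadratic : ∃₂ λ u v → InF u × InF v × y * y ≈ u + v * y
    quadratic = generated (E.*-closed y∈E y∈E)

    module _ {u v : Carrier} (u∈F : InF u) (v∈F : InF v) (y²≈u+vy : y * y ≈ u + v * y) where

      moves : ∀ g → ¬ Automorphism.act g y ≈ y → Automorphism.act g y ≈ v - y
      moves g gy≉y = x∙y⁻¹≈ε⇒x≈y _ _ (no-zero-divisors product (λ e → gy≉y (x∙y⁻¹≈ε⇒x≈y _ _ e)))
        where
        module g = Automorphism g
        z = g.act y
        z²≈u+vz : z * z ≈ u + v * z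
        z²≈u+vz = trans (sym (g.*-homo y y)) (trans (g.cong y²≈u+vy) (trans (g.+-homo _ _)
          (+-cong (fixes-InF g u∈F) (trans (g.*-homo _ _) (*-congʳ (fixes-InF g v∈F))))))
        product : (z - y) * (z - (v - y)) ≈ 0#
        product = trans (S.solve 3 (λ z y v → (z :- y) :* (z :- (v :- y)) := (z :* z :- y :* y) :- (v :* z :- v :* y)) refl z y v)
          (trans (+-congʳ (+-cong z²≈u+vz (-‿cong y²≈u+vy)))
            (trans (S.solve 4 (λ u v z y → ((u :+ v :* z) :- (u :+ v :* y)) :- (v :* z :- v :* y) := u :- u) refl u v z y) (-‿inverseʳ u)))

      -- The nontrivial automorphism of E/F is unique.
      quotient-fixes : ∀ g h → ¬ Automorphism.act g y ≈ y → ¬ Automorphism.act h y ≈ y →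
        Fixes ⌊ E ⌋ (Group._∙_ G g (Group._⁻¹ G h))
      quotient-fixes g h gy≉y hy≉y = fixes (Group._∙_ G g (Group._⁻¹ G h)) (trans (g.cong h⁻¹y) (conjugate g gy≉y))
        where
        module g = Automorphism g
        module h = Automorphism h
        conjugate : ∀ g → ¬ Automorphism.act g y ≈ y → Automorphism.act g (v - y) ≈ y
        conjugate g gy≉y = trans (g′.+-homo _ _) (trans (+-cong (fixes-InF g v∈F) (trans (g′.-‿homo y) (-‿cong (moves g gy≉y))))
          (S.solve 2 (λ v y → v :- (v :- y) := y) refl v y))
          where module g′ = Automorphism g
        h⁻¹y : h.inv y ≈ v - y
        h⁻¹y = h.injective (trans (h.act-inv y) (sym (conjugate h hy≉y)))

-- Traces

module MatrixTraces (C : CommutativeRing 0ℓ 0ℓ) where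
  open Ring C
  open Matrices C

  trace determinant : M₂ → Carrier
  trace A       = e₁₁ A + e₂₂ A
  determinant A = e₁₁ A * e₂₂ A - e₁₂ A * e₂₁ A

  trace-cong : ∀ {A B} → A ≈ₘ B → trace A ≈ trace B
  trace-cong (entrywise a _ _ d) = +-cong a d

  ·-cong : ∀ {A A′ B B′} → A ≈ₘ A′ → B ≈ₘ B′ → A · B ≈ₘ A′ · B′
  ·-cong (entrywise a b c d) (entrywise a′ b′ c′ d′) = entrywise
    (+-cong (*-cong a a′) (*-cong b c′)) (+-cong (*-cong a b′) (*-cong b d′))
    (+-cong (*-cong c a′) (*-cong d c′)) (+-cong (*-cong c b′) (*-cong d d′))

  trace-comm : ∀ A B → trace (A · B) ≈ trace (B · A)
  trace-comm (mat a b c d) (mat e f g h) = S.solve 8 (λ a b c d e f g h →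
    (a :* e :+ b :* g) :+ (c :* f :+ d :* h) := (e :* a :+ f :* c) :+ (g :* b :+ h :* d))
    refl a b c d e f g h

  trace-assoc : ∀ A B D → trace (A · B · D) ≈ trace (A · (B · D))
  trace-assoc (mat a b c d) (mat e f g h) (mat i j k l) = +-cong (entry a b i k) (entry c d j l)
    where
    entry : ∀ a b i k → (a * e + b * g) * i + (a * f + b * h) * k ≈ a * (e * i + f * k) + b * (g * i + h * k)
    entry a b i k = S.solve 8 (λ a b e f g h i k →
      (a :* e :+ b :* g) :* i :+ (a :* f :+ b :* h) :* k :=
      a :* (e :* i :+ f :* k) :+ b :* (g :* i :+ h :* k)) refl a b e f g h i k

  trace-identity : ∀ A → trace (A · 1ₘ) ≈ trace A
  trace-identity (mat a b c d) = +-cong (trans (+-cong (*-identityʳ a) (zeroʳ b)) (+-identityʳ a))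
    (trans (+-cong (zeroʳ c) (*-identityʳ d)) (+-identityˡ d))

  determinant-unit : ∀ {A B} → A · B ≈ₘ 1ₘ → determinant A * determinant B ≈ 1#
  determinant-unit {mat a b c d} {mat e f g h} (entrywise r₁₁ r₁₂ r₂₁ r₂₂) = trans
    (S.solve 8 (λ a b c d e f g h → (a :* d :- b :* c) :* (e :* h :- f :* g) :=
      (a :* e :+ b :* g) :* (c :* f :+ d :* h) :- (a :* f :+ b :* h) :* (c :* e :+ d :* g))
      refl a b c d e f g h)
    (trans (+-cong (trans (*-cong r₁₁ r₂₂) (*-identityˡ 1#)) (-‿cong (trans (*-cong r₁₂ r₂₁) (zeroˡ 0#))))
      (trans (+-congˡ -0#≈0#) (+-identityʳ 1#)))

  antidiagonal-trace : ∀ {a b d a⁻¹ d⁻¹} m n → d * d⁻¹ ≈ 1# →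
    trace (mat a b 0# d · mat 0# m n 0# · mat a⁻¹ (- (a⁻¹ * b * d⁻¹)) 0# d⁻¹) ≈ 0#
  antidiagonal-trace {a} {b} {d} {a⁻¹} {d⁻¹} m n dd⁻¹≈1 = trans
    -- The matrix entry 0 is passed to the solver as a variable o, so a multiple of o remains for
    -- `zeroˡ` to discard. What is left is b n a⁻¹ (1 - d d⁻¹).
    (S.solve 8 (λ a b d x y m n o →
      ((a :* o :+ b :* n) :* x :+ (a :* m :+ b :* o) :* o) :+
      ((o :* o :+ d :* n) :* (:- (x :* b :* y)) :+ (o :* m :+ d :* o) :* y) :=
      (b :* n :* x :- b :* n :* x :* (d :* y)) :+
      o :* (a :* x :+ a :* m :+ b :* o :- o :* (x :* b :* y) :+ m :* y :+ d :* y))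
      refl a b d a⁻¹ d⁻¹ m n 0#)
    (trans (+-cong (trans (+-congˡ (-‿cong (trans (*-congˡ dd⁻¹≈1) (*-identityʳ _)))) (-‿inverseʳ _)) (zeroˡ _)) (+-identityʳ 0#))

  module _ {O : Pred Carrier 0ℓ} (O-subring : Subring C O) (ϖ : Carrier) where
    open Congruences.Modulo C O-subring ϖ

    infix 4 _≡ₘ_
    _≡ₘ_ : Rel M₂ 0ℓ
    _≡ₘ_ = Entrywise (λ x y → I (x - y))

    I-trans : ∀ {x y z} → I (x - y) → I (y - z) → I (x - z)
    I-trans {x} {y} {z} m k = I-resp (S.solve 3 (λ x y z → x :- y :+ (y :- z) := x :- z) refl x y z) (I-+ m k)

    I-sym : ∀ {x y} → I (x - y) → I (y - x)
    I-sym {x} {y} m = I-resp (S.solve 2 (λ x y → :- (x :- y) := y :- x) refl x y) (I-neg m)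

    I-≈ : ∀ {x y} → x ≈ y → I (x - y)
    I-≈ e = I-resp (sym (trans (+-congʳ e) (-‿inverseʳ _))) I-0

    trace-≡ : ∀ {A X Y} → AllEntries O A → X ≡ₘ Y → I (trace (A · X) - trace (A · Y))
    trace-≡ {mat a b c d} {mat e f g h} {mat e′ f′ g′ h′} (allEntries pa pb pc pd) (entrywise r₁₁ r₁₂ r₂₁ r₂₂) = I-resp
      (S.solve 8 (λ ae bg cf dh ae′ bg′ cf′ dh′ → (ae :- ae′) :+ (bg :- bg′) :+ ((cf :- cf′) :+ (dh :- dh′)) :=
        ((ae :+ bg) :+ (cf :+ dh)) :- ((ae′ :+ bg′) :+ (cf′ :+ dh′)))
        refl (a * e) (b * g) (c * f) (d * h) (a * e′) (b * g′) (c * f′) (d * h′))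
      (I-+ (I-+ (scale pa r₁₁) (scale pb r₂₁)) (I-+ (scale pc r₁₂) (scale pd r₂₂)))
      where
      scale : ∀ {a x y} → O a → I (x - y) → I (a * x - a * y)
      scale {a} {x} {y} m k = I-resp (S.solve 3 (λ a x y → a :* (x :- y) := a :* x :- a :* y) refl a x y) (I-* m k)

    -- The chain is tr B ≡ tr BPQ = tr QBP ≡ tr QPA = tr AQP ≡ tr A. In each congruence the factor
    -- kept fixed has entries in O.
    similar-trace : ∀ {A B P Q} → AllEntries O A → AllEntries O B → AllEntries O P → AllEntries O Q →
      P · Q ≡ₘ 1ₘ → Q · P ≡ₘ 1ₘ → (P · A) ≡ₘ (B · P) → I (trace B - trace A)
    similar-trace {A} {B} {P} {Q} A∈ B∈ P∈ Q∈ PQ≡1 QP≡1 PA≡BP =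
      I-trans (I-≈ (sym (trace-identity B)))
      (I-trans (I-sym (trace-≡ B∈ PQ≡1))
      (I-trans (I-≈ (trans (sym (trace-assoc B P Q)) (trace-comm (B · P) Q)))
      (I-trans (I-sym (trace-≡ Q∈ PA≡BP))
      (I-trans (I-≈ (trans (sym (trace-assoc Q P A)) (trace-comm (Q · P) A)))
      (I-trans (trace-≡ A∈ QP≡1) (I-≈ (trace-identity A)))))))

-- An inertia element acting nontrivially on E

inertia-moves : ExcludedMiddle (Level.suc 0ℓ) → ZornsLemma → (em : ∀ {P : Set} → Dec P) → ∀ {p n} →
  Prime p → p ≢ 2 → (F : FiniteExtensionOfℚₚ p) (F̄ : AlgebraicClosure (FiniteExtensionOfℚₚ.asField F))
  (π : ∣ FiniteExtensionOfℚₚ.asField F ∣) → UniformiserOf F π → ResidueOrder F π (suc n) →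
  let open Galois F F̄ π in
  (Φ : Automorphism) → IsFrobenius (suc n) Φ →
  (E : FiniteSubextension 2) → Ramified E →
  (s : Automorphism) → ¬ Fixes ⌊ E ⌋ s →
  ∃ λ (τ : Inertia) → Fixes ⌊ E ⌋ (Group._∙_ G (proj₁ τ) (Group._⁻¹ G s))
inertia-moves em₁ zorn em {p} p-prime p≢2 F F̄ π π-unif residue Φ frob E ramified s s-moves =
  choose (ramified⇒∉Fⁿʳ E ramified)
  where
  open MaximalUnramifiedValuation em p-prime F F̄ π π-unif residue Φ frob using (ramified⇒∉Fⁿʳ)
  open MaximalUnramified em F F̄ π π-unif residue Φ frob using (base; base-unramified)
  open Galois F F̄ π
  module F̄ = AlgebraicClosure F̄
  module φ = RingHomomorphism F̄.ι
  C = FieldOps.commutativeRing F̄.asField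
  open Ring C
  open QuadraticExtension em F F̄ π E

  InF⊆Fⁿʳ : ∀ {x} → InF x → Fⁿʳ x
  InF⊆Fⁿʳ (a , e) = incl base base-unramified ((λ _ → a) , trans e (sym (trans (+-identityʳ _) (*-identityʳ _))))

  Fⁿʳ-subring : Subring C Fⁿʳ
  Fⁿʳ-subring = record
    { resp = resp ; +-closed = +-clos ; *-closed = *-clos ; -‿closed = -‿clos
    ; 1-closed = InF⊆Fⁿʳ (Subring.1-closed InF-subring) }

  choose : (∃ λ y → y ∈ ⌊ E ⌋ × ¬ Fⁿʳ y) → ∃ λ (τ : Inertia) → Fixes ⌊ E ⌋ (Group._∙_ G (proj₁ τ) (Group._⁻¹ G s))
  choose (y , y∈E , y∉Fⁿʳ) = lifted (quadratic y∈E y∉F)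
    where
    y∉F : ¬ InF y
    y∉F m = y∉Fⁿʳ (InF⊆Fⁿʳ m)

    lifted : (∃₂ λ u v → InF u × InF v × y * y ≈ u + v * y) → _
    lifted (u , v , u∈F , v∈F , e) = conclude (QuadraticLifting.conjugation em₁ zorn em F F̄ π
        Fⁿʳ-subring (λ c → InF⊆Fⁿʳ (c , refl)) y∉Fⁿʳ (InF⊆Fⁿʳ u∈F) (InF⊆Fⁿʳ v∈F) e)
      where
      conclude : (∃ λ (g : Automorphism) → Fixes Fⁿʳ g × Automorphism.act g y ≈ v - y) → _
      conclude (g , g-inertial , gy≈v-y) = (g , λ {x} → g-inertial {x}) ,
          λ {x} → quotient-fixes y∈E y∉F u∈F v∈F e g s gy≉y (λ sy≈y → s-moves (fixes y∈E y∉F s sy≈y)) {x}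
        where
        -- If y = v - y then y = v/2 lies in F.
        gy≉y : ¬ Automorphism.act g y ≈ y
        gy≉y gy≈y = halve (PadicImage.half-integral (FiniteExtensionOfℚₚ.asField F) (FiniteExtensionOfℚₚ.ι F) p-prime p≢2)
          where
          module Fʳ = Ring (FieldOps.commutativeRing (FiniteExtensionOfℚₚ.asField F))
          halve : (∃ λ h → Integers.Integral (FiniteExtensionOfℚₚ.asField F) (FiniteExtensionOfℚₚ.ι F) h × (Fʳ.1# Fʳ.+ Fʳ.1#) Fʳ.* h Fʳ.≈ Fʳ.1#) → ⊥
          halve (h , _ , f) = y∉F (Subring.resp InF-subring
            (trans (*-congˡ (sym (trans (+-congʳ (trans (sym gy≈y) gy≈v-y)) (S.solve 2 (λ v y → v :- y :+ y := v) refl v y))))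
              (trans (*-congˡ (trans (+-cong (sym (*-identityˡ y)) (sym (*-identityˡ y))) (sym (distribʳ y 1# 1#))))
                (trans (S.solve 3 (λ h t y → h :* (t :* y) := t :* h :* y) refl φ.⟦ h ⟧ (1# + 1#) y)
                  (trans (*-congʳ (trans (*-congʳ (sym (trans (φ.+-homo _ _) (+-cong φ.1#-homo φ.1#-homo))))
                    (trans (sym (φ.*-homo _ _)) (trans (φ.⟦⟧-cong f) φ.1#-homo)))) (*-identityˡ y)))))
            (Subring.*-closed InF-subring (h , refl) v∈F))

-- Comparison of traces at an inertia element

module InertialTrace (em : ∀ {P : Set} → Dec P) {p ℓ q : ℕ} (ℓ-prime : Prime ℓ) (ℓ≢2 : ℓ ≢ 2)
  (F : FiniteExtensionOfℚₚ p) (F̄ : AlgebraicClosure (FiniteExtensionOfℚₚ.asField F))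
  (π : ∣ FiniteExtensionOfℚₚ.asField F ∣) (Φ : Galois.Automorphism F F̄ π)
  (K : FiniteExtensionOfℚₚ ℓ) (Ω : AlgebraicClosure (FiniteExtensionOfℚₚ.asField K))
  (ϖ : ∣ FiniteExtensionOfℚₚ.asField K ∣) (ϖ-uniformiser : UniformiserOf K ϖ) where
  open Galois F F̄ π
  open Weil Φ
  open Representations F F̄ π Φ K Ω ϖ
  private
    module K   = FiniteExtensionOfℚₚ K
    module Ω   = AlgebraicClosure Ω
    module Kʳ  = Ring (FieldOps.commutativeRing K.asField)
    module M   = Matrices (FieldOps.commutativeRing K.asField)
    module KT  = MatrixTraces (FieldOps.commutativeRing K.asField)
    module φ   = RingHomomorphism Ω.ι
    module Hom = FieldHomomorphism em K.asField Ω.asField Ω.ι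
    module 𝓞K  = Integers K.asField K.ι
    module ϖ   = 𝓞K.IsUniformiser ϖ-uniformiser
    module I   = Subring (PadicImage.Integral-subring K.asField K.ι)
    C = FieldOps.commutativeRing Ω.asField
    open MonoidHomomorphism using () renaming (⟦_⟧ to ⟪_⟫)
  open Ring C
  open Matrices C
  open MatrixTraces C
  open Congruences.Modulo (FieldOps.commutativeRing K.asField) (PadicImage.Integral-subring K.asField K.ι) ϖ using (I-resp; I-*) renaming (I to ϖ∣_)

  module _
    (ω : Character W_F) (norm : IsNormCharacter q ω) (t : InertiaCharacter)
    (E : FiniteSubextension 2) (σ : W)
    (ρ₁ ρ₂ : Representation) (integral₁ : Integrality ρ₁) (integral₂ : Integrality ρ₂)
    (ξ : Character (W_E E)) (Indξ : Representation) (induced : IsInduced E σ ξ Indξ)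
    (χ : Character W_F) (U₁ U₂ : UpperTriangularGL₂K)
    (conjugate : ConjugateBy U₁ ρ₁ Indξ) (form : HasSpecialForm U₂ t ω χ ρ₂)
    (τ : Inertia) (τσ⁻¹-fixes : Fixes ⌊ E ⌋ (Group._∙_ G (proj₁ τ) (Group._⁻¹ G (proj₁ σ)))) where

    w : W
    w = Φ^ (+ 0) · τ

    h : Group.Carrier (W_E E)
    h = w ∘ʷ (σ ⁻¹ʷ) , λ {x} → τσ⁻¹-fixes {x}

    -- The coset condition on τ makes `h` = τσ⁻¹ an element of W_E, so the formula for the induced
    -- representation at hσ applies to τ.
    Indξ-w : ∃₂ λ m n → ⟪ Indξ ⟫ w ≈ₘ mat 0# m n 0#
    Indξ-w = antidiagonal (proj₂ (induced h))
      where
      hσ≈w : Group._≈_ W_F w (proj₁ h ∘ʷ σ)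
      hσ≈w x = Automorphism.cong (proj₁ w) (FieldOps.sym (AlgebraicClosure.asField F̄) (Automorphism.inv-act (proj₁ σ) x))
      antidiagonal : ∀ {m n} → ⟪ Indξ ⟫ (proj₁ h ∘ʷ σ) ≈ₘ mat 0# m n 0# → ∃₂ λ m n → ⟪ Indξ ⟫ w ≈ₘ mat 0# m n 0#
      antidiagonal {m} {n} (entrywise a b c d) = m , n , transfer (MonoidHomomorphism.⟦⟧-cong Indξ {w} {proj₁ h ∘ʷ σ} hσ≈w)
        where
        transfer : ⟪ Indξ ⟫ w ≈ₘ ⟪ Indξ ⟫ (proj₁ h ∘ʷ σ) → ⟪ Indξ ⟫ w ≈ₘ mat 0# m n 0#
        transfer (entrywise a′ b′ c′ d′) = entrywise (trans a′ a) (trans b′ b) (trans c′ c) (trans d′ d)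

    A B : M.M₂
    A = proj₁ (integral₁ w)
    B = proj₁ (integral₂ w)

    φ-injective : ∀ {x y} → φ.⟦ x ⟧ ≈ φ.⟦ y ⟧ → x Kʳ.≈ y
    φ-injective {x} {y} e = Kʳ.x∙y⁻¹≈ε⇒x≈y x y (Hom.hom-injective
      (trans (φ.+-homo _ _) (trans (+-cong e (φ.-‿homo y)) (-‿inverseʳ _))))

    trace-A : KT.trace A Kʳ.≈ Kʳ.0#
    trace-A = φ-injective (trans (φ.+-homo _ _) (trans (trace-cong (proj₂ (proj₂ (integral₁ w))))
      (trans (trace-cong (conjugate (+ 0) τ)) (trans (vanish Indξ-w) (sym φ.0#-homo)))))
      where
      open UpperTriangularGL₂K U₁
      vanish : (∃₂ λ m n → ⟪ Indξ ⟫ w ≈ₘ mat 0# m n 0#) → trace (matrix · ⟪ Indξ ⟫ w · inverse) ≈ 0#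
      vanish (m , n , e) = trans (trace-cong (·-cong {matrix · ⟪ Indξ ⟫ w} {V · mat 0# m n 0#} {inverse} {V⁻¹}
          (·-cong {matrix} {V} {⟪ Indξ ⟫ w} {mat 0# m n 0#} (entrywise refl refl φ.0#-homo refl) e)
          (entrywise refl (trans (φ.-‿homo _) (-‿cong (trans (φ.*-homo _ _) (*-congʳ (φ.*-homo _ _))))) φ.0#-homo refl)))
        (antidiagonal-trace m n (trans (sym (φ.*-homo d d⁻¹)) (trans (φ.⟦⟧-cong d-inv) φ.1#-homo)))
        where
        V V⁻¹ : M₂
        V   = mat φ.⟦ a ⟧ φ.⟦ b ⟧ 0# φ.⟦ d ⟧
        V⁻¹ = mat φ.⟦ a⁻¹ ⟧ (- (φ.⟦ a⁻¹ ⟧ * φ.⟦ b ⟧ * φ.⟦ d⁻¹ ⟧)) 0# φ.⟦ d⁻¹ ⟧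

    -- On inertia ω is 1, so both diagonal entries are χ(τ). The relation is phrased with the
    -- determinant because that is a unit of 𝓞_K by the integrality of B and its inverse.
    trace-B : KT.trace B Kʳ.* KT.trace B Kʳ.≈ (Kʳ.1# Kʳ.+ Kʳ.1#) Kʳ.* ((Kʳ.1# Kʳ.+ Kʳ.1#) Kʳ.* KT.determinant B)
    trace-B = φ-injective (compare (proj₂ (proj₂ (integral₂ w))) (form (+ 0) τ))
      where
      x = ⟪ χ ⟫ w
      ω≈1 : ⟪ ω ⟫ w ≈ 1#
      ω≈1 = proj₂ (norm 0 τ)
      two : φ.⟦ Kʳ.1# Kʳ.+ Kʳ.1# ⟧ ≈ 1# + 1#
      two = trans (φ.+-homo _ _) (+-cong φ.1#-homo φ.1#-homo)
      compare : ∀ {y} → mat φ.⟦ M.e₁₁ B ⟧ φ.⟦ M.e₁₂ B ⟧ φ.⟦ M.e₂₁ B ⟧ φ.⟦ M.e₂₂ B ⟧ ≈ₘ ⟪ ρ₂ ⟫ w → ⟪ ρ₂ ⟫ w ≈ₘ mat (x * ⟪ ω ⟫ w) y 0# x →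
        φ.⟦ KT.trace B Kʳ.* KT.trace B ⟧ ≈ φ.⟦ (Kʳ.1# Kʳ.+ Kʳ.1#) Kʳ.* ((Kʳ.1# Kʳ.+ Kʳ.1#) Kʳ.* KT.determinant B) ⟧
      compare (entrywise a _ c d) (entrywise a′ _ c′ d′) = trans (φ.*-homo _ _) (trans (*-cong tr tr)
          (trans (S.solve 2 (λ o x → (x :+ x) :* (x :+ x) := x :* x :+ x :* x :+ (x :* x :+ x :* x)) refl 1# x)
          (sym (trans (φ.*-homo _ _) (trans (*-cong two (trans (φ.*-homo _ _) (*-cong two det)))
            (trans (*-congˡ (double _)) (double _)))))))
        where
        double : ∀ z → (1# + 1#) * z ≈ z + z
        double z = trans (distribʳ z 1# 1#) (+-cong (*-identityˡ z) (*-identityˡ z))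
        b₁₁ : φ.⟦ M.e₁₁ B ⟧ ≈ x
        b₁₁ = trans a (trans a′ (trans (*-congˡ ω≈1) (*-identityʳ x)))
        tr : φ.⟦ KT.trace B ⟧ ≈ x + x
        tr = trans (φ.+-homo _ _) (+-cong b₁₁ (trans d d′))
        det : φ.⟦ KT.determinant B ⟧ ≈ x * x
        det = trans (φ.+-homo _ _) (trans (+-cong (trans (φ.*-homo _ _) (*-cong b₁₁ (trans d d′)))
            (trans (φ.-‿homo _) (-‿cong (trans (φ.*-homo _ _) (trans (*-congˡ (trans c c′)) (zeroʳ _))))))
          (trans (+-congˡ -0#≈0#) (+-identityʳ _)))

    ϖ∤1 : ¬ ϖ∣ Kʳ.1#
    ϖ∤1 (z , m , e) = ϖ.proper (z , (_ , m) , e)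

    -- tr² = 4 det, so ϖ ∣ tr forces ϖ ∣ 4.
    trace-B-unit : ¬ ϖ∣ KT.trace B
    trace-B-unit ϖ∣tr = ϖ∤1 (divides-one (PadicImage.half-integral K.asField K.ι ℓ-prime ℓ≢2) (proj₁ (proj₂ (integral₂ w))))
      where
      divides-one : (∃ λ h → 𝓞K.Integral h × (Kʳ.1# Kʳ.+ Kʳ.1#) Kʳ.* h Kʳ.≈ Kʳ.1#) → InGL₂𝓞K B → ϖ∣ Kʳ.1#
      -- With h = 1/2 the relation becomes 1 = h² · det B⁻¹ · tr B · tr B.
      divides-one (h , h∈ , e) (M.allEntries a b c d , B⁻¹ , M.allEntries a′ b′ c′ d′ , BB⁻¹≈1 , _) = I-resp
        (Kʳ.trans (Kʳ.trans (Kʳ.*-assoc _ _ _) (Kʳ.*-congˡ trace-B))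
          (Kʳ.trans (Kʳ.S.solve 4 (λ h o D D′ → (h Kʳ.:* h Kʳ.:* D′) Kʳ.:* (o Kʳ.:* (o Kʳ.:* D)) Kʳ.:= (o Kʳ.:* h) Kʳ.:* (o Kʳ.:* h) Kʳ.:* (D Kʳ.:* D′))
              Kʳ.refl h (Kʳ.1# Kʳ.+ Kʳ.1#) (KT.determinant B) (KT.determinant B⁻¹))
            (Kʳ.trans (Kʳ.*-cong (Kʳ.*-cong e e) (KT.determinant-unit {B} {B⁻¹} BB⁻¹≈1)) (Kʳ.trans (Kʳ.*-identityʳ _) (Kʳ.*-identityˡ _)))))
        (I-* (I.*-closed (I.*-closed (I.*-closed h∈ h∈) (I.−-closed (I.*-closed a′ d′) (I.*-closed b′ c′)))
          (I.+-closed a d)) ϖ∣tr)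

    absurd : ∀ {P Q} → M.AllEntries 𝓞K.Integral P → M.AllEntries 𝓞K.Integral Q →
      P M.· Q ≡ϖ M.1ₘ → Q M.· P ≡ϖ M.1ₘ → (∀ w → P M.· proj₁ (integral₁ w) ≡ϖ proj₁ (integral₂ w) M.· P) → ⊥
    absurd P∈ Q∈ PQ≡1 QP≡1 PA≡BP = trace-B-unit (I-resp
      (Kʳ.trans (Kʳ.+-congˡ (Kʳ.trans (Kʳ.-‿cong trace-A) Kʳ.-0#≈0#)) (Kʳ.+-identityʳ _))
      (KT.similar-trace (PadicImage.Integral-subring K.asField K.ι) ϖ
        (proj₁ (proj₁ (proj₂ (integral₁ w)))) (proj₁ (proj₁ (proj₂ (integral₂ w)))) P∈ Q∈ PQ≡1 QP≡1 (PA≡BP w)))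

open FiniteExtensionOfℚₚ using (asField)

proposition3p6 : ExcludedMiddle (Level.suc 0ℓ) → ZornsLemma →
    ∀ {p ℓ q : ℕ} → Prime p → Prime ℓ → p ≢ 2 → ℓ ≢ 2 → p ≢ ℓ →
    (F : FiniteExtensionOfℚₚ p) (F̄ : AlgebraicClosure (asField F)) →
    (π : ∣ asField F ∣) → UniformiserOf F π → ResidueOrder F π q →
    let open Galois F F̄ π in
    (Φ : Automorphism) → IsFrobenius q Φ →
    let open Weil Φ in
    (K : FiniteExtensionOfℚₚ ℓ) (Ω : AlgebraicClosure (asField K)) →
    (ϖ : ∣ asField K ∣) → UniformiserOf K ϖ →
    let open Representations F F̄ π Φ K Ω ϖ in
    (ω : Character (W_F)) → IsNormCharacter q ω →
    (t : InertiaCharacter) → IsTame ω t →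
    (E : FiniteSubextension 2) →
    (σ : W) → ¬ InW_E E σ →
    (ρ₁ ρ₂ : Representation) →
    ContinuousRepresentation ρ₁ → ContinuousRepresentation ρ₂ →
    (integral₁ : Integrality ρ₁) (integral₂ : Integrality ρ₂) →
    (ξ : Character (W_E E)) (Indξ : Representation) →
    IsSupercuspidal E σ t ρ₁ ξ Indξ →
    (χ : Character (W_F)) → IsSpecial t ρ₂ ω χ →
    (U₁ U₂ : UpperTriangularGL₂K) →
    ConjugateBy U₁ ρ₁ Indξ →
    HasSpecialForm U₂ t ω χ ρ₂ →
    UnitOfK (UpperTriangularGL₂K.a/d U₂) →
    Ramified E →
    ¬ ReductionsIsomorphic ρ₁ ρ₂ integral₁ integral₂
-- The class of 0 needs a representative, so the residue order is not zero; the lemmas take it in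
-- the form `suc n`.
proposition3p6 em₁ zorn {p} {ℓ} {zero} p-prime ℓ-prime p≢2 ℓ≢2 p≢ℓ F F̄ π π-unif residue =
  contradiction (Integers.HasResidueOrder.exhaust residue (_ , Subring.0-closed (PadicImage.Integral-subring (asField F) (FiniteExtensionOfℚₚ.ι F)))) λ ()
proposition3p6 em₁ zorn {p} {ℓ} {suc n} p-prime ℓ-prime p≢2 ℓ≢2 p≢ℓ F F̄ π π-unif residue Φ frob K Ω ϖ ϖ-unif
  ω norm t tame E σ σ∉W_E ρ₁ ρ₂ _ _ integral₁ integral₂ ξ Indξ supercuspidal χ special U₁ U₂ conjugate form _ ramified
  (P , Q , P∈ , Q∈ , PQ≡1 , QP≡1 , PA≡BP) =
  InertialTrace.absurd (λ {P} → em {P}) {q = suc n} ℓ-prime ℓ≢2 F F̄ π Φ K Ω ϖ ϖ-unif ω norm t E σ ρ₁ ρ₂ integral₁ integral₂ ξ Indξ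
    (IsSupercuspidal.induced supercuspidal) χ U₁ U₂ conjugate form
    (proj₁ moving) (proj₂ moving) P∈ Q∈ PQ≡1 QP≡1 PA≡BP
  where
  open Representations F F̄ π Φ K Ω ϖ
  -- Excluded middle is assumed one universe higher and is brought down through `Lift`.
  em : ∀ {P : Set} → Dec P
  em {P} with em₁ {Lift (Level.suc 0ℓ) P}
  ... | yes (lift m) = yes m
  ... | no ¬m = no (λ m → ¬m (lift m))

  moving = inertia-moves em₁ zorn em p-prime p≢2 F F̄ π π-unif residue Φ frob E ramified (proj₁ σ) σ∉W_E
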